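{- Let $1\le r\le n$, let $p=(p_1,\dots,p_n)$ be a size vector with $p_1\le p_2\le\cdots\le p_n$, and let $A,B\subseteq S_p$ be an $r$-cross-intersecting pair of families. (1) If $p_1>r+1$, then $|A|\cdot|B|\le\prod_{i=r+1}^n p_i^2$; in case of equality $A=B$ and this family is obtained by fixing $r$ coordinates (i.e. it equals $\{x\in S_p: x_i=a_i \text{ for all } i\in R\}$ for some $R\subseteq[n]$ with $|R|=r$ and some $a_i\in[p_i]$). (2) If $p_1=r+1>4$, then $|A|\cdot|B|\le\prod_{i=r+1}^n p_i^2$; in case of equality $A=B$ and this family is either obtained by fixing $r$ coordinates, or is a Hamming ball of radius $1$ in a set $T$ of $r+2$ coordinates all satisfying $p_i=r+1$ ($i\in T$). (3) There is a function $t$ with $t(r)=r/2+o(r)$ such that if $p_1\ge t(r)$ and $(A,B)$ is a maximal $r$-cross-intersecting pair, then $A$ and $B$ are Hamming balls in some set of at most $r+3$ coordinates.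
   Context: $[m]=\{1,\dots,m\}$. A size vector is a sequence of integers $p=(p_1,\dots,p_n)$ with $p_i\ge 2$ for all $i$; $S_p=[p_1]\times\cdots\times[p_n]$. Two vectors $x,y\in S_p$ are $r$-intersecting if $|\{i: x_i=y_i\}|\ge r$; families $A,B\subseteq S_p$ are $r$-cross-intersecting if every $x\in A$, $y\in B$ are $r$-intersecting. A pair $(A,B)$ of $r$-cross-intersecting families in $S_p$ is maximal if it maximizes $|A|\cdot|B|$ among all $r$-cross-intersecting pairs in $S_p$. For $T\subseteq[n]$, $x_0\in S_p$ and $0\le k\le|T|$, the Hamming ball of radius $k$ around $x_0$ in the coordinates $T$ is $\{x\in S_p: |\{i\in T: x_i\ne (x_0)_i\}|\le k\}$. -}

module Defs where

open import Data.Bool using (Bool; T)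
open import Data.Fin using (Fin; _≟_)
open import Data.Fin.Subset using (Subset; ∣_∣; _∈_; _∩_; ∁)
open import Data.Integer using (+_)
open import Data.List as List using (List; allFin; cartesianProductWith; drop; filterᵇ; length; map)
open import Data.Nat using (ℕ; _*_; _^_; _≤_; _≥_)
open import Data.Nat.ListAction using (product)
open import Data.Product using (Σ; ∃; _×_)
open import Data.Rational as ℚ using (ℚ; 0ℚ)
open import Data.Vec using (Vec; []; _∷_; lookup; tabulate; toList)
open import Data.Vec.Relation.Unary.All using (All; []; _∷_)
open import Data.Vec.Relation.Unary.All.Properties using (lookup⁺)
open import Function using (_⇔_)
open import Relation.Binary.PropositionalEquality using (_≡_)
open import Relation.Nullary.Decidable using (does)

private variable
  n : ℕ

IsSizeVector : Vec ℕ n → Set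
IsSizeVector = All (_≥ 2)

-- An element of All Fin p is a tuple with one entry of Fin pᵢ, the stand-in
-- for [pᵢ] = {1,…,pᵢ}, for each coordinate i.
S : Vec ℕ n → Set
S = All Fin

infix 8 _at_

_at_ : {p : Vec ℕ n} → S p → (i : Fin n) → Fin (lookup p i)
x at i = lookup⁺ x i

vectors : (p : Vec ℕ n) → List (S p)
vectors []      = List.[ [] ]
vectors (q ∷ p) = cartesianProductWith _∷_ (allFin q) (vectors p)

-- Families are subsets of the finite set S p, given by indicator functions;
-- equality of families is therefore pointwise equality _≗_.
Family : Vec ℕ n → Set
Family p = S p → Bool

card : {p : Vec ℕ n} → Family p → ℕ
card {p = p} A = length (filterᵇ A (vectors p))

infix 4 _∈ᶠ_

_∈ᶠ_ : {p : Vec ℕ n} → S p → Family p → Set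
x ∈ᶠ A = T (A x)

agreement : {p : Vec ℕ n} → S p → S p → Subset n
agreement x y = tabulate λ i → does (x at i ≟ y at i)

Intersecting : {p : Vec ℕ n} → ℕ → S p → S p → Set
Intersecting r x y = ∣ agreement x y ∣ ≥ r

CrossIntersecting : {p : Vec ℕ n} → ℕ → Family p → Family p → Set
CrossIntersecting r A B = ∀ x y → x ∈ᶠ A → y ∈ᶠ B → Intersecting r x y

Maximal : {p : Vec ℕ n} → ℕ → Family p → Family p → Set
Maximal {p = p} r A B =
  CrossIntersecting r A B ×
  (∀ (A′ B′ : Family p) → CrossIntersecting r A′ B′ →
    card A′ * card B′ ≤ card A * card B)

-- Only the coordinates of a that lie in R matter.
ObtainedByFixing : {p : Vec ℕ n} → ℕ → Family p → Set
ObtainedByFixing {n} {p} r A =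
  Σ (Subset n) λ R → ∣ R ∣ ≡ r ×
  Σ (S p) λ a → ∀ x → x ∈ᶠ A ⇔ (∀ i → i ∈ R → x at i ≡ a at i)

IsHammingBallAround : {p : Vec ℕ n} → S p → Subset n → ℕ → Family p → Set
IsHammingBallAround x₀ T k A =
  k ≤ ∣ T ∣ × (∀ x → x ∈ᶠ A ⇔ ∣ T ∩ ∁ (agreement x x₀) ∣ ≤ k)

IsHammingBallOfRadius : {p : Vec ℕ n} → ℕ → Subset n → Family p → Set
IsHammingBallOfRadius k T A = ∃ λ x₀ → IsHammingBallAround x₀ T k A

IsHammingBall : {p : Vec ℕ n} → Subset n → Family p → Set
IsHammingBall T A = ∃ λ k → IsHammingBallOfRadius k T A

-- ∏_{i=r+1}^n pᵢ²
productOfSquaresAfter : ℕ → Vec ℕ n → ℕ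
productOfSquaresAfter r p = product (map (_^ 2) (drop r (toList p)))

fromℕ : ℕ → ℚ
fromℕ r = + r ℚ./ 1

-- f(r) = o(r) as r → ∞
LittleO : (ℕ → ℚ) → Set
LittleO f = ∀ ε → 0ℚ ℚ.< ε →
  ∃ λ N → ∀ r → N ≤ r → ℚ.∣ f r ∣ ℚ.≤ ε ℚ.* fromℕ r

-- In a maximal pair (A , B), freeing a coordinate i gives pᵢ² |Aₗ| |Bₘ| ≤ |A| |B| for l ≠ m, where
-- Aₗ is the part of A with xᵢ = l. Hence every coordinate is either irrelevant or has a popular value zᵢ that
-- all but a 1/pᵢ fraction of A and of B share, while any other value has frequency at most
-- 1/(pᵢ(pᵢ - 1)). Comparing the entropy of a uniform element of A, bounded through these
-- frequencies, with |A| |B| ≥ ∏_{i>r} pᵢ² leaves at most r + 3 relevant coordinates. Say there are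
-- r + s of them: union bounds over the coordinates in which some x ∈ A differs from z show
-- that the supports of x ∈ A and y ∈ B relative to z have total size at most s, so by
-- maximality A and B are balls around z with radii adding up to s ≤ 3. For p₁ > r, comparing
-- volumes excludes unequal radii, and radius 1 attains the bound only when all relevant pᵢ equal r + 1.

module Submission where

open import Defs
import Algebra.Properties.CommutativeMonoid.Sum as MonoidSum
import Algebra.Properties.Semiring.Sum as SemiringSum
open import Data.Bool using (Bool; true; false; not; _∧_; _∨_; T; if_then_else_)
open import Data.Bool.Properties using (∧-identityʳ; T?; T-≡; T-∨)
open import Data.Empty using (⊥-elim)
open import Data.Fin using (Fin; zero; suc; _≟_)
open import Data.Fin.Subset using (Subset; ∣_∣; _∈_; _∩_; ∁)
open import Data.Integer as ℤ using (-[1+_])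
import Data.Integer.Properties as ℤ
open import Data.List as List using (List; []; _∷_; filterᵇ; length)
open import Data.List.Properties using (map-++; map-∘; length-map)
open import Data.Nat using (ℕ; zero; suc; _+_; _*_; _∸_; _^_; _≤_; _<_; _>_; z≤n; s≤s; NonZero; >-nonZero; _≤ᵇ_; _≡ᵇ_; ⌊_/2⌋)
import Data.Nat.ListAction as ListAction
import Data.Nat.ListAction.Properties as ListAction
open import Data.Nat.Properties hiding (_≟_)
open import Data.Nat.Induction using (<-rec)
open import Data.Nat.Logarithm using (⌊log₂_⌋; ⌊log₂⌋-mono-≤; ⌊log₂⌊n/2⌋⌋≡⌊log₂n⌋∸1; ⌊log₂[2^n]⌋≡n)
open import Data.Nat.Tactic.RingSolver using (solve-∀)
open import Data.Product using (Σ; ∃; _×_; _,_; proj₁; proj₂; swap)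
open import Data.Rational as ℚ using (ℚ; 0ℚ; ½)
import Data.Rational.Properties as ℚ
import Data.Rational.Unnormalised as ℚᵘ
import Data.Rational.Unnormalised.Properties as ℚᵘ
open import Data.Sum using (_⊎_; inj₁; inj₂)
open import Data.Unit using (tt)
open import Data.Vec as Vec using (Vec; []; _∷_; lookup; head)
import Data.Vec.Properties as Vec
open import Data.Vec.Relation.Unary.All using ([]; _∷_)
open import Data.Vec.Relation.Unary.Linked using (Linked; _∷_)
open import Function using (_∘_; id; mk⇔; Equivalence)
open import Relation.Binary.PropositionalEquality
open import Relation.Nullary using (yes; no; does; ¬_; contradiction)

open import Algebra.Properties.CommutativeSemigroup *-commutativeSemigroup using (x∙yz≈y∙xz)
open SemiringSum +-*-semiring using (sum; ∑-distrib-+; sum-cong-≗; *-distribˡ-sum; *-distribʳ-sum)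
open MonoidSum *-1-commutativeMonoid using ()
  renaming (sum to prod; ∑-distrib-+ to prod-distrib-*; sum-cong-≗ to prod-cong-≗)
open ≤-Reasoning

-- All estimates are multiplied out to inequalities between natural numbers; in the entropy bound,
-- AM-GM over the members of a family replaces the logarithm. Each relevant size k then has to
-- satisfy `Steep r k`. Its ratio r/(r + 4) compares the r sizes that a pair may fix with the r + 4
-- relevant coordinates to be excluded. The sizes at which it holds explain the hypothesis r + 1 > 4
-- and the choice t(r) = r/2 + 4 + 4r/(1 + ⌊log₂ r⌋).
--
-- The tight spot of the union bounds is p₁ = 3, r = 1 with three coordinates in a support: three
-- events of frequency 1/3 may exhaust the whole family. This case gets its own count, based on
-- three events of frequency 1/6.
--
-- The structure theory concerns maximal pairs, the first two claims concern arbitrary ones. A pair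
-- is improved until it cannot be improved further. No search over all families is made, so a
-- maximal pair is obtained only under a double negation, which suffices to prove an inequality of
-- numbers. A pair that attains the bound is then maximal itself.

private variable
  n : ℕ

-- Sums over coordinates and over vectors

⟦_⟧ : Bool → ℕ
⟦ true  ⟧ = 1
⟦ false ⟧ = 0

⟦⟧≤1 : ∀ b → ⟦ b ⟧ ≤ 1
⟦⟧≤1 true  = ≤-refl
⟦⟧≤1 false = z≤n

sum-mono-≤ : {f g : Fin n → ℕ} → (∀ i → f i ≤ g i) → sum f ≤ sum g
sum-mono-≤ {n = zero}  f≤g = z≤n
sum-mono-≤ {n = suc n} f≤g = +-mono-≤ (f≤g zero) (sum-mono-≤ (f≤g ∘ suc))

sum-zero : ∀ n → sum {n} (λ _ → 0) ≡ 0
sum-zero zero    = refl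
sum-zero (suc n) = sum-zero n

sum-const : ∀ n c → sum {n} (λ _ → c) ≡ n * c
sum-const zero    c = refl
sum-const (suc n) c = cong (c +_) (sum-const n c)

member≤sum : (f : Fin n → ℕ) → ∀ i → f i ≤ sum f
member≤sum f zero    = m≤m+n _ _
member≤sum f (suc i) = ≤-trans (member≤sum (f ∘ suc) i) (m≤n+m _ (f zero))

sum-single : ∀ (i : Fin n) (f : Fin n → ℕ) → sum (λ j → ⟦ does (j ≟ i) ⟧ * f j) ≡ f i
sum-single {n = suc n} zero    f = trans (cong₂ _+_ (*-identityˡ (f zero)) (sum-zero n)) (+-identityʳ _)
sum-single (suc i) f = sum-single i (f ∘ suc)

prod-mono-≤ : {f g : Fin n → ℕ} → (∀ i → f i ≤ g i) → prod f ≤ prod g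
prod-mono-≤ {n = zero}  f≤g = ≤-refl
prod-mono-≤ {n = suc n} f≤g = *-mono-≤ (f≤g zero) (prod-mono-≤ (f≤g ∘ suc))

prod-pos : {f : Fin n → ℕ} → (∀ i → 1 ≤ f i) → 1 ≤ prod f
prod-pos {n = zero}  1≤f = ≤-refl
prod-pos {n = suc n} 1≤f = *-mono-≤ (1≤f zero) (prod-pos (1≤f ∘ suc))

^-distrib-* : ∀ a b k → (a * b) ^ k ≡ a ^ k * b ^ k
^-distrib-* a b zero    = refl
^-distrib-* a b (suc k) =
  trans (cong (a * b *_) (^-distrib-* a b k)) ([m*n]*[o*p]≡[m*o]*[n*p] a b (a ^ k) (b ^ k))

prod-^ : (f : Fin n → ℕ) → ∀ k → prod (λ i → f i ^ k) ≡ prod f ^ k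
prod-^ {n = zero}  f k = sym (^-zeroˡ k)
prod-^ {n = suc n} f k =
  trans (cong (f zero ^ k *_) (prod-^ (f ∘ suc) k)) (sym (^-distrib-* (f zero) (prod (f ∘ suc)) k))

∑ : (p : Vec ℕ n) → (S p → ℕ) → ℕ
∑ []      f = f []
∑ (q ∷ p) f = sum λ v → ∑ p λ x → f (v ∷ x)

∑-cong : (p : Vec ℕ n) {f g : S p → ℕ} → f ≗ g → ∑ p f ≡ ∑ p g
∑-cong []      f≗g = f≗g []
∑-cong (q ∷ p) f≗g = sum-cong-≗ λ v → ∑-cong p λ x → f≗g (v ∷ x)

∑-mono-≤ : (p : Vec ℕ n) {f g : S p → ℕ} → (∀ x → f x ≤ g x) → ∑ p f ≤ ∑ p g
∑-mono-≤ []      f≤g = f≤g []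
∑-mono-≤ (q ∷ p) f≤g = sum-mono-≤ λ v → ∑-mono-≤ p λ x → f≤g (v ∷ x)

∑-distrib : (p : Vec ℕ n) (f g : S p → ℕ) → ∑ p (λ x → f x + g x) ≡ ∑ p f + ∑ p g
∑-distrib []      f g = refl
∑-distrib (q ∷ p) f g =
  trans (sum-cong-≗ λ v → ∑-distrib p (λ x → f (v ∷ x)) (λ x → g (v ∷ x)))
        (∑-distrib-+ (λ v → ∑ p λ x → f (v ∷ x)) (λ v → ∑ p λ x → g (v ∷ x)))

∑-*ˡ : (p : Vec ℕ n) → ∀ c (f : S p → ℕ) → ∑ p (λ x → c * f x) ≡ c * ∑ p f
∑-*ˡ []      c f = refl
∑-*ˡ (q ∷ p) c f =
  trans (sum-cong-≗ λ v → ∑-*ˡ p c λ x → f (v ∷ x))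
        (sym (*-distribˡ-sum c λ v → ∑ p λ x → f (v ∷ x)))

∑-*ʳ : (p : Vec ℕ n) → ∀ c (f : S p → ℕ) → ∑ p (λ x → f x * c) ≡ ∑ p f * c
∑-*ʳ p c f = trans (∑-cong p λ x → *-comm (f x) c) (trans (∑-*ˡ p c f) (*-comm c _))

∑-zero : (p : Vec ℕ n) → ∑ p (λ _ → 0) ≡ 0
∑-zero p = ∑-*ˡ p 0 (λ _ → 0)

∑-sum-comm : ∀ {m} (p : Vec ℕ n) (f : Fin m → S p → ℕ) →
  ∑ p (λ x → sum λ i → f i x) ≡ sum λ i → ∑ p (f i)
∑-sum-comm {m = zero}  p f = ∑-zero p
∑-sum-comm {m = suc m} p f =
  trans (∑-distrib p (f zero) _) (cong (∑ p (f zero) +_) (∑-sum-comm p (f ∘ suc)))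

member≤∑ : (p : Vec ℕ n) (f : S p → ℕ) → ∀ x → f x ≤ ∑ p f
member≤∑ []      f []      = ≤-refl
member≤∑ (q ∷ p) f (v ∷ x) =
  ≤-trans (member≤∑ p (λ y → f (v ∷ y)) x) (member≤sum (λ v → ∑ p λ y → f (v ∷ y)) v)

-- The distributive law. The counts of boxes of vectors below rest on it, and for its sake their
-- indicators are written as products over all coordinates.
∑-prod : (p : Vec ℕ n) (w : ∀ i → Fin (lookup p i) → ℕ) →
  ∑ p (λ x → prod λ i → w i (x at i)) ≡ prod λ i → sum (w i)
∑-prod []      w = refl
∑-prod (q ∷ p) w = begin-equality
  sum (λ v → ∑ p λ x → w zero v * prod λ i → w (suc i) (x at i))
    ≡⟨ sum-cong-≗ (λ v → trans (∑-*ˡ p (w zero v) _) (cong (w zero v *_) (∑-prod p λ i → w (suc i)))) ⟩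
  sum (λ v → w zero v * prod λ i → sum (w (suc i)))
    ≡⟨ *-distribʳ-sum (prod λ i → sum (w (suc i))) (w zero) ⟨
  sum (w zero) * (prod λ i → sum (w (suc i))) ∎

set : {p : Vec ℕ n} → S p → (i : Fin n) → Fin (lookup p i) → S p
set {p = q ∷ p} (_ ∷ x) zero    v = v ∷ x
set {p = q ∷ p} (u ∷ x) (suc i) v = u ∷ set x i v

set-at-same : {p : Vec ℕ n} (x : S p) → ∀ i v → set x i v at i ≡ v
set-at-same {p = q ∷ p} (u ∷ x) zero    v = refl
set-at-same {p = q ∷ p} (u ∷ x) (suc i) v = set-at-same x i v

set-at-other : {p : Vec ℕ n} (x : S p) → ∀ {i j} v → i ≢ j → set x i v at j ≡ x at j
set-at-other {p = q ∷ p} (u ∷ x) {zero}  {zero}  v i≢j = contradiction refl i≢j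
set-at-other {p = q ∷ p} (u ∷ x) {zero}  {suc j} v i≢j = refl
set-at-other {p = q ∷ p} (u ∷ x) {suc i} {zero}  v i≢j = refl
set-at-other {p = q ∷ p} (u ∷ x) {suc i} {suc j} v i≢j = set-at-other x v (i≢j ∘ cong suc)

set-at-self : {p : Vec ℕ n} (x : S p) → ∀ i → set x i (x at i) ≡ x
set-at-self {p = q ∷ p} (u ∷ x) zero    = refl
set-at-self {p = q ∷ p} (u ∷ x) (suc i) = cong (u ∷_) (set-at-self x i)

-- Both sides count the vectors of the family whose i-th entry is v, once for each value of a freed i-th entry.
∑-set : (p : Vec ℕ n) (f : S p → ℕ) → ∀ i v →
  ∑ p (λ x → f (set x i v)) ≡ lookup p i * ∑ p (λ x → ⟦ does (x at i ≟ v) ⟧ * f x)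
∑-set (q ∷ p) f zero v = begin-equality
  sum {q} (λ _ → ∑ p λ x → f (v ∷ x))
    ≡⟨ sum-const q _ ⟩
  q * ∑ p (λ x → f (v ∷ x))
    ≡⟨ cong (q *_) (sum-single v (λ u → ∑ p λ x → f (u ∷ x))) ⟨
  q * sum (λ u → ⟦ does (u ≟ v) ⟧ * ∑ p (λ x → f (u ∷ x)))
    ≡⟨ cong (q *_) (sum-cong-≗ λ u → ∑-*ˡ p ⟦ does (u ≟ v) ⟧ (λ x → f (u ∷ x))) ⟨
  q * sum (λ u → ∑ p (λ x → ⟦ does (u ≟ v) ⟧ * f (u ∷ x))) ∎
∑-set (q ∷ p) f (suc i) v =
  trans (sum-cong-≗ λ u → ∑-set p (λ x → f (u ∷ x)) i v)
        (sym (*-distribˡ-sum (lookup p i) (λ u → ∑ p (λ x → ⟦ does (x at i ≟ v) ⟧ * f (u ∷ x)))))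

sumOver : ∀ {a} {X : Set a} → (X → ℕ) → List X → ℕ
sumOver f xs = ListAction.sum (List.map f xs)

sumOver-vectors : (p : Vec ℕ n) (f : S p → ℕ) → sumOver f (vectors p) ≡ ∑ p f
sumOver-vectors []      f = +-identityʳ (f [])
sumOver-vectors (q ∷ p) f = trans (go q id) (sum-cong-≗ λ v → sumOver-vectors p λ x → f (v ∷ x))
  where
  go : ∀ m (g : Fin m → Fin q) →
    sumOver f (List.cartesianProductWith _∷_ (List.tabulate g) (vectors p)) ≡
    sum λ i → sumOver (λ x → f (g i ∷ x)) (vectors p)
  go zero    g = refl
  go (suc m) g = begin-equality
    sumOver f (List.map (g zero ∷_) (vectors p) List.++ rest)
      ≡⟨ cong ListAction.sum (map-++ f (List.map (g zero ∷_) (vectors p)) rest) ⟩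
    ListAction.sum (List.map f (List.map (g zero ∷_) (vectors p)) List.++ List.map f rest)
      ≡⟨ ListAction.sum-++ (List.map f (List.map (g zero ∷_) (vectors p))) _ ⟩
    sumOver f (List.map (g zero ∷_) (vectors p)) + sumOver f rest
      ≡⟨ cong₂ _+_ (cong ListAction.sum (sym (map-∘ {g = f} {f = g zero ∷_} (vectors p)))) (go m (g ∘ suc)) ⟩
    sumOver (λ x → f (g zero ∷ x)) (vectors p) + (sum λ i → sumOver (λ x → f (g (suc i) ∷ x)) (vectors p)) ∎
    where rest = List.cartesianProductWith _∷_ (List.tabulate (g ∘ suc)) (vectors p)

sumOver-filterᵇ : ∀ {a} {X : Set a} (A : X → Bool) f (xs : List X) →
  sumOver f (filterᵇ A xs) ≡ sumOver (λ x → ⟦ A x ⟧ * f x) xs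
sumOver-filterᵇ A f []       = refl
sumOver-filterᵇ A f (x ∷ xs) with A x
... | true  = cong₂ _+_ (sym (+-identityʳ (f x))) (sumOver-filterᵇ A f xs)
... | false = sumOver-filterᵇ A f xs

sumOver-1 : ∀ {a} {X : Set a} (xs : List X) → sumOver (λ _ → 1) xs ≡ length xs
sumOver-1 []       = refl
sumOver-1 (x ∷ xs) = cong suc (sumOver-1 xs)

sumOver-family : {p : Vec ℕ n} (A : Family p) (f : S p → ℕ) →
  sumOver f (filterᵇ A (vectors p)) ≡ ∑ p (λ x → ⟦ A x ⟧ * f x)
sumOver-family {p = p} A f = trans (sumOver-filterᵇ A f (vectors p)) (sumOver-vectors p _)

card≡∑ : {p : Vec ℕ n} (A : Family p) → card A ≡ ∑ p (λ x → ⟦ A x ⟧)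
card≡∑ {p = p} A = trans (sym (sumOver-1 (filterᵇ A (vectors p))))
  (trans (sumOver-family A (λ _ → 1)) (∑-cong p λ x → *-identityʳ ⟦ A x ⟧))

∣∣≡sum : (R : Subset n) → ∣ R ∣ ≡ sum λ i → ⟦ lookup R i ⟧
∣∣≡sum []          = refl
∣∣≡sum (true  ∷ R) = cong suc (∣∣≡sum R)
∣∣≡sum (false ∷ R) = ∣∣≡sum R

∣agreement∣≡sum : {p : Vec ℕ n} (x y : S p) →
  ∣ agreement x y ∣ ≡ sum λ i → ⟦ does (x at i ≟ y at i) ⟧
∣agreement∣≡sum x y = trans (∣∣≡sum (agreement x y))
  (sum-cong-≗ λ i → cong ⟦_⟧ (Vec.lookup∘tabulate (λ i → does (x at i ≟ y at i)) i))

does-≟-comm : ∀ {m} (u v : Fin m) → does (u ≟ v) ≡ does (v ≟ u)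
does-≟-comm u v with u ≟ v | v ≟ u
... | yes _   | yes _   = refl
... | no _    | no _    = refl
... | yes u≡v | no v≢u  = contradiction (sym u≡v) v≢u
... | no u≢v  | yes v≡u = contradiction (sym v≡u) u≢v

CrossIntersecting-sym : {p : Vec ℕ n} {r : ℕ} {A B : Family p} →
  CrossIntersecting r A B → CrossIntersecting r B A
CrossIntersecting-sym {r = r} c y x y∈B x∈A = subst (r ≤_)
  (trans (∣agreement∣≡sum x y)
    (trans (sum-cong-≗ λ i → cong ⟦_⟧ (does-≟-comm (x at i) (y at i))) (sym (∣agreement∣≡sum y x))))
  (c x y x∈A y∈B)

Maximal-sym : {p : Vec ℕ n} {r : ℕ} {A B : Family p} → Maximal r A B → Maximal r B A
Maximal-sym {r = r} {A} {B} (c , max) = CrossIntersecting-sym {r = r} {A} {B} c , λ A′ B′ c′ →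
  subst₂ _≤_ (*-comm (card B′) (card A′)) (*-comm (card A) (card B))
    (max B′ A′ (CrossIntersecting-sym {r = r} {A′} {B′} c′))

-- The pair that fixes the first r coordinates

productOfFirst : ℕ → Vec ℕ n → ℕ
productOfFirst zero    p       = 1
productOfFirst (suc r) []      = 1
productOfFirst (suc r) (q ∷ p) = q * productOfFirst r p

productAfter : ℕ → Vec ℕ n → ℕ
productAfter r p = ListAction.product (List.drop r (Vec.toList p))

productOfFirst*productAfter : ∀ r (p : Vec ℕ n) → productOfFirst r p * productAfter r p ≡ prod (lookup p)
productOfFirst*productAfter zero    []      = refl
productOfFirst*productAfter zero    (q ∷ p) =
  trans (+-identityʳ _) (cong (q *_) (trans (sym (+-identityʳ _)) (productOfFirst*productAfter zero p)))
productOfFirst*productAfter (suc r) []      = refl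
productOfFirst*productAfter (suc r) (q ∷ p) =
  trans (*-assoc q _ _) (cong (q *_) (productOfFirst*productAfter r p))

productOfSquaresAfter≡ : ∀ r (p : Vec ℕ n) →
  productOfSquaresAfter r p ≡ productAfter r p * productAfter r p
productOfSquaresAfter≡ r p = go (List.drop r (Vec.toList p))
  where
  go : ∀ qs → ListAction.product (List.map (_^ 2) qs) ≡ ListAction.product qs * ListAction.product qs
  go []       = refl
  go (q ∷ qs) = trans (cong₂ _*_ (cong (q *_) (*-identityʳ q)) (go qs)) ([m*n]*[o*p]≡[m*o]*[n*p] q q _ _)

fixFirst : {p : Vec ℕ n} → ℕ → S p → Family p
fixFirst zero    z x = true
fixFirst {p = []}    (suc r) []      []      = true
fixFirst {p = q ∷ p} (suc r) (w ∷ z) (v ∷ x) = does (v ≟ w) ∧ fixFirst r z x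

⟦∧⟧ : ∀ b c → ⟦ b ∧ c ⟧ ≡ ⟦ b ⟧ * ⟦ c ⟧
⟦∧⟧ true  c = sym (+-identityʳ ⟦ c ⟧)
⟦∧⟧ false c = refl

∑-1 : (p : Vec ℕ n) → ∑ p (λ _ → 1) ≡ prod (lookup p)
∑-1 []      = refl
∑-1 (q ∷ p) = trans (sum-const q _) (cong (q *_) (∑-1 p))

card-fixFirst : {p : Vec ℕ n} → ∀ r (z : S p) → card (fixFirst r z) ≡ productAfter r p
card-fixFirst {p = p} r z = trans (card≡∑ (fixFirst r z)) (go p r z)
  where
  go : ∀ {n} (p : Vec ℕ n) r (z : S p) → ∑ p (λ x → ⟦ fixFirst r z x ⟧) ≡ productAfter r p
  go p       zero    z       =
    trans (∑-1 p) (trans (sym (productOfFirst*productAfter 0 p)) (+-identityʳ (productAfter 0 p)))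
  go []      (suc r) []      = refl
  go (q ∷ p) (suc r) (w ∷ z) = begin-equality
    sum (λ v → ∑ p λ x → ⟦ does (v ≟ w) ∧ fixFirst r z x ⟧)
      ≡⟨ sum-cong-≗ (λ v → trans (∑-cong p λ x → ⟦∧⟧ (does (v ≟ w)) (fixFirst r z x))
                                 (∑-*ˡ p ⟦ does (v ≟ w) ⟧ (λ x → ⟦ fixFirst r z x ⟧))) ⟩
    sum (λ v → ⟦ does (v ≟ w) ⟧ * ∑ p (λ x → ⟦ fixFirst r z x ⟧))
      ≡⟨ sum-single w (λ _ → ∑ p (λ x → ⟦ fixFirst r z x ⟧)) ⟩
    ∑ p (λ x → ⟦ fixFirst r z x ⟧)
      ≡⟨ go p r z ⟩
    productAfter r p ∎

fixFirst-cross : {p : Vec ℕ n} → ∀ r → r ≤ n → (z : S p) →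
  CrossIntersecting r (fixFirst r z) (fixFirst r z)
fixFirst-cross zero    _ z x y _ _ = z≤n
fixFirst-cross {p = q ∷ p} (suc r) (s≤s r≤n) (w ∷ z) (u ∷ x) (v ∷ y) hx hy
  with u ≟ w | v ≟ w
... | yes refl | yes refl with u ≟ u
...   | yes _  = s≤s (fixFirst-cross r r≤n z x y hx hy)
...   | no u≢u = contradiction refl u≢u

basepoint : {p : Vec ℕ n} → (∀ i → 1 ≤ lookup p i) → S p
basepoint {p = []}        _   = []
basepoint {p = suc q ∷ p} 1≤p = zero ∷ basepoint (1≤p ∘ suc)
basepoint {p = zero ∷ p}  1≤p with () ← 1≤p zero

-- The competitor consists of two copies of the family that fixes the first r coordinates to those
-- of `basepoint`.
Maximal⇒productAfter²≤ : {p : Vec ℕ n} {r : ℕ} {A B : Family p} → (∀ i → 1 ≤ lookup p i) → r ≤ n →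
  Maximal r A B → productAfter r p * productAfter r p ≤ card A * card B
Maximal⇒productAfter²≤ {p = p} {r} 1≤p r≤n (_ , max) =
  subst (λ c → c * c ≤ _) (card-fixFirst r z)
    (max (fixFirst r z) (fixFirst r z) (fixFirst-cross r r≤n z))
  where z = basepoint 1≤p

-- A strict inequality in one term could not be made up for by the others. This is what turns an
-- inclusion of families with reversed cardinalities into an equality.
sum-≤⇒≗ : {f g : Fin n → ℕ} → (∀ i → f i ≤ g i) → sum g ≤ sum f → f ≗ g
sum-≤⇒≗ {n = suc n} {f} {g} f≤g le zero = ≤-antisym (f≤g zero)
  (+-cancelʳ-≤ (sum (g ∘ suc)) (g zero) (f zero)
    (≤-trans le (+-monoʳ-≤ (f zero) (sum-mono-≤ (f≤g ∘ suc)))))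
sum-≤⇒≗ {n = suc n} {f} {g} f≤g le (suc i) = sum-≤⇒≗ (f≤g ∘ suc)
  (+-cancelˡ-≤ (f zero) (sum (g ∘ suc)) (sum (f ∘ suc)) (≤-trans (+-monoˡ-≤ _ (f≤g zero)) le)) i

∑-≤⇒≗ : (p : Vec ℕ n) {f g : S p → ℕ} → (∀ x → f x ≤ g x) → ∑ p g ≤ ∑ p f → f ≗ g
∑-≤⇒≗ []      f≤g le []      = ≤-antisym (f≤g []) le
∑-≤⇒≗ (q ∷ p) f≤g le (v ∷ x) = ∑-≤⇒≗ p (λ y → f≤g (v ∷ y))
  (≤-reflexive (sym (sum-≤⇒≗ (λ u → ∑-mono-≤ p λ y → f≤g (u ∷ y)) le v))) x

⟦⟧-injective : ∀ {b c} → ⟦ b ⟧ ≡ ⟦ c ⟧ → b ≡ c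
⟦⟧-injective {true}  {true}  _ = refl
⟦⟧-injective {false} {false} _ = refl

⟦⟧-mono : ∀ {b c} → (T b → T c) → ⟦ b ⟧ ≤ ⟦ c ⟧
⟦⟧-mono {false}         f = z≤n
⟦⟧-mono {true}  {true}  f = ≤-refl
⟦⟧-mono {true}  {false} f = ⊥-elim (f tt)

card-mono-≤ : {p : Vec ℕ n} (A A′ : Family p) → (∀ x → T (A x) → T (A′ x)) → card A ≤ card A′
card-mono-≤ {p = p} A A′ A⊆A′ = subst₂ _≤_ (sym (card≡∑ A)) (sym (card≡∑ A′))
  (∑-mono-≤ p λ x → ⟦⟧-mono (A⊆A′ x))

⊆∧card≤⇒≗ : {p : Vec ℕ n} (A A′ : Family p) → (∀ x → T (A x) → T (A′ x)) → card A′ ≤ card A → A ≗ A′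
⊆∧card≤⇒≗ {p = p} A A′ A⊆A′ le x = ⟦⟧-injective
  (∑-≤⇒≗ p (λ x → ⟦⟧-mono (A⊆A′ x)) (subst₂ _≤_ (card≡∑ A′) (card≡∑ A) le) x)

-- Popular values and irrelevant coordinates

∣agreement∣-mono : {p : Vec ℕ n} {x y x′ y′ : S p} →
  (∀ i → x at i ≡ y at i → x′ at i ≡ y′ at i) → ∣ agreement x y ∣ ≤ ∣ agreement x′ y′ ∣
∣agreement∣-mono {x = x} {y} {x′} {y′} h =
  subst₂ _≤_ (sym (∣agreement∣≡sum x y)) (sym (∣agreement∣≡sum x′ y′)) (sum-mono-≤ pointwise)
  where
  pointwise : ∀ i → ⟦ does (x at i ≟ y at i) ⟧ ≤ ⟦ does (x′ at i ≟ y′ at i) ⟧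
  pointwise i with x at i ≟ y at i | x′ at i ≟ y′ at i
  ... | no _  | _      = z≤n
  ... | yes _ | yes _  = ≤-refl
  ... | yes e | no ¬e  = contradiction (h i e) ¬e

argmax : ∀ {m} (f : Fin (suc m) → ℕ) → ∃ λ i → ∀ j → f j ≤ f i
argmax {zero}  f = zero , λ { zero → ≤-refl }
argmax {suc m} f with argmax (f ∘ suc)
... | i , max with ≤-total (f zero) (f (suc i))
...   | inj₁ le = suc i , λ { zero → le ; (suc j) → max j }
...   | inj₂ le = zero , λ { zero → ≤-refl ; (suc j) → ≤-trans (max j) le }

-- Two slices of one family can be played against a single slice of the other only if a value
-- different from both is left. This is why sizes are at least 3 from here on.
third : ∀ {k} → 3 ≤ k → (l l′ : Fin k) → ∃ λ m → m ≢ l × m ≢ l′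
third (s≤s (s≤s (s≤s _))) zero          zero          = suc zero , (λ ()) , (λ ())
third (s≤s (s≤s (s≤s _))) zero          (suc zero)    = suc (suc zero) , (λ ()) , (λ ())
third (s≤s (s≤s (s≤s _))) zero          (suc (suc _)) = suc zero , (λ ()) , (λ ())
third (s≤s (s≤s (s≤s _))) (suc zero)    zero          = suc (suc zero) , (λ ()) , (λ ())
third (s≤s (s≤s (s≤s _))) (suc (suc _)) zero          = suc zero , (λ ()) , (λ ())
third (s≤s (s≤s (s≤s _))) (suc _)       (suc _)       = zero , (λ ()) , (λ ())

-- (h a - c)(a - h c) ≥ 0, with the two factors written as X and - Y.
dominant : ∀ h a c → c < h * a → (1 + h) * (1 + h) * (a * c) ≤ h * ((a + c) * (a + c)) → h * c ≤ a
dominant h a c c<ha le = ≮⇒≥ λ a<hc → impossible (m≤n⇒∃[o]m+o≡n c<ha) (m≤n⇒∃[o]m+o≡n a<hc)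
  where
  impossible : (∃ λ X → suc c + X ≡ h * a) → ¬ (∃ λ Y → suc a + Y ≡ h * c)
  impossible (X , eX) (Y , eY) = <⇒≱ strictly le
    where
    e₁ : (c + suc X) * (a + suc Y) ≡ (h * a) * (h * c)
    e₁ = cong₂ _*_ (trans (+-suc c X) eX) (trans (+-suc a Y) eY)
    strictly : h * ((a + c) * (a + c)) < (1 + h) * (1 + h) * (a * c)
    strictly = begin-strict
      h * ((a + c) * (a + c))
        ≡⟨ lhs h a c ⟩
      a * (h * a) + c * (h * c) + 2 * (h * (a * c))
        ≡⟨ cong₂ (λ u v → a * u + c * v + 2 * (h * (a * c))) (sym eX) (sym eY) ⟩
      a * (suc c + X) + c * (suc a + Y) + 2 * (h * (a * c))
        <⟨ m<m+n _ (s≤s z≤n) ⟩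
      a * (suc c + X) + c * (suc a + Y) + 2 * (h * (a * c)) + suc X * suc Y
        ≡⟨ mid h a c X Y ⟩
      (c + suc X) * (a + suc Y) + a * c + 2 * (h * (a * c))
        ≡⟨ cong (λ u → u + a * c + 2 * (h * (a * c))) e₁ ⟩
      (h * a) * (h * c) + a * c + 2 * (h * (a * c))
        ≡⟨ rhs h a c ⟩
      (1 + h) * (1 + h) * (a * c) ∎
      where
      lhs : ∀ h a c → h * ((a + c) * (a + c)) ≡ a * (h * a) + c * (h * c) + 2 * (h * (a * c))
      lhs = solve-∀
      mid : ∀ h a c X Y → a * (suc c + X) + c * (suc a + Y) + 2 * (h * (a * c)) + suc X * suc Y
                          ≡ (c + suc X) * (a + suc Y) + a * c + 2 * (h * (a * c))
      mid = solve-∀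
      rhs : ∀ h a c → (h * a) * (h * c) + a * c + 2 * (h * (a * c)) ≡ (1 + h) * (1 + h) * (a * c)
      rhs = solve-∀

positive-total : ∀ h c a → c < h * a → NonZero (a + c)
positive-total h c zero    lt = contradiction (subst (c <_) (*-zeroʳ h) lt) λ ()
positive-total h c (suc a) lt = _

-- Let α = c/a and β = d/b be the odds against the value in question. The last hypothesis reads 1/(1
-- + α) · β/(1 + β) ≤ h/(1 + h)². As α ≤ β, making both odds equal, to α or to β, only lowers the
-- left side. This leaves a condition on each family separately, to which `dominant` applies.
dominant₂-ordered : ∀ h a c b d → c < h * a → d < h * b → b * c ≤ a * d →
  (1 + h) * (1 + h) * (a * d) ≤ h * ((a + c) * (b + d)) → h * c ≤ a × h * d ≤ b
dominant₂-ordered h a c b d c<ha d<hb bc≤ad ad =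
    dominant h a c c<ha (*-cancelʳ-≤ _ _ (b + d) {{positive-total h d b d<hb}} (begin
      H * (a * c) * (b + d) ≡⟨ e₁ H a b c d ⟩
      H * (a * (b * c) + a * c * d) ≤⟨ *-monoʳ-≤ H (+-monoˡ-≤ (a * c * d) (*-monoʳ-≤ a bc≤ad)) ⟩
      H * (a * (a * d) + a * c * d) ≡⟨ e₂ H a c d ⟩
      H * (a * d) * (a + c) ≤⟨ *-monoˡ-≤ (a + c) ad ⟩
      h * ((a + c) * (b + d)) * (a + c) ≡⟨ e₃ h (a + c) (b + d) ⟩
      h * ((a + c) * (a + c)) * (b + d) ∎))
  , dominant h b d d<hb (*-cancelʳ-≤ _ _ (a + c) {{positive-total h c a c<ha}} (begin
      H * (b * d) * (a + c) ≡⟨ e₄ H a b c d ⟩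
      H * (d * (b * c) + a * b * d) ≤⟨ *-monoʳ-≤ H (+-monoˡ-≤ (a * b * d) (*-monoʳ-≤ d bc≤ad)) ⟩
      H * (d * (a * d) + a * b * d) ≡⟨ e₅ H a b d ⟩
      H * (a * d) * (b + d) ≤⟨ *-monoˡ-≤ (b + d) ad ⟩
      h * ((a + c) * (b + d)) * (b + d) ≡⟨ e₆ h (a + c) (b + d) ⟩
      h * ((b + d) * (b + d)) * (a + c) ∎))
  where
  H = (1 + h) * (1 + h)
  e₁ : ∀ H a b c d → H * (a * c) * (b + d) ≡ H * (a * (b * c) + a * c * d)
  e₁ = solve-∀
  e₂ : ∀ H a c d → H * (a * (a * d) + a * c * d) ≡ H * (a * d) * (a + c)
  e₂ = solve-∀
  e₃ : ∀ h u v → h * (u * v) * u ≡ h * (u * u) * v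
  e₃ = solve-∀
  e₄ : ∀ H a b c d → H * (b * d) * (a + c) ≡ H * (d * (b * c) + a * b * d)
  e₄ = solve-∀
  e₅ : ∀ H a b d → H * (d * (a * d) + a * b * d) ≡ H * (a * d) * (b + d)
  e₅ = solve-∀
  e₆ : ∀ h u v → h * (u * v) * v ≡ h * (v * v) * u
  e₆ = solve-∀

dominant₂ : ∀ h a c b d → c < h * a → d < h * b →
  (1 + h) * (1 + h) * (a * d) ≤ h * ((a + c) * (b + d)) →
  (1 + h) * (1 + h) * (b * c) ≤ h * ((a + c) * (b + d)) → h * c ≤ a × h * d ≤ b
dominant₂ h a c b d c<ha d<hb ad bc with ≤-total (b * c) (a * d)
... | inj₁ le = dominant₂-ordered h a c b d c<ha d<hb le ad
... | inj₂ le with hd≤b , hc≤a ← dominant₂-ordered h b d a c d<hb c<ha le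
                     (subst (λ t → (1 + h) * (1 + h) * (b * c) ≤ h * t) (*-comm (a + c) (b + d)) bc) = hc≤a , hd≤b

slice : {p : Vec ℕ n} → Family p → (i : Fin n) → Fin (lookup p i) → ℕ
slice {p = p} A i v = ∑ p λ x → ⟦ does (x at i ≟ v) ⟧ * ⟦ A x ⟧

offSlice : {p : Vec ℕ n} → Family p → (i : Fin n) → Fin (lookup p i) → ℕ
offSlice {p = p} A i v = ∑ p λ x → ⟦ not (does (x at i ≟ v)) ⟧ * ⟦ A x ⟧

-- Testing membership after overwriting entry i amounts to taking the slice at v and refilling its
-- i-th entry with every possible value.
free : {p : Vec ℕ n} → Family p → (i : Fin n) → Fin (lookup p i) → Family p
free A i v x = A (set x i v)

card-free : {p : Vec ℕ n} (A : Family p) → ∀ i v → card (free A i v) ≡ lookup p i * slice A i v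
card-free {p = p} A i v = trans (card≡∑ (free A i v)) (∑-set p (λ x → ⟦ A x ⟧) i v)

slice+offSlice : {p : Vec ℕ n} (A : Family p) → ∀ i v → slice A i v + offSlice A i v ≡ card A
slice+offSlice {p = p} A i v = trans (sym (∑-distrib p _ _))
  (trans (∑-cong p λ x → split (does (x at i ≟ v)) ⟦ A x ⟧) (sym (card≡∑ A)))
  where
  split : ∀ b c → ⟦ b ⟧ * c + ⟦ not b ⟧ * c ≡ c
  split true  c = trans (+-identityʳ _) (+-identityʳ c)
  split false c = +-identityʳ c

sum-indicator* : ∀ {m} (f : Fin m → Bool) (c : ℕ) (u : Fin m) →
  (∀ v → f v ≡ does (u ≟ v)) → sum (λ v → ⟦ f v ⟧ * c) ≡ c
sum-indicator* f c u eq = trans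
  (sum-cong-≗ λ v → cong (λ b → ⟦ b ⟧ * c) (trans (eq v) (does-≟-comm u v)))
  (sum-single u (λ _ → c))

sum-slice : {p : Vec ℕ n} (A : Family p) → ∀ i → sum (slice A i) ≡ card A
sum-slice {p = p} A i = trans (sym (∑-sum-comm p λ v x → ⟦ does (x at i ≟ v) ⟧ * ⟦ A x ⟧))
  (trans (∑-cong p λ x → sum-indicator* _ ⟦ A x ⟧ (x at i) λ v → refl) (sym (card≡∑ A)))

offSlice≡sum : {p : Vec ℕ n} (A : Family p) → ∀ i l →
  offSlice A i l ≡ sum λ v → ⟦ not (does (v ≟ l)) ⟧ * slice A i v
offSlice≡sum {p = p} A i l = sym (begin-equality
  sum (λ v → ⟦ not (does (v ≟ l)) ⟧ * slice A i v)
    ≡⟨ sum-cong-≗ (λ v → ∑-*ˡ p ⟦ not (does (v ≟ l)) ⟧ (λ x → ⟦ does (x at i ≟ v) ⟧ * ⟦ A x ⟧)) ⟨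
  sum (λ v → ∑ p λ x → ⟦ not (does (v ≟ l)) ⟧ * (⟦ does (x at i ≟ v) ⟧ * ⟦ A x ⟧))
    ≡⟨ ∑-sum-comm p (λ v x → ⟦ not (does (v ≟ l)) ⟧ * (⟦ does (x at i ≟ v) ⟧ * ⟦ A x ⟧)) ⟨
  ∑ p (λ x → sum λ v → ⟦ not (does (v ≟ l)) ⟧ * (⟦ does (x at i ≟ v) ⟧ * ⟦ A x ⟧))
    ≡⟨ ∑-cong p (λ x → trans
         (sum-cong-≗ λ v → trans (x∙yz≈y∙xz ⟦ not (does (v ≟ l)) ⟧ ⟦ does (x at i ≟ v) ⟧ ⟦ A x ⟧)
           (cong (λ b → ⟦ b ⟧ * (⟦ not (does (v ≟ l)) ⟧ * ⟦ A x ⟧)) (does-≟-comm (x at i) v)))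
         (sum-single (x at i) (λ v → ⟦ not (does (v ≟ l)) ⟧ * ⟦ A x ⟧))) ⟩
  offSlice A i l ∎)

record Popular {p : Vec ℕ n} (A : Family p) (i : Fin n) (l : Fin (lookup p i)) : Set where
  field
    rare   : lookup p i * offSlice A i l ≤ card A
    scarce : ∀ v → v ≢ l → lookup p i * ((lookup p i ∸ 1) * slice A i v) ≤ card A

Irrelevant : {p : Vec ℕ n} → Family p → Fin n → Set
Irrelevant {p = p} A i = ∀ x v → A (set x i v) ≡ A x

record MaximalPair {p : Vec ℕ n} (r : ℕ) (A B : Family p) : Set where
  field
    maximal : Maximal r A B
    card>0ˡ : 1 ≤ card A
    card>0ʳ : 1 ≤ card B

MaximalPair-sym : {p : Vec ℕ n} {r : ℕ} {A B : Family p} → MaximalPair r A B → MaximalPair r B A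
MaximalPair-sym {A = A} {B} c = record
  { maximal = Maximal-sym {A = A} {B} maximal ; card>0ˡ = card>0ʳ ; card>0ʳ = card>0ˡ }
  where open MaximalPair c

⟦∨⟧≥ˡ : ∀ b c → T b → T (b ∨ c)
⟦∨⟧≥ˡ true c _ = tt

sum-not-≟ : ∀ {h} (l : Fin (suc h)) c → sum (λ v → ⟦ not (does (v ≟ l)) ⟧ * c) ≡ h * c
sum-not-≟ {h} l c = +-cancelˡ-≡ c _ _ (begin-equality
  c + sum (λ v → ⟦ not (does (v ≟ l)) ⟧ * c)
    ≡⟨ cong (_+ sum (λ v → ⟦ not (does (v ≟ l)) ⟧ * c)) (sum-single l (λ _ → c)) ⟨
  sum (λ v → ⟦ does (v ≟ l) ⟧ * c) + sum (λ v → ⟦ not (does (v ≟ l)) ⟧ * c)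
    ≡⟨ ∑-distrib-+ (λ v → ⟦ does (v ≟ l) ⟧ * c) (λ v → ⟦ not (does (v ≟ l)) ⟧ * c) ⟨
  sum (λ v → ⟦ does (v ≟ l) ⟧ * c + ⟦ not (does (v ≟ l)) ⟧ * c)
    ≡⟨ sum-cong-≗ (λ v → split (does (v ≟ l))) ⟩
  sum {suc h} (λ v → c)
    ≡⟨ sum-const (suc h) c ⟩
  c + h * c ∎)
  where
  split : ∀ b → ⟦ b ⟧ * c + ⟦ not b ⟧ * c ≡ c
  split true  = trans (+-identityʳ _) (+-identityʳ c)
  split false = +-identityʳ c

module Coordinate {p : Vec ℕ n} {r : ℕ} {A B : Family p} (cross : MaximalPair r A B) (i : Fin n) where

  open MaximalPair cross

  private
    k = lookup p i
    a = slice A i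
    b = slice B i
    instance
      cardA≢0 : NonZero (card A)
      cardA≢0 = >-nonZero card>0ˡ
      cardB≢0 : NonZero (card B)
      cardB≢0 = >-nonZero card>0ʳ

  -- After overwriting with different values, coordinate i is a disagreement. All r agreements
  -- therefore lie elsewhere, where x and y were not touched.
  free-cross : ∀ {l m} → l ≢ m → CrossIntersecting r (free A i l) (free B i m)
  free-cross {l} {m} l≢m x y x∈ y∈ =
    ≤-trans (proj₁ maximal _ _ x∈ y∈) (∣agreement∣-mono {x = set x i l} {set y i m} {x} {y} λ j e → agree j e)
    where
    agree : ∀ j → set x i l at j ≡ set y i m at j → x at j ≡ y at j
    agree j e with i ≟ j
    ... | yes refl = contradiction (trans (sym (set-at-same x i l)) (trans e (set-at-same y i m))) l≢m
    ... | no i≢j   = trans (sym (set-at-other x l i≢j)) (trans e (set-at-other y m i≢j))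

  swap-≤ : ∀ {l m} → l ≢ m → k * a l * (k * b m) ≤ card A * card B
  swap-≤ {l} {m} l≢m = subst₂ (λ c d → c * d ≤ card A * card B) (card-free A i l) (card-free B i m)
    (proj₂ maximal _ _ (free-cross l≢m))

  dominated : ∀ {l} → card A ≤ k * a l → ∀ m → l ≢ m → k * b m ≤ card B
  dominated le m l≢m = *-cancelˡ-≤ (card A) (≤-trans (*-monoˡ-≤ (k * b m) le) (swap-≤ l≢m))

  -- When all slices of A and of B have average size, freeing coordinate i preserves maximality;
  -- two different slices of A could then be merged against a third slice of B.
  merge : ∀ {l l′ m} → m ≢ l → m ≢ l′ → k * a l ≡ card A → k * b m ≡ card B →
    ∀ x → T (free A i l′ x) → T (free A i l x)
  merge {l} {l′} {m} m≢l m≢l′ al bm x t = subst T (sym (same x)) (join-r (free A i l x) (free A i l′ x) t)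
    where
    both : Family p
    both x = free A i l x ∨ free A i l′ x
    join-r : ∀ c d → T d → T (c ∨ d)
    join-r true  d _ = tt
    join-r false d t = t
    both-cross : CrossIntersecting r both (free B i m)
    both-cross x y x∈ y∈ with Equivalence.to T-∨ x∈
    ... | inj₁ x∈l  = free-cross (m≢l ∘ sym) x y x∈l y∈
    ... | inj₂ x∈l′ = free-cross (m≢l′ ∘ sym) x y x∈l′ y∈
    card-both : card both ≤ card (free A i l)
    card-both = ≤-trans
      (*-cancelʳ-≤ (card both) (card A) (card B)
        (subst (λ c → card both * c ≤ card A * card B) (trans (card-free B i m) bm)
          (proj₂ maximal both (free B i m) both-cross)))
      (≤-reflexive (sym (trans (card-free A i l) al)))
    same : free A i l ≗ both
    same = ⊆∧card≤⇒≗ (free A i l) both (λ x → ⟦∨⟧≥ˡ _ _) card-both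

  balanced⇒irrelevant : 3 ≤ k → (∀ l → k * a l ≡ card A) → (∀ m → k * b m ≡ card B) → Irrelevant A i
  balanced⇒irrelevant 3≤k al bm x v =
    trans (⟦⟧-injective (≤-antisym (⟦⟧-mono (step v u x)) (⟦⟧-mono (step u v x)))) (cong A (set-at-self x i))
    where
    u = x at i
    step : ∀ l′ l x → T (free A i l′ x) → T (free A i l x)
    step l′ l with m , m≢l , m≢l′ ← third 3≤k l l′ = merge m≢l m≢l′ (al l) (bm m)

-- If no term exceeds the average, none can fall below it.
sum-average : ∀ {k} (f : Fin k → ℕ) c → (∀ j → k * f j ≤ c) → sum f ≡ c → ∀ j → k * f j ≡ c
sum-average {k} f c le e = sum-≤⇒≗ le (≤-reflexive (begin-equality
  sum {k} (λ _ → c) ≡⟨ sum-const k c ⟩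
  k * c ≡⟨ cong (k *_) (sym e) ⟩
  k * sum f ≡⟨ *-distribˡ-sum k f ⟩
  sum (λ j → k * f j) ∎))

module _ {p : Vec ℕ n} {r : ℕ} {A B : Family p} (cross : MaximalPair r A B) (i : Fin n) where

  open MaximalPair cross
  open Coordinate cross i
  private
    module Sym = Coordinate (MaximalPair-sym cross) i
    k = lookup p i
    a = slice A i
    b = slice B i
    instance
      cardB≢0 : NonZero (card B)
      cardB≢0 = >-nonZero card>0ʳ

  -- The sum of `swap-≤` over the h values of B other than l.
  swap-offSlice-≤ : ∀ {h} → k ≡ suc h → ∀ l → suc h * suc h * (a l * offSlice B i l) ≤ h * (card A * card B)
  swap-offSlice-≤ {h} refl-k l = begin
    suc h * suc h * (a l * offSlice B i l)
      ≡⟨ cong (λ t → t * t * (a l * offSlice B i l)) refl-k ⟨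
    k * k * (a l * offSlice B i l)
      ≡⟨ e k (a l) (offSlice B i l) ⟩
    k * a l * k * offSlice B i l
      ≡⟨ cong (k * a l * k *_) (offSlice≡sum B i l) ⟩
    k * a l * k * sum (λ v → ⟦ not (does (v ≟ l)) ⟧ * b v)
      ≡⟨ *-distribˡ-sum (k * a l * k) (λ v → ⟦ not (does (v ≟ l)) ⟧ * b v) ⟩
    sum (λ v → k * a l * k * (⟦ not (does (v ≟ l)) ⟧ * b v))
      ≤⟨ sum-mono-≤ each ⟩
    sum (λ v → ⟦ not (does (v ≟ l)) ⟧ * (card A * card B))
      ≡⟨ count refl-k l (card A * card B) ⟩
    h * (card A * card B) ∎
    where
    e : ∀ k a d → k * k * (a * d) ≡ k * a * k * d
    e = solve-∀
    count : ∀ {k h} → k ≡ suc h → ∀ (l : Fin k) c → sum (λ v → ⟦ not (does (v ≟ l)) ⟧ * c) ≡ h * c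
    count refl = sum-not-≟
    each : ∀ v → k * a l * k * (⟦ not (does (v ≟ l)) ⟧ * b v) ≤ ⟦ not (does (v ≟ l)) ⟧ * (card A * card B)
    each v with v ≟ l
    ... | yes _  = ≤-reflexive (*-zeroʳ (k * a l * k))
    ... | no v≢l = ≤-trans (≤-reflexive (trans (cong (k * a l * k *_) (+-identityʳ (b v))) (*-assoc (k * a l) k (b v))))
                     (≤-trans (swap-≤ (v≢l ∘ sym)) (≤-reflexive (sym (+-identityʳ _))))

  strictly-dominated : ∀ {l} → card A < k * a l → ∀ m → l ≢ m → k * b m < card B
  strictly-dominated {l} lt m l≢m = ≰⇒> λ cB≤ → <⇒≱ lt (*-cancelʳ-≤ (k * a l) (card A) (card B)
    (≤-trans (*-monoʳ-≤ (k * a l) cB≤) (swap-≤ l≢m)))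

>-average⇒offSlice< : {p : Vec ℕ n} (A : Family p) → ∀ i {h} → lookup p i ≡ suc h → ∀ l →
  card A < lookup p i * slice A i l → offSlice A i l < h * slice A i l
>-average⇒offSlice< {p = p} A i {h} k≡ l lt = +-cancelˡ-< (slice A i l) _ _ (begin-strict
  slice A i l + offSlice A i l ≡⟨ slice+offSlice A i l ⟩
  card A <⟨ lt ⟩
  lookup p i * slice A i l ≡⟨ cong (_* slice A i l) k≡ ⟩
  suc h * slice A i l ∎)

-- The odds of B alone give `rare`. For `scarce` the large slice of A at l, of share at least h/(h +
-- 1), is played against the slice of B at v through `swap-≤`.
popular : {p : Vec ℕ n} {r : ℕ} {A B : Family p} (cross : MaximalPair r A B) → ∀ i {h} → lookup p i ≡ suc h → ∀ l →
  h * offSlice A i l ≤ slice A i l → h * offSlice B i l ≤ slice B i l → Popular B i l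
popular {p = p} {A = A} {B} cross i {h} k≡ l ha hb = record
  { rare = begin
      lookup p i * offSlice B i l ≡⟨ cong (_* offSlice B i l) k≡ ⟩
      offSlice B i l + h * offSlice B i l ≤⟨ +-monoʳ-≤ (offSlice B i l) hb ⟩
      offSlice B i l + slice B i l ≡⟨ +-comm (offSlice B i l) _ ⟩
      slice B i l + offSlice B i l ≡⟨ slice+offSlice B i l ⟩
      card B ∎
  ; scarce = λ v v≢l → *-cancelˡ-≤ (card A) {{>-nonZero (MaximalPair.card>0ˡ cross)}} (begin
      card A * (k * ((k ∸ 1) * slice B i v)) ≡⟨ cong (λ t → card A * (k * ((t ∸ 1) * slice B i v))) k≡ ⟩
      card A * (k * (h * slice B i v)) ≡⟨ e (card A) k h (slice B i v) ⟩
      h * card A * (k * slice B i v) ≤⟨ *-monoˡ-≤ (k * slice B i v) hA ⟩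
      k * slice A i l * (k * slice B i v) ≤⟨ Coordinate.swap-≤ cross i (v≢l ∘ sym) ⟩
      card A * card B ∎)
  }
  where
  k = lookup p i
  e : ∀ c k h s → c * (k * (h * s)) ≡ h * c * (k * s)
  e = solve-∀
  hA : h * card A ≤ k * slice A i l
  hA = begin
    h * card A ≡⟨ cong (h *_) (slice+offSlice A i l) ⟨
    h * (slice A i l + offSlice A i l) ≡⟨ *-distribˡ-+ h _ _ ⟩
    h * slice A i l + h * offSlice A i l ≤⟨ +-monoʳ-≤ (h * slice A i l) ha ⟩
    h * slice A i l + slice A i l ≡⟨ +-comm (h * slice A i l) _ ⟩
    suc h * slice A i l ≡⟨ cong (_* slice A i l) k≡ ⟨
    k * slice A i l ∎

-- The largest slice of A decides. If it is only average, all slices of A are average, hence all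
-- slices of B too, and the coordinate is irrelevant. Otherwise it pushes every other slice of B
-- below average, so that B exceeds the average at the same value l. Then `dominant₂` strengthens
-- the two excesses to popularity.
irrelevant-or-popular : {p : Vec ℕ n} {r : ℕ} {A B : Family p} → MaximalPair r A B → ∀ i → 3 ≤ lookup p i →
  (Irrelevant A i × Irrelevant B i) ⊎ (∃ λ l → Popular A i l × Popular B i l)
irrelevant-or-popular {p = p} {r} {A} {B} cross i 3≤k = go (sym (m+[n∸m]≡n (≤-trans (s≤s z≤n) 3≤k))) (largest (≤-trans (s≤s z≤n) 3≤k) a)
  where
  open MaximalPair cross
  module AB = Coordinate cross i
  module BA = Coordinate (MaximalPair-sym cross) i
  k = lookup p i
  a = slice A i
  b = slice B i
  largest : ∀ {k} → 1 ≤ k → (f : Fin k → ℕ) → ∃ λ l → ∀ m → f m ≤ f l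
  largest (s≤s _) f = argmax f
  go : ∀ {h} → k ≡ suc h → (∃ λ l → ∀ m → a m ≤ a l) →
    (Irrelevant A i × Irrelevant B i) ⊎ (∃ λ l → Popular A i l × Popular B i l)
  go {h} k≡ (l , max) with card A <? k * a l
  ... | no ≮ = inj₁ (AB.balanced⇒irrelevant 3≤k a≡ b≡ , BA.balanced⇒irrelevant 3≤k b≡ a≡)
    where
    a≡ : ∀ m → k * a m ≡ card A
    a≡ = sum-average a (card A) (λ m → ≤-trans (*-monoʳ-≤ k (max m)) (≮⇒≥ ≮)) (sum-slice A i)
    b≡ : ∀ m → k * b m ≡ card B
    b≡ = sum-average b (card B) (λ m → let l , m≢l , _ = third 3≤k m m in
           AB.dominated (≤-reflexive (sym (a≡ l))) m (m≢l)) (sum-slice B i)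
  ... | yes a-large = inj₂ (l , popular (MaximalPair-sym cross) i k≡ l hb ha , popular cross i k≡ l ha hb)
    where
    b-large : card B < k * b l
    b-large = ≰⇒> λ le → let m , m≢l , _ = third 3≤k l l in
      <⇒≢ (strictly-dominated cross i a-large m (m≢l ∘ sym)) (sum-average b (card B) (small le) (sum-slice B i) m)
      where
      small : k * b l ≤ card B → ∀ m → k * b m ≤ card B
      small le m with l ≟ m
      ... | yes refl = le
      ... | no l≢m   = <⇒≤ (strictly-dominated cross i a-large m l≢m)
    both : h * offSlice A i l ≤ a l × h * offSlice B i l ≤ b l
    both = dominant₂ h (a l) (offSlice A i l) (b l) (offSlice B i l)
      (>-average⇒offSlice< A i k≡ l a-large) (>-average⇒offSlice< B i k≡ l b-large)
      (subst (λ t → suc h * suc h * (a l * offSlice B i l) ≤ h * t) (sym (cong₂ _*_ (slice+offSlice A i l) (slice+offSlice B i l)))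
        (swap-offSlice-≤ cross i k≡ l))
      (subst (λ t → suc h * suc h * (b l * offSlice A i l) ≤ h * t) (trans (*-comm (card B) (card A)) (sym (cong₂ _*_ (slice+offSlice A i l) (slice+offSlice B i l))))
        (swap-offSlice-≤ (MaximalPair-sym cross) i k≡ l))
    ha = proj₁ both
    hb = proj₂ both

-- Sets of coordinates and Hamming distance

count : (Fin n → Bool) → ℕ
count W = sum λ i → ⟦ W i ⟧

factor : Bool → ℕ → ℕ
factor b q = if b then q else 1

prodOver : (Fin n → Bool) → (Fin n → ℕ) → ℕ
prodOver W f = prod λ i → factor (W i) (f i)

infixl 6 _without_

_without_ : (Fin n → Bool) → Fin n → Fin n → Bool
(W without a) i = W i ∧ not (does (i ≟ a))

without-⊆ : (W : Fin n → Bool) (a i : Fin n) → T ((W without a) i) → T (W i)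
without-⊆ W a i t with W i
... | true = tt

prodOver-without : (W : Fin n → Bool) (f : Fin n → ℕ) (a : Fin n) → T (W a) →
  prodOver W f ≡ f a * prodOver (W without a) f
prodOver-without {suc n} W f zero t with W zero
... | true = cong (f zero *_) (trans
  (prod-cong-≗ λ i → cong (λ b → factor b (f (suc i))) (sym (∧-identityʳ (W (suc i))))) (sym (*-identityˡ _)))
prodOver-without {suc n} W f (suc a) t = begin-equality
  factor (W zero) (f zero) * prodOver (W ∘ suc) (f ∘ suc)
    ≡⟨ cong₂ _*_ (cong (λ b → factor b (f zero)) (sym (∧-identityʳ (W zero))))
                 (prodOver-without (W ∘ suc) (f ∘ suc) a t) ⟩
  factor (W zero ∧ true) (f zero) * (f (suc a) * prodOver ((W ∘ suc) without a) (f ∘ suc))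
    ≡⟨ x∙yz≈y∙xz (factor (W zero ∧ true) (f zero)) (f (suc a)) _ ⟩
  f (suc a) * prodOver (W without suc a) f ∎

count-without : (W : Fin n → Bool) (a : Fin n) → T (W a) → count W ≡ suc (count (W without a))
count-without {suc n} W zero t with W zero
... | true = cong suc (sum-cong-≗ λ i → cong ⟦_⟧ (sym (∧-identityʳ (W (suc i)))))
count-without {suc n} W (suc a) t = trans
  (cong₂ _+_ (cong ⟦_⟧ (sym (∧-identityʳ (W zero)))) (count-without (W ∘ suc) a t))
  (+-suc ⟦ W zero ∧ true ⟧ _)

count>0⇒∃ : (W : Fin n → Bool) → 1 ≤ count W → ∃ λ i → T (W i)
count>0⇒∃ {suc n} W le with W zero in eq
... | true  = zero , subst T (sym eq) tt
... | false with i , t ← count>0⇒∃ (W ∘ suc) le = suc i , t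

count>0 : (W : Fin n → Bool) (i : Fin n) → T (W i) → 1 ≤ count W
count>0 W i t = ≤-trans (T⇒1≤ (W i) t) (member≤sum (λ j → ⟦ W j ⟧) i)
  where
  T⇒1≤ : ∀ b → T b → 1 ≤ ⟦ b ⟧
  T⇒1≤ true _ = ≤-refl

argmaxOn : (W : Fin n → Bool) (f : Fin n → ℕ) → 1 ≤ count W →
  ∃ λ a → T (W a) × (∀ j → T (W j) → f j ≤ f a)
argmaxOn {suc n} W f 1≤ = pick (argmax g)
  where
  g : Fin (suc n) → ℕ
  g i = if W i then suc (f i) else 0
  g-in : ∀ i → T (W i) → g i ≡ suc (f i)
  g-in i t with W i
  ... | true = refl
  pick : (∃ λ a → ∀ j → g j ≤ g a) → ∃ λ a → T (W a) × (∀ j → T (W j) → f j ≤ f a)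
  pick (a , max) with W a in eq
  ... | true  = a , subst T (sym eq) tt , λ j t → ≤-pred (subst (_≤ suc (f a)) (g-in j t) (max j))
  ... | false with i , t ← count>0⇒∃ W 1≤ = contradiction (subst (_≤ 0) (g-in i t) (max i)) λ ()

-- c separates the r smallest sizes from the others.
data Threshold (c : ℕ) : ℕ → Vec ℕ n → Set where
  rest  : {p : Vec ℕ n} → (∀ i → c ≤ lookup p i) → Threshold c 0 p
  first : ∀ {q r} {p : Vec ℕ n} → q ≤ c → Threshold c r p → Threshold c (suc r) (q ∷ p)

head-≤ : ∀ {q} {p : Vec ℕ n} → Linked _≤_ (q ∷ p) → ∀ i → q ≤ lookup (q ∷ p) i
head-≤ _            zero    = ≤-refl
head-≤ {p = _ ∷ _} (q≤q′ ∷ lnk) (suc i) = ≤-trans q≤q′ (head-≤ lnk i)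

threshold : ∀ {m} (p : Vec ℕ (suc m)) → Linked _≤_ p → ∀ r → 1 ≤ r → r ≤ suc m →
  ∃ λ c → head p ≤ c × Threshold c r p
threshold (q ∷ p) lnk 1 _ _ = q , ≤-refl , first ≤-refl (rest λ i → head-≤ lnk (suc i))
threshold (q ∷ q′ ∷ p) (q≤q′ ∷ lnk) (suc (suc r)) _ (s≤s r≤)
  with c , q′≤c , th ← threshold (q′ ∷ p) lnk (suc r) (s≤s z≤n) r≤
  = c , ≤-trans q≤q′ q′≤c , first (≤-trans q≤q′ q′≤c) th
threshold (q ∷ []) _ (suc (suc r)) _ (s≤s ())

productOfFirst≤^ : ∀ {c r} {p : Vec ℕ n} → Threshold c r p → productOfFirst r p ≤ c ^ r
productOfFirst≤^ (rest _)       = ≤-refl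
productOfFirst≤^ (first q≤c th) = *-mono-≤ q≤c (productOfFirst≤^ th)

-- An exchange argument: for each of the first r coordinates that W misses it contains a later one
-- instead, and c lies between the two sizes. The e surplus coordinates contribute at least c each.
productOfFirst*^≤prodOver : ∀ {c r e} {p : Vec ℕ n} → Threshold c r p → (W : Fin n → Bool) →
  count W ≡ r + e → productOfFirst r p * c ^ e ≤ prodOver W (lookup p)
productOfFirst*^≤prodOver {c = c} {e = e} {p} (rest c≤) W refl =
  subst (_≤ _) (sym (+-identityʳ (c ^ count W))) (go W (lookup p) c≤)
  where
  go : ∀ {n} (W : Fin n → Bool) (f : Fin n → ℕ) → (∀ i → c ≤ f i) → c ^ count W ≤ prodOver W f
  go {zero}  W f c≤ = ≤-refl
  go {suc n} W f c≤ with W zero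
  ... | true  = *-mono-≤ (c≤ zero) (go (W ∘ suc) (f ∘ suc) (c≤ ∘ suc))
  ... | false = subst (c ^ count (W ∘ suc) ≤_) (sym (+-identityʳ _)) (go (W ∘ suc) (f ∘ suc) (c≤ ∘ suc))
productOfFirst*^≤prodOver {c = c} {suc r} {e} {q ∷ p} (first q≤c th) W eq with W zero
... | true  = subst (_≤ q * prodOver (W ∘ suc) (lookup p)) (sym (*-assoc q (productOfFirst r p) (c ^ e)))
  (*-monoʳ-≤ q (productOfFirst*^≤prodOver th (W ∘ suc) (suc-injective eq)))
... | false = begin
  q * productOfFirst r p * c ^ e ≤⟨ *-monoˡ-≤ (c ^ e) (*-monoˡ-≤ (productOfFirst r p) q≤c) ⟩
  c * productOfFirst r p * c ^ e ≡⟨ cong (_* c ^ e) (*-comm c (productOfFirst r p)) ⟩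
  productOfFirst r p * c * c ^ e ≡⟨ *-assoc (productOfFirst r p) c (c ^ e) ⟩
  productOfFirst r p * c ^ suc e ≤⟨ productOfFirst*^≤prodOver th (W ∘ suc) (trans eq (sym (+-suc r e))) ⟩
  prodOver (W ∘ suc) (lookup p) ≡⟨ *-identityˡ _ ⟨
  1 * prodOver (W ∘ suc) (lookup p) ∎

tabulateˢ : (p : Vec ℕ n) → (∀ i → Fin (lookup p i)) → S p
tabulateˢ []      f = []
tabulateˢ (q ∷ p) f = f zero ∷ tabulateˢ p (f ∘ suc)

tabulateˢ-at : (p : Vec ℕ n) (f : ∀ i → Fin (lookup p i)) → ∀ i → tabulateˢ p f at i ≡ f i
tabulateˢ-at (q ∷ p) f zero    = refl
tabulateˢ-at (q ∷ p) f (suc i) = tabulateˢ-at p (f ∘ suc) i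

irrelevant⇒cylinder : {p : Vec ℕ n} (A : Family p) (W : Fin n → Bool) →
  (∀ i → ¬ T (W i) → Irrelevant A i) →
  ∀ x y → (∀ i → T (W i) → x at i ≡ y at i) → A x ≡ A y
irrelevant⇒cylinder {p = []}    A W irr [] [] _ = refl
irrelevant⇒cylinder {p = q ∷ p} A W irr (u ∷ x) (v ∷ y) eq = trans first-entry
  (irrelevant⇒cylinder (λ x → A (v ∷ x)) (W ∘ suc) (λ i ¬W x′ → irr (suc i) ¬W (v ∷ x′)) x y (eq ∘ suc))
  where
  first-entry : A (u ∷ x) ≡ A (v ∷ x)
  first-entry with T? (W zero)
  ... | yes t = cong (λ w → A (w ∷ x)) (eq zero t)
  ... | no ¬t = irr zero ¬t (v ∷ x) u

differ : {p : Vec ℕ n} → (Fin n → Bool) → S p → S p → Fin n → Bool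
differ W x y i = W i ∧ not (does (x at i ≟ y at i))

dist : {p : Vec ℕ n} → (Fin n → Bool) → S p → S p → ℕ
dist W x y = count (differ W x y)

-- The indicator of coincidence with z on W, as a product so that `∑-prod` can count it.
eqOn : {p : Vec ℕ n} → (Fin n → Bool) → S p → S p → ℕ
eqOn W z x = prod λ i → factor (W i) ⟦ does (x at i ≟ z at i) ⟧

eqOn≥1 : {p : Vec ℕ n} (W : Fin n → Bool) (z x : S p) →
  (∀ i → T (W i) → x at i ≡ z at i) → 1 ≤ eqOn W z x
eqOn≥1 W z x eq = prod-pos each
  where
  each : ∀ i → 1 ≤ factor (W i) ⟦ does (x at i ≟ z at i) ⟧
  each i with W i | eq i
  ... | false | _ = ≤-refl
  ... | true  | e with x at i ≟ z at i
  ...   | yes _ = ≤-refl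
  ...   | no ≢  = contradiction (e tt) ≢

eqOn-witness : {p : Vec ℕ n} (W : Fin n → Bool) (z x : S p) →
  eqOn W z x ≤ 1 × (∀ i → T (W i) → x at i ≢ z at i → eqOn W z x ≡ 0)
eqOn-witness W z x = bound W (λ i → does (x at i ≟ z at i)) , λ i t ≢ → vanish W (λ i → does (x at i ≟ z at i)) i t (no-does i ≢)
  where
  no-does : ∀ i → x at i ≢ z at i → does (x at i ≟ z at i) ≡ false
  no-does i ≢ with x at i ≟ z at i
  ... | yes e = contradiction e ≢
  ... | no _  = refl
  bound : ∀ {n} (W e : Fin n → Bool) → prod (λ i → factor (W i) ⟦ e i ⟧) ≤ 1
  bound {zero}  W e = ≤-refl
  bound {suc n} W e = *-mono-≤ (one (W zero)) (bound (W ∘ suc) (e ∘ suc))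
    where
    one : ∀ b → factor b ⟦ e zero ⟧ ≤ 1
    one true  = ⟦⟧≤1 (e zero)
    one false = ≤-refl
  vanish : ∀ {n} (W e : Fin n → Bool) i → T (W i) → e i ≡ false → prod (λ i → factor (W i) ⟦ e i ⟧) ≡ 0
  vanish W e zero t eq with W zero
  ... | true rewrite eq = refl
  vanish W e (suc i) t eq = trans (cong (factor (W zero) ⟦ e zero ⟧ *_) (vanish (W ∘ suc) (e ∘ suc) i t eq)) (*-zeroʳ (factor (W zero) ⟦ e zero ⟧))

∑-eqOn : {p : Vec ℕ n} (W : Fin n → Bool) (z : S p) →
  ∑ p (eqOn W z) ≡ prod λ i → if W i then 1 else lookup p i
∑-eqOn {p = p} W z = trans (∑-prod p (λ i v → factor (W i) ⟦ does (v ≟ z at i) ⟧)) (prod-cong-≗ each)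
  where
  each : ∀ i → sum (λ v → factor (W i) ⟦ does (v ≟ z at i) ⟧) ≡ (if W i then 1 else lookup p i)
  each i with W i
  ... | true  = trans (sum-cong-≗ λ v → sym (*-identityʳ ⟦ does (v ≟ z at i) ⟧)) (sum-single (z at i) (λ _ → 1))
  ... | false = trans (sum-const (lookup p i) 1) (*-identityʳ _)

∑-eqOn*prodOver : {p : Vec ℕ n} (W : Fin n → Bool) (z : S p) →
  ∑ p (eqOn W z) * prodOver W (lookup p) ≡ prod (lookup p)
∑-eqOn*prodOver {p = p} W z = trans (cong (_* prodOver W (lookup p)) (∑-eqOn W z))
  (trans (sym (prod-distrib-* (λ i → if W i then 1 else lookup p i) (λ i → factor (W i) (lookup p i))))
    (prod-cong-≗ λ i → each (W i) (lookup p i)))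
  where
  each : ∀ b q → (if b then 1 else q) * factor b q ≡ q
  each true  q = +-identityʳ q
  each false q = *-identityʳ q

-- Supports relative to the popular vector

record Structure {p : Vec ℕ n} (r : ℕ) (A B : Family p) : Set where
  field
    cross      : MaximalPair r A B
    W          : Fin n → Bool
    z          : S p
    irrelevant : ∀ i → ¬ T (W i) → Irrelevant A i × Irrelevant B i
    popularity : ∀ i → T (W i) → Popular A i (z at i) × Popular B i (z at i)
  open MaximalPair cross public

Structure-sym : {p : Vec ℕ n} {r : ℕ} {A B : Family p} → Structure r A B → Structure r B A
Structure-sym st = record
  { cross = MaximalPair-sym cross ; W = W ; z = z
  ; irrelevant = λ i ¬t → swap (irrelevant i ¬t) ; popularity = λ i t → swap (popularity i t) }
  where open Structure st

structure : {p : Vec ℕ n} {r : ℕ} {A B : Family p} → (∀ i → 3 ≤ lookup p i) → MaximalPair r A B → Structure r A B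
structure {n} {p = p} {r} {A} {B} 3≤p cross = record
  { cross = cross
  ; W = λ i → W (cases i)
  ; z = tabulateˢ p (λ i → centre i (cases i))
  ; irrelevant = λ i → irr i (cases i)
  ; popularity = λ i t → subst (λ l → Popular A i l × Popular B i l)
      (sym (tabulateˢ-at p (λ i → centre i (cases i)) i)) (pop i (cases i) t)
  }
  where
  Case : Fin n → Set
  Case i = (Irrelevant A i × Irrelevant B i) ⊎ (∃ λ l → Popular A i l × Popular B i l)
  -- Each coordinate is decided once, so that `W`, `z` and the properties of both refer to the same
  -- decision.
  cases : ∀ i → Case i
  cases i = irrelevant-or-popular cross i (3≤p i)
  W : ∀ {i} → Case i → Bool
  W (inj₁ _) = false
  W (inj₂ _) = true
  zero′ : ∀ {k} → 3 ≤ k → Fin k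
  zero′ (s≤s _) = zero
  centre : ∀ i → Case i → Fin (lookup p i)
  -- An arbitrary entry: vectors are compared with `z` on `W` only.
  centre i (inj₁ _)       = zero′ (3≤p i)
  centre i (inj₂ (l , _)) = l
  irr : ∀ i (c : Case i) → ¬ T (W c) → Irrelevant A i × Irrelevant B i
  irr i (inj₁ c) _ = c
  irr i (inj₂ _) ¬t = ⊥-elim (¬t tt)
  pop : ∀ i (c : Case i) → T (W c) → Popular A i (centre i c) × Popular B i (centre i c)
  pop i (inj₂ (l , c)) _ = c

T-∧⁻ : ∀ b c → T (b ∧ c) → T b × T c
T-∧⁻ true true _ = tt , tt

T-∧⁺ : ∀ {b c} → T b → T c → T (b ∧ c)
T-∧⁺ {true} _ t = t

¬T⇒false : ∀ {b} → ¬ T b → b ≡ false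
¬T⇒false {false} _ = refl
¬T⇒false {true}  ¬t = ⊥-elim (¬t tt)

1≤⟦⟧ : ∀ {b} → T b → 1 ≤ ⟦ b ⟧
1≤⟦⟧ {true} _ = ≤-refl

does≟-refl : ∀ {m} {u v : Fin m} → u ≡ v → T (does (u ≟ v))
does≟-refl {u = u} {v} e with u ≟ v
... | yes _ = tt
... | no ≢  = ≢ e

does≟⇒≡ : ∀ {m} {u v : Fin m} → T (does (u ≟ v)) → u ≡ v
does≟⇒≡ {u = u} {v} t with u ≟ v
... | yes e = e

not-does≟ : ∀ {m} {u v : Fin m} → u ≢ v → T (not (does (u ≟ v)))
not-does≟ {u = u} {v} ≢ with u ≟ v
... | yes e = ≢ e
... | no _  = tt

not-does≟⁻ : ∀ {m} {u v : Fin m} → T (not (does (u ≟ v))) → u ≢ v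
not-does≟⁻ {u = u} {v} t with u ≟ v
... | no ≢ = ≢

module _ {p : Vec ℕ n} (W : Fin n → Bool) where

  differ⁺ : {x y : S p} → ∀ {i} → T (W i) → x at i ≢ y at i → T (differ W x y i)
  differ⁺ t ≢ = T-∧⁺ t (not-does≟ ≢)

  differ⁻ : {x y : S p} → ∀ i → T (differ W x y i) → T (W i) × x at i ≢ y at i
  differ⁻ i t with t₁ , t₂ ← T-∧⁻ (W i) _ t = t₁ , not-does≟⁻ t₂

  ¬differ⇒≡ : {x y : S p} → ∀ i → T (W i) → ¬ T (differ W x y i) → x at i ≡ y at i
  ¬differ⇒≡ {x} {y} i t ¬d with x at i ≟ y at i
  ... | yes e = e
  ... | no ≢  = contradiction (T-∧⁺ t tt) ¬d

  dist≤0⇒≡ : {x y : S p} → dist W x y ≤ 0 → ∀ i → T (W i) → x at i ≡ y at i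
  dist≤0⇒≡ {x} {y} d≤0 i t = ¬differ⇒≡ {x} {y} i t λ d → contradiction (≤-trans (count>0 (differ W x y) i d) d≤0) λ ()

  dist+agree : (x y : S p) → dist W x y + count (λ i → W i ∧ does (x at i ≟ y at i)) ≡ count W
  dist+agree x y = trans (sym (∑-distrib-+ (λ i → ⟦ differ W x y i ⟧) λ i → ⟦ W i ∧ does (x at i ≟ y at i) ⟧))
    (sum-cong-≗ λ i → table (W i) (does (x at i ≟ y at i)))
    where
    table : ∀ a b → ⟦ a ∧ not b ⟧ + ⟦ a ∧ b ⟧ ≡ ⟦ a ⟧
    table true  true  = refl
    table true  false = refl
    table false _     = refl

  outside : S p → S p → S p → Fin n → Bool
  outside z x y i = differ W y z i ∧ does (x at i ≟ z at i)

  -- On the support of x the two vectors differ by hypothesis. Where y leaves z and x does not, they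
  -- differ as well, and the two sets of coordinates are disjoint.
  dist+outside≤dist : (z x y : S p) → (∀ i → T (differ W x z i) → y at i ≢ x at i) →
    dist W x z + count (outside z x y) ≤ dist W x y
  dist+outside≤dist z x y ≢ = subst (_≤ dist W x y)
    (∑-distrib-+ (λ i → ⟦ differ W x z i ⟧) (λ i → ⟦ outside z x y i ⟧)) (sum-mono-≤ each)
    where
    each : ∀ i → ⟦ differ W x z i ⟧ + ⟦ outside z x y i ⟧ ≤ ⟦ differ W x y i ⟧
    each i with W i | ≢ i
    ... | false | _ = z≤n
    ... | true  | h with x at i ≟ z at i | y at i ≟ z at i | x at i ≟ y at i
    ...   | yes _   | yes _   | _       = z≤n
    ...   | yes x≡z | no y≢z  | yes x≡y = contradiction (trans (sym x≡y) x≡z) y≢z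
    ...   | yes _   | no _    | no _    = ≤-refl
    ...   | no _    | _       | yes x≡y = contradiction (sym x≡y) (h tt)
    ...   | no _    | yes _   | no _    = ≤-refl
    ...   | no _    | no _    | no _    = ≤-refl

hit-or-miss : (X E : Fin n → Bool) → 1 ≤ sum (λ i → ⟦ X i ⟧ * ⟦ E i ⟧) ⊎ (∀ i → T (X i) → E i ≡ false)
hit-or-miss X E with 1 ≤? sum (λ i → ⟦ X i ⟧ * ⟦ E i ⟧)
... | yes le = inj₁ le
... | no ≰   = inj₂ λ i t → ¬T⇒false λ e → ≰ (≤-trans (*-mono-≤ (1≤⟦⟧ t) (1≤⟦⟧ e)) (member≤sum (λ i → ⟦ X i ⟧ * ⟦ E i ⟧) i))

-- A member y of B either meets one of the events E i with i in X, each of frequency at most 1/c, or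
-- is counted by g. Since g is a function and not a family, it may count with multiplicity.
union-bound : {p : Vec ℕ n} (B : Family p) (c : ℕ) (X : Fin n → Bool) (E : Fin n → S p → Bool) (g : S p → ℕ) →
  (∀ i → T (X i) → c * ∑ p (λ y → ⟦ E i y ⟧ * ⟦ B y ⟧) ≤ card B) →
  (∀ y → T (B y) → (∀ i → T (X i) → E i y ≡ false) → 1 ≤ g y) →
  c * card B ≤ count X * card B + c * ∑ p g
union-bound {p = p} B c X E g small covered = begin
  c * card B
    ≡⟨ cong (c *_) (card≡∑ B) ⟩
  c * ∑ p (λ y → ⟦ B y ⟧)
    ≤⟨ *-monoʳ-≤ c (∑-mono-≤ p each) ⟩
  c * ∑ p (λ y → (sum λ i → ⟦ X i ⟧ * (⟦ E i y ⟧ * ⟦ B y ⟧)) + g y)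
    ≡⟨ cong (c *_) (trans (∑-distrib p _ g) (cong (_+ ∑ p g) (trans
         (∑-sum-comm p (λ i y → ⟦ X i ⟧ * (⟦ E i y ⟧ * ⟦ B y ⟧)))
         (sum-cong-≗ λ i → ∑-*ˡ p ⟦ X i ⟧ (λ y → ⟦ E i y ⟧ * ⟦ B y ⟧))))) ⟩
  c * ((sum λ i → ⟦ X i ⟧ * ∑ p (λ y → ⟦ E i y ⟧ * ⟦ B y ⟧)) + ∑ p g)
    ≡⟨ trans (*-distribˡ-+ c _ (∑ p g)) (cong (_+ c * ∑ p g) (*-distribˡ-sum c (λ i → ⟦ X i ⟧ * ∑ p (λ y → ⟦ E i y ⟧ * ⟦ B y ⟧)))) ⟩
  (sum λ i → c * (⟦ X i ⟧ * ∑ p (λ y → ⟦ E i y ⟧ * ⟦ B y ⟧))) + c * ∑ p g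
    ≤⟨ +-monoˡ-≤ (c * ∑ p g) (sum-mono-≤ λ i → weigh (X i) (small i)) ⟩
  (sum λ i → ⟦ X i ⟧ * card B) + c * ∑ p g
    ≡⟨ cong (_+ c * ∑ p g) (*-distribʳ-sum (card B) (λ i → ⟦ X i ⟧)) ⟨
  count X * card B + c * ∑ p g ∎
  where
  weigh : ∀ b {m} → (T b → c * m ≤ card B) → c * (⟦ b ⟧ * m) ≤ ⟦ b ⟧ * card B
  weigh true  {m} h = subst₂ _≤_ (cong (c *_) (sym (+-identityʳ m))) (sym (+-identityʳ _)) (h tt)
  weigh false h = ≤-reflexive (*-zeroʳ c)
  each : ∀ y → ⟦ B y ⟧ ≤ (sum λ i → ⟦ X i ⟧ * (⟦ E i y ⟧ * ⟦ B y ⟧)) + g y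
  each y with B y | covered y
  ... | false | _   = z≤n
  ... | true  | cov with hit-or-miss X (λ i → E i y)
  ...   | inj₁ hit  = ≤-trans hit (≤-trans (≤-reflexive (sum-cong-≗ λ i → cong (⟦ X i ⟧ *_) (sym (*-identityʳ ⟦ E i y ⟧)))) (m≤m+n _ (g y)))
  ...   | inj₂ miss = ≤-trans (cov tt miss) (m≤n+m (g y) _)

module Relevant {p : Vec ℕ n} {r : ℕ} {A B : Family p} (3≤p : ∀ i → 3 ≤ lookup p i) (st : Structure r A B) where

  open Structure st

  B-cylinder : ∀ {y y′} → (∀ i → T (W i) → y at i ≡ y′ at i) → B y ≡ B y′
  B-cylinder {y} {y′} = irrelevant⇒cylinder B W (λ i ¬t → proj₂ (irrelevant i ¬t)) y y′

  -- B does not depend on coordinates outside `W`, so y can be changed there to disagree with x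
  -- everywhere. The r agreements that remain all lie in `W`.
  dist-bound : ∀ {x y} → T (A x) → T (B y) → r + dist W x y ≤ count W
  dist-bound {x} {y} x∈A y∈B = begin
    r + dist W x y
      ≤⟨ +-monoˡ-≤ (dist W x y) (subst (r ≤_) (∣agreement∣≡sum x y′)
           (proj₁ maximal x y′ x∈A (subst T (B-cylinder same) y∈B))) ⟩
    sum (λ i → ⟦ does (x at i ≟ y′ at i) ⟧) + dist W x y
      ≡⟨ ∑-distrib-+ (λ i → ⟦ does (x at i ≟ y′ at i) ⟧) (λ i → ⟦ differ W x y i ⟧) ⟨
    sum (λ i → ⟦ does (x at i ≟ y′ at i) ⟧ + ⟦ differ W x y i ⟧)
      ≤⟨ sum-mono-≤ each ⟩
    count W ∎
    where
    other : ∀ {k} → 3 ≤ k → (v : Fin k) → ∃ λ u → v ≢ u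
    other 3≤k v with u , u≢v , _ ← third 3≤k v v = u , u≢v ∘ sym
    new : ∀ i → Fin (lookup p i)
    new i = if W i then y at i else proj₁ (other (3≤p i) (x at i))
    y′ = tabulateˢ p new
    same : ∀ i → T (W i) → y at i ≡ y′ at i
    same i t = sym (trans (tabulateˢ-at p new i) (cong (λ b → if b then y at i else _) (Equivalence.to T-≡ t)))
    each : ∀ i → ⟦ does (x at i ≟ y′ at i) ⟧ + ⟦ differ W x y i ⟧ ≤ ⟦ W i ⟧
    each i rewrite tabulateˢ-at p new i with W i
    ... | false with x at i ≟ proj₁ (other (3≤p i) (x at i))
    ...   | yes e = contradiction e (proj₂ (other (3≤p i) (x at i)))
    ...   | no _  = z≤n
    each i | true with x at i ≟ y at i
    ...   | yes _ = ≤-refl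
    ...   | no _  = ≤-refl

  outside-bound : ∀ {x y} → T (A x) → T (B y) → (∀ i → T (differ W x z i) → y at i ≢ x at i) →
    r + (dist W x z + count (outside W z x y)) ≤ count W
  outside-bound {x} {y} x∈A y∈B ≢ =
    ≤-trans (+-monoʳ-≤ r (dist+outside≤dist W z x y ≢)) (dist-bound x∈A y∈B)

  -- From pᵢ ≥ 3 follows pᵢ(pᵢ - 1) ≥ 6, so an unpopular value has frequency at most 1/6.
  scarce₆ : ∀ i → T (W i) → ∀ v → v ≢ z at i → 6 * slice A i v ≤ card A
  scarce₆ i t v v≢z = ≤-trans (six (lookup p i) (3≤p i)) (Popular.scarce (proj₁ (popularity i t)) v v≢z)
    where
    six : ∀ k {s} → 3 ≤ k → 6 * s ≤ k * ((k ∸ 1) * s)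
    six k {s} 3≤k = subst (_≤ k * ((k ∸ 1) * s)) (sym (*-assoc 3 2 s))
      (*-mono-≤ 3≤k (*-monoˡ-≤ s (∸-monoˡ-≤ 1 3≤k)))

  -- Average over x in A. At a coordinate where y leaves z, either x differs from y, which happens
  -- at most s times, or x takes the unpopular value of y, an event of frequency at most 1/6. For
  -- the size Y of the support this gives Y ≤ s + Y/6, that is Y ≤ 6s/5, which is less than s + 1
  -- for s ≤ 3.
  support≤ : ∀ {s y} → count W ≤ r + s → s ≤ 3 → T (B y) → dist W y z ≤ s
  support≤ {s} {y} W≤ s≤3 y∈B = ≮⇒≥ λ s<Y → <⇒≱ (six-five s<Y) (*-cancelʳ-≤ _ _ (card A) {{>-nonZero card>0ˡ}} (begin
    6 * Y * card A
      ≡⟨ trans (*-assoc 6 Y (card A)) (cong (λ t → 6 * t) (trans (*-comm Y (card A)) (trans (cong (_* Y) (card≡∑ A)) (sym (∑-*ʳ p Y λ x → ⟦ A x ⟧))))) ⟩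
    6 * ∑ p (λ x → ⟦ A x ⟧ * Y)
      ≤⟨ *-monoʳ-≤ 6 (∑-mono-≤ p each) ⟩
    6 * ∑ p (λ x → ⟦ A x ⟧ * s + sum λ i → ⟦ differ W y z i ⟧ * (⟦ does (x at i ≟ y at i) ⟧ * ⟦ A x ⟧))
      ≡⟨ cong (6 *_) (trans (∑-distrib p _ _) (cong₂ _+_
           (trans (∑-*ʳ p s λ x → ⟦ A x ⟧) (cong (_* s) (sym (card≡∑ A))))
           (trans (∑-sum-comm p λ i x → ⟦ differ W y z i ⟧ * (⟦ does (x at i ≟ y at i) ⟧ * ⟦ A x ⟧))
             (sum-cong-≗ λ i → ∑-*ˡ p ⟦ differ W y z i ⟧ (λ x → ⟦ does (x at i ≟ y at i) ⟧ * ⟦ A x ⟧))))) ⟩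
    6 * (card A * s + sum λ i → ⟦ differ W y z i ⟧ * slice A i (y at i))
      ≡⟨ trans (*-distribˡ-+ 6 (card A * s) _) (cong (6 * (card A * s) +_) (*-distribˡ-sum 6 λ i → ⟦ differ W y z i ⟧ * slice A i (y at i))) ⟩
    6 * (card A * s) + (sum λ i → 6 * (⟦ differ W y z i ⟧ * slice A i (y at i)))
      ≤⟨ +-monoʳ-≤ (6 * (card A * s)) (sum-mono-≤ weigh) ⟩
    6 * (card A * s) + (sum λ i → ⟦ differ W y z i ⟧ * card A)
      ≡⟨ cong₂ _+_ (trans (cong (6 *_) (*-comm (card A) s)) (sym (*-assoc 6 s (card A)))) (sym (*-distribʳ-sum (card A) λ i → ⟦ differ W y z i ⟧)) ⟩
    6 * s * card A + Y * card A
      ≡⟨ *-distribʳ-+ (card A) (6 * s) Y ⟨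
    (6 * s + Y) * card A ∎))
    where
    Y = dist W y z
    six-five : s < Y → 6 * s + Y < 6 * Y
    six-five s<Y = begin-strict
      6 * s + Y ≡⟨ cong (_+ Y) (6s s) ⟩
      5 * s + s + Y ≤⟨ +-monoˡ-≤ Y (+-monoʳ-≤ (5 * s) s≤3) ⟩
      5 * s + 3 + Y <⟨ +-monoˡ-< Y (+-monoʳ-< (5 * s) {3} {5} (s≤s (s≤s (s≤s (s≤s z≤n))))) ⟩
      5 * s + 5 + Y ≡⟨ 5s s Y ⟩
      5 * suc s + Y ≤⟨ +-monoˡ-≤ Y (*-monoʳ-≤ 5 s<Y) ⟩
      5 * Y + Y ≡⟨ 6s Y ⟨
      6 * Y ∎
      where
      6s : ∀ s → 6 * s ≡ 5 * s + s
      6s = solve-∀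
      5s : ∀ s Y → 5 * s + 5 + Y ≡ 5 * suc s + Y
      5s = solve-∀
    table : ∀ a b c → ⟦ a ∧ not b ⟧ ≤ ⟦ a ∧ not c ⟧ + ⟦ a ∧ not b ⟧ * ⟦ c ⟧
    table false _     _     = z≤n
    table true  true  _     = z≤n
    table true  false true  = ≤-refl
    table true  false false = ≤-refl
    each : ∀ x → ⟦ A x ⟧ * Y ≤ ⟦ A x ⟧ * s + sum λ i → ⟦ differ W y z i ⟧ * (⟦ does (x at i ≟ y at i) ⟧ * ⟦ A x ⟧)
    each x with A x | dist-bound {x} {y}
    ... | false | _ = z≤n
    ... | true  | h = begin
      1 * Y
        ≡⟨ +-identityʳ Y ⟩
      Y
        ≤⟨ sum-mono-≤ (λ i → table (W i) (does (y at i ≟ z at i)) (does (x at i ≟ y at i))) ⟩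
      sum (λ i → ⟦ differ W x y i ⟧ + ⟦ differ W y z i ⟧ * ⟦ does (x at i ≟ y at i) ⟧)
        ≡⟨ ∑-distrib-+ (λ i → ⟦ differ W x y i ⟧) (λ i → ⟦ differ W y z i ⟧ * ⟦ does (x at i ≟ y at i) ⟧) ⟩
      dist W x y + sum (λ i → ⟦ differ W y z i ⟧ * ⟦ does (x at i ≟ y at i) ⟧)
        ≤⟨ +-mono-≤ (subst (dist W x y ≤_) (sym (+-identityʳ s)) (+-cancelˡ-≤ r _ _ (≤-trans (h tt y∈B) W≤)))
             (≤-reflexive (sum-cong-≗ λ i → cong (⟦ differ W y z i ⟧ *_) (sym (*-identityʳ _)))) ⟩
      1 * s + sum (λ i → ⟦ differ W y z i ⟧ * (⟦ does (x at i ≟ y at i) ⟧ * 1)) ∎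
    weigh : ∀ i → 6 * (⟦ differ W y z i ⟧ * slice A i (y at i)) ≤ ⟦ differ W y z i ⟧ * card A
    weigh i with differ W y z i in eq
    ... | false = z≤n
    ... | true with t , y≢z ← differ⁻ W {y} {z} i (subst T (sym eq) tt) =
      subst₂ _≤_ (cong (6 *_) (sym (*-identityˡ (slice A i (y at i))))) (sym (*-identityˡ (card A))) (scarce₆ i t (y at i) y≢z)

square-cancel-≤ : ∀ {m n} → m * m ≤ n * n → m ≤ n
square-cancel-≤ {m} {n} le = ≮⇒≥ λ n<m → <⇒≱ (*-mono-< n<m n<m) le

-- Here e is at most the geometric mean of a and b. Maximality bounds only the product |A| |B| from
-- below, so upper bounds on the two factors have to be combined in this way.
geometric-≤ : ∀ {a b e u v} → e * e ≤ a * b → u * a ≤ v → u * b ≤ v → u * e ≤ v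
geometric-≤ {a} {b} {e} {u} {v} ee ua ub = square-cancel-≤ (begin
  u * e * (u * e) ≡⟨ [m*n]*[o*p]≡[m*o]*[n*p] u e u e ⟩
  u * u * (e * e) ≤⟨ *-monoʳ-≤ (u * u) ee ⟩
  u * u * (a * b) ≡⟨ [m*n]*[o*p]≡[m*o]*[n*p] u u a b ⟩
  u * a * (u * b) ≤⟨ *-mono-≤ ua ub ⟩
  v * v ∎)

prodOver-scale : (X : Fin n → Bool) (c : ℕ) (f : Fin n → ℕ) →
  prodOver X (λ i → c * f i) ≡ c ^ count X * prodOver X f
prodOver-scale {zero}  X c f = refl
prodOver-scale {suc n} X c f with X zero
... | true  = trans (cong (c * f zero *_) (prodOver-scale (X ∘ suc) c (f ∘ suc))) ([m*n]*[o*p]≡[m*o]*[n*p] c (f zero) (c ^ count (X ∘ suc)) _)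
... | false = trans (*-identityˡ _) (trans (prodOver-scale (X ∘ suc) c (f ∘ suc)) (cong (c ^ count (X ∘ suc) *_) (sym (*-identityˡ _))))

prodOver-mono-≤ : (X : Fin n → Bool) {f g : Fin n → ℕ} → (∀ i → T (X i) → f i ≤ g i) →
  prodOver X f ≤ prodOver X g
prodOver-mono-≤ X {f} {g} f≤g = prod-mono-≤ λ i → each (X i) (f≤g i)
  where
  each : ∀ b {m n} → (T b → m ≤ n) → factor b m ≤ factor b n
  each true  h = h tt
  each false h = ≤-refl

eqOn-cases : {p : Vec ℕ n} (W : Fin n → Bool) (z x : S p) →
  (∀ i → T (W i) → x at i ≡ z at i) ⊎ eqOn W z x ≡ 0
eqOn-cases W z x with 1 ≤? count (differ W x z)
... | yes le = let i , t = count>0⇒∃ (differ W x z) le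
                   Wi , ≢ = differ⁻ W {x} {z} i t in inj₂ (proj₂ (eqOn-witness W z x) i Wi ≢)
... | no ≰   = inj₁ (dist≤0⇒≡ W {x} {z} (≮⇒≥ ≰))

module Supports {p : Vec ℕ n} {r : ℕ} {A B : Family p} (3≤p : ∀ i → 3 ≤ lookup p i) (st : Structure r A B) where

  open Structure st
  open Relevant 3≤p st

  Q Π : ℕ
  Q = prod (lookup p)
  Π = prodOver W (lookup p)

  instance
    Π≢0 : NonZero Π
    Π≢0 = >-nonZero (prod-pos λ i → each (W i) (3≤p i))
      where
      each : ∀ b {k} → 3 ≤ k → 1 ≤ factor b k
      each true  3≤k = ≤-trans (s≤s z≤n) 3≤k
      each false _   = ≤-refl
    cardB≢0 : NonZero (card B)
    cardB≢0 = >-nonZero card>0ʳ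

  rare-at : ∀ {c} → (∀ i → c ≤ lookup p i) → ∀ i → T (W i) → c * offSlice B i (z at i) ≤ card B
  rare-at c≤p i t = ≤-trans (*-monoˡ-≤ (offSlice B i (z at i)) (c≤p i)) (Popular.rare (proj₂ (popularity i t)))

  ≢-false : ∀ {m} {u v : Fin m} → not (does (u ≟ v)) ≡ false → u ≡ v
  ≢-false {u = u} {v} e with u ≟ v
  ... | yes u≡v = u≡v

  -- If x ∈ A has the largest conceivable support, most of B coincides with z on W; the scarcity
  -- of y at a coordinate of its support then leaves no room for y.
  full-support : ∀ {c s x y} → (∀ i → c ≤ lookup p i) → 3 ≤ c → suc s ≤ c → count W ≡ r + s →
    T (A x) → dist W x z ≡ s → T (B y) → ¬ 1 ≤ dist W y z
  full-support {c} {s} {x} {y} c≤p 3≤c s<c W≡ x∈A X≡ y∈B Y≥1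
    with i , t ← count>0⇒∃ (differ W y z) Y≥1 with Wi , y≢z ← differ⁻ W {y} {z} i t =
    <⇒≱ strictly (*-cancelʳ-≤ _ _ (card B) all)
    where
    d = c ∸ 1
    ω = ∑ p (eqOn W z)
    bound : c * card B ≤ count (differ W x z) * card B + c * ω
    bound = union-bound B c (differ W x z) (λ i y → not (does (y at i ≟ z at i))) (eqOn W z)
      (λ i t → rare-at c≤p i (proj₁ (differ⁻ W {x} {z} i t)))
      λ y′ y′∈B miss → eqOn≥1 W z y′ λ j Wj → same y′ y′∈B (λ i t → ≢-false (miss i t)) j Wj
      where
      same : ∀ y′ → T (B y′) → (∀ i → T (differ W x z i) → y′ at i ≡ z at i) → ∀ j → T (W j) → y′ at j ≡ z at j
      same y′ y′∈B onX j Wj with T? (differ W x z j)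
      ... | yes t = onX j t
      ... | no ¬t = ¬differ⇒≡ W {y′} {z} j Wj λ t → contradiction
        (≤-trans (count>0 (outside W z x y′) j (T-∧⁺ t (does≟-refl (¬differ⇒≡ W {x} {z} j Wj ¬t)))) none) λ ()
        where
        none : count (outside W z x y′) ≤ 0
        none = +-cancelˡ-≤ (r + s) _ 0 (begin
          r + s + count (outside W z x y′) ≡⟨ +-assoc r s _ ⟩
          r + (s + count (outside W z x y′)) ≡⟨ cong (λ k → r + (k + count (outside W z x y′))) X≡ ⟨
          r + (dist W x z + count (outside W z x y′)) ≤⟨ outside-bound {x} {y′} x∈A y′∈B
            (λ i t e → proj₂ (differ⁻ W {x} {z} i t) (trans (sym e) (onX i t))) ⟩
          count W ≡⟨ W≡ ⟩
          r + s ≡⟨ +-identityʳ (r + s) ⟨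
          r + s + 0 ∎)
    -- As many vectors coincide on `W` with y as with z. The former all belong to B, which depends
    -- on `W` only, and they share the unpopular entry of y at i.
    ω≤slice : ω ≤ slice B i (y at i)
    ω≤slice = begin
      ∑ p (eqOn W z) ≡⟨ trans (∑-eqOn W z) (sym (∑-eqOn W y)) ⟩
      ∑ p (eqOn W y) ≤⟨ ∑-mono-≤ p each ⟩
      slice B i (y at i) ∎
      where
      each : ∀ y′ → eqOn W y y′ ≤ ⟦ does (y′ at i ≟ y at i) ⟧ * ⟦ B y′ ⟧
      each y′ with eqOn-cases W y y′
      ... | inj₂ ≡0 = subst (_≤ _) (sym ≡0) z≤n
      ... | inj₁ eq = ≤-trans (proj₁ (eqOn-witness W y y′))
        (*-mono-≤ (1≤⟦⟧ (does≟-refl (eq i Wi))) (1≤⟦⟧ (subst T (sym (B-cylinder eq)) y∈B)))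
    all : c * d * card B ≤ (s * d + 1) * card B
    all = begin
      c * d * card B ≡⟨ e₁ c d (card B) ⟩
      d * (c * card B) ≤⟨ *-monoʳ-≤ d bound ⟩
      d * (dist W x z * card B + c * ω) ≡⟨ cong (λ t → d * (t * card B + c * ω)) X≡ ⟩
      d * (s * card B + c * ω) ≡⟨ e₂ c d s (card B) ω ⟩
      s * d * card B + c * (d * ω) ≤⟨ +-monoʳ-≤ (s * d * card B) (*-mono-≤ (c≤p i) (*-mono-≤ (∸-monoˡ-≤ 1 (c≤p i)) ω≤slice)) ⟩
      s * d * card B + lookup p i * ((lookup p i ∸ 1) * slice B i (y at i))
                                           ≤⟨ +-monoʳ-≤ (s * d * card B) (Popular.scarce (proj₂ (popularity i Wi)) (y at i) y≢z) ⟩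
      s * d * card B + card B ≡⟨ e₃ (s * d) (card B) ⟩
      (s * d + 1) * card B ∎
      where
      e₁ : ∀ c d b → c * d * b ≡ d * (c * b)
      e₁ = solve-∀
      e₂ : ∀ c d s b w → d * (s * b + c * w) ≡ s * d * b + c * (d * w)
      e₂ = solve-∀
      e₃ : ∀ u b → u * b + b ≡ (u + 1) * b
      e₃ = solve-∀
    strictly : s * d + 1 < c * d
    strictly = begin-strict
      s * d + 1 ≡⟨ +-comm (s * d) 1 ⟩
      1 + s * d <⟨ +-monoˡ-< (s * d) (∸-monoˡ-≤ 1 3≤c) ⟩
      d + s * d ≤⟨ *-monoˡ-≤ d s<c ⟩
      c * d ∎

sum-not-≟′ : ∀ {k} → 1 ≤ k → (l : Fin k) → sum (λ v → ⟦ not (does (v ≟ l)) ⟧) ≡ k ∸ 1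
sum-not-≟′ {suc h} _ l = trans (sum-cong-≗ λ v → sym (*-identityʳ ⟦ not (does (v ≟ l)) ⟧))
  (trans (sum-not-≟ l 1) (*-identityʳ h))

module Supports₂ {p : Vec ℕ n} {r : ℕ} {A B : Family p} (3≤p : ∀ i → 3 ≤ lookup p i) (st : Structure r A B) where

  open Structure st
  open Relevant 3≤p st
  open Supports 3≤p st
  private module Swapped = Relevant 3≤p (Structure-sym st)

  -- Refilling entry i of the slice at zᵢ stays within all Q vectors, and the rest of A is at most
  -- |A|/pᵢ. The outcome is |A| ≤ Q/(pᵢ - 1).
  card-A-≤ : ∀ i → T (W i) → lookup p i * card A ≤ Q + card A
  card-A-≤ i Wi = begin
    lookup p i * card A
      ≡⟨ cong (lookup p i *_) (slice+offSlice A i (z at i)) ⟨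
    lookup p i * (slice A i (z at i) + offSlice A i (z at i))
      ≡⟨ *-distribˡ-+ (lookup p i) _ _ ⟩
    lookup p i * slice A i (z at i) + lookup p i * offSlice A i (z at i)
      ≤⟨ +-mono-≤ (≤-trans (≤-reflexive (sym (card-free A i (z at i)))) (card≤Q (free A i (z at i))))
                  (Popular.rare (proj₁ (popularity i Wi))) ⟩
    Q + card A ∎
    where
    card≤Q : ∀ F → card F ≤ Q
    card≤Q F = subst₂ _≤_ (sym (card≡∑ F)) (∑-1 p) (∑-mono-≤ p λ x → ⟦⟧≤1 (F x))

  -- All but a fraction 2/c of the members y of B coincide with z on the support of x. By
  -- `outside-bound` such a y leaves z in at most one of the other r + 1 relevant coordinates. For a
  -- given exceptional coordinate at most QP/Π vectors qualify.
  half-support : ∀ {c P x} → (∀ i → c ≤ lookup p i) → 1 ≤ r → count W ≡ r + 3 →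
    (∀ j → T (W j) → lookup p j ≤ P) → T (A x) → dist W x z ≡ 2 →
    c * card B * Π ≤ 2 * card B * Π + c * ((r + 1) * (Q * P))
  half-support {c} {P} {x} c≤p 1≤r W≡ ≤P x∈A X≡ = begin
    c * card B * Π
      ≤⟨ *-monoˡ-≤ Π bound ⟩
    (dist W x z * card B + c * ∑ p g) * Π
      ≡⟨ cong (λ t → (t * card B + c * ∑ p g) * Π) X≡ ⟩
    (2 * card B + c * ∑ p g) * Π
      ≡⟨ trans (*-distribʳ-+ Π (2 * card B) (c * ∑ p g)) (cong (2 * card B * Π +_) (*-assoc c (∑ p g) Π)) ⟩
    2 * card B * Π + c * (∑ p g * Π)
      ≤⟨ +-monoʳ-≤ (2 * card B * Π) (*-monoʳ-≤ c g-bound) ⟩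
    2 * card B * Π + c * ((r + 1) * (Q * P)) ∎
    where
    X = differ W x z
    outer : Fin n → Bool
    outer j = W j ∧ does (x at j ≟ z at j)
    g : S p → ℕ
    g y = sum λ j → ⟦ outer j ⟧ * eqOn (W without j) z y
    outer≡ : count outer ≡ r + 1
    outer≡ = +-cancelˡ-≡ 2 _ _ (trans (cong (_+ count outer) (sym X≡)) (trans (dist+agree W x z)
      (trans W≡ (trans (+-comm r 3) (cong (2 +_) (+-comm 1 r))))))
    g-bound : ∑ p g * Π ≤ (r + 1) * (Q * P)
    g-bound = begin
      ∑ p g * Π
        ≡⟨ cong (_* Π) (trans (∑-sum-comm p λ j y → ⟦ outer j ⟧ * eqOn (W without j) z y)
             (sum-cong-≗ λ j → ∑-*ˡ p ⟦ outer j ⟧ (eqOn (W without j) z))) ⟩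
      sum (λ j → ⟦ outer j ⟧ * ∑ p (eqOn (W without j) z)) * Π
        ≡⟨ *-distribʳ-sum Π (λ j → ⟦ outer j ⟧ * ∑ p (eqOn (W without j) z)) ⟩
      sum (λ j → ⟦ outer j ⟧ * ∑ p (eqOn (W without j) z) * Π)
        ≤⟨ sum-mono-≤ each ⟩
      sum (λ j → ⟦ outer j ⟧ * (Q * P))
        ≡⟨ *-distribʳ-sum (Q * P) (λ j → ⟦ outer j ⟧) ⟨
      count outer * (Q * P)
        ≡⟨ cong (_* (Q * P)) outer≡ ⟩
      (r + 1) * (Q * P) ∎
      where
      each : ∀ j → ⟦ outer j ⟧ * ∑ p (eqOn (W without j) z) * Π ≤ ⟦ outer j ⟧ * (Q * P)
      each j with outer j in eq
      ... | false = z≤n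
      ... | true with Wj , _ ← T-∧⁻ (W j) _ (subst T (sym eq) tt) = begin
        (ω + 0) * Π ≡⟨ cong₂ _*_ (+-identityʳ ω) (prodOver-without W (lookup p) j Wj) ⟩
        ω * (lookup p j * Π′) ≡⟨ x∙yz≈y∙xz ω (lookup p j) Π′ ⟩
        lookup p j * (ω * Π′) ≡⟨ cong (lookup p j *_) (∑-eqOn*prodOver (W without j) z) ⟩
        lookup p j * Q ≤⟨ *-monoˡ-≤ Q (≤P j Wj) ⟩
        P * Q ≡⟨ trans (*-comm P Q) (sym (+-identityʳ (Q * P))) ⟩
        1 * (Q * P) ∎
        where
        ω = ∑ p (eqOn (W without j) z)
        Π′ = prodOver (W without j) (lookup p)
    covered : ∀ y → T (B y) → (∀ i → T (X i) → y at i ≡ z at i) → 1 ≤ g y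
    covered y y∈B onX = ≤-trans (*-mono-≤ (1≤⟦⟧ (proj₁ (proj₂ witness))) (eqOn≥1 _ z y (proj₂ (proj₂ witness))))
      (member≤sum (λ j → ⟦ outer j ⟧ * eqOn (W without j) z y) (proj₁ witness))
      where
      V = outside W z x y
      V≤1 : count V ≤ 1
      V≤1 = +-cancelˡ-≤ (r + 2) _ 1 (begin
        r + 2 + count V ≡⟨ +-assoc r 2 _ ⟩
        r + (2 + count V) ≡⟨ cong (λ k → r + (k + count V)) X≡ ⟨
        r + (dist W x z + count V) ≤⟨ outside-bound {x} {y} x∈A y∈B
          (λ i t e → proj₂ (differ⁻ W {x} {z} i t) (trans (sym e) (onX i t))) ⟩
        count W ≡⟨ trans W≡ (sym (+-assoc r 2 1)) ⟩
        r + 2 + 1 ∎)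
      V-or-≡ : ∀ i → T (W i) → ¬ T (V i) → y at i ≡ z at i
      V-or-≡ i Wi ¬V with T? (X i)
      ... | yes t = onX i t
      ... | no ¬t = ¬differ⇒≡ W {y} {z} i Wi λ d → ¬V (T-∧⁺ d (does≟-refl (¬differ⇒≡ W {x} {z} i Wi ¬t)))
      witness : ∃ λ j → T (outer j) × (∀ i → T ((W without j) i) → y at i ≡ z at i)
      witness with 1 ≤? count V
      -- If y coincides with z on all of `W`, any outer coordinate may be called the exceptional
      -- one.
      ... | no none with j , t ← count>0⇒∃ outer (subst (1 ≤_) (sym outer≡) (m≤n+m 1 r)) =
        j , t , λ i Wi → V-or-≡ i (without-⊆ W j i Wi) (none ∘ count>0 V i)
      ... | yes some with j , t ← count>0⇒∃ V some =
        j , T-∧⁺ (proj₁ (T-∧⁻ (W j) _ (proj₁ (T-∧⁻ (differ W y z j) _ t)))) (proj₂ (T-∧⁻ (differ W y z j) _ t))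
          , λ i Wi → V-or-≡ i (without-⊆ W j i Wi) λ Vi → contradiction
              (≤-trans (s≤s (count>0 (V without j) i (T-∧⁺ Vi (proj₂ (T-∧⁻ (W i) _ Wi)))))
                       (≤-trans (≤-reflexive (sym (count-without V j t))) V≤1)) λ { (s≤s ()) }
    bound : c * card B ≤ count X * card B + c * ∑ p g
    bound = union-bound B c X (λ i y → not (does (y at i ≟ z at i))) g
      (λ i t → rare-at c≤p i (proj₁ (differ⁻ W {x} {z} i t)))
      λ y y∈B miss → covered y y∈B λ i t → ≢-false (miss i t)

  -- On the support of x each event yᵢ = xᵢ has frequency at most 1/6 in B, so at least half of B
  -- avoids all three. Such a y already differs from x in three relevant coordinates, all that |W| =
  -- r + 3 permits, and hence coincides with z on the rest of `W`. The function `g` is the indicator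
  -- of the box of these vectors.
  triple-support : ∀ {x} → count W ≡ r + 3 → T (A x) → dist W x z ≡ 3 →
    card B * Π ≤ 2 * (Q * prodOver (differ W x z) (λ i → lookup p i ∸ 1))
  triple-support {x} W≡ x∈A X≡ = begin
    card B * Π ≤⟨ *-monoˡ-≤ Π (*-cancelˡ-≤ {card B} {2 * ∑ p g} 3 B≤) ⟩
    2 * ∑ p g * Π ≡⟨ *-assoc 2 (∑ p g) Π ⟩
    2 * (∑ p g * Π) ≡⟨ cong (λ t → 2 * t) g*Π ⟩
    2 * (Q * prodOver X (λ i → lookup p i ∸ 1)) ∎
    where
    X = differ W x z
    weight : ∀ i → Fin (lookup p i) → ℕ
    weight i v = if X i then ⟦ not (does (v ≟ x at i)) ⟧ else factor (W i) ⟦ does (v ≟ z at i) ⟧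
    g : S p → ℕ
    g y = prod λ i → weight i (y at i)
    g*Π : ∑ p g * Π ≡ Q * prodOver X (λ i → lookup p i ∸ 1)
    g*Π = trans (cong (_* Π) (∑-prod p weight)) (trans
      (sym (prod-distrib-* (λ i → sum (weight i)) (λ i → factor (W i) (lookup p i))))
      (trans (prod-cong-≗ each) (prod-distrib-* (lookup p) (λ i → factor (X i) (lookup p i ∸ 1)))))
      where
      each : ∀ i → sum (weight i) * factor (W i) (lookup p i) ≡ lookup p i * factor (X i) (lookup p i ∸ 1)
      each i with W i
      ... | false = trans (*-identityʳ _) (trans (sum-const (lookup p i) 1) refl)
      ... | true with x at i ≟ z at i
      ...   | yes _ = trans (cong (_* lookup p i) (trans (sum-cong-≗ λ v → sym (*-identityʳ ⟦ does (v ≟ z at i) ⟧)) (sum-single (z at i) (λ _ → 1)))) (*-comm 1 (lookup p i))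
      ...   | no _  = trans (cong (_* lookup p i) (sum-not-≟′ (≤-trans (s≤s z≤n) (3≤p i)) (x at i))) (*-comm (lookup p i ∸ 1) (lookup p i))
    covered : ∀ y → T (B y) → (∀ i → T (X i) → does (y at i ≟ x at i) ≡ false) → 1 ≤ g y
    covered y y∈B miss = prod-pos each
      where
      V = outside W z x y
      onX : ∀ i → T (X i) → y at i ≢ x at i
      onX i t e = subst T (miss i t) (does≟-refl e)
      V≤0 : count V ≤ 0
      V≤0 = +-cancelˡ-≤ (r + 3) _ 0 (begin
        r + 3 + count V ≡⟨ +-assoc r 3 _ ⟩
        r + (3 + count V) ≡⟨ cong (λ k → r + (k + count V)) X≡ ⟨
        r + (dist W x z + count V) ≤⟨ outside-bound {x} {y} x∈A y∈B onX ⟩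
        count W ≡⟨ trans W≡ (sym (+-identityʳ (r + 3))) ⟩
        r + 3 + 0 ∎)
      each : ∀ i → 1 ≤ weight i (y at i)
      each i with X i in eqX
      ... | true = 1≤⟦⟧ (not-does≟ (onX i (subst T (sym eqX) tt)))
      ... | false with W i in eqW
      ...   | false = ≤-refl
      ...   | true  = 1≤⟦⟧ (does≟-refl (¬differ⇒≡ W {y} {z} i Wi λ d → contradiction
          (≤-trans (count>0 V i (T-∧⁺ d (does≟-refl (¬differ⇒≡ W {x} {z} i Wi ¬X)))) V≤0) λ ()))
        where
        Wi : T (W i)
        Wi = subst T (sym eqW) tt
        ¬X : ¬ T (differ W x z i)
        ¬X t = subst T eqX′ t
          where
          eqX′ : differ W x z i ≡ false
          eqX′ = trans (cong (_∧ not (does (x at i ≟ z at i))) eqW) eqX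
    bound : 6 * card B ≤ count X * card B + 6 * ∑ p g
    bound = union-bound B 6 X (λ i y → does (y at i ≟ x at i)) g
      (λ i t → let Wi , x≢z = differ⁻ W {x} {z} i t in Swapped.scarce₆ i Wi (x at i) x≢z) covered
    B≤ : 3 * card B ≤ 3 * (2 * ∑ p g)
    B≤ = +-cancelˡ-≤ (3 * card B) _ _ (begin
      3 * card B + 3 * card B ≡⟨ e₁ (card B) ⟩
      6 * card B ≤⟨ bound ⟩
      count X * card B + 6 * ∑ p g ≡⟨ cong₂ _+_ (cong (_* card B) X≡) (e₂ (∑ p g)) ⟩
      3 * card B + 3 * (2 * ∑ p g) ∎)
      where
      e₁ : ∀ b → 3 * b + 3 * b ≡ 6 * b
      e₁ = solve-∀
      e₂ : ∀ g → 6 * g ≡ 3 * (2 * g)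
      e₂ = solve-∀

sum>0⇒∃ : (f : Fin n → ℕ) → 1 ≤ sum f → ∃ λ i → 1 ≤ f i
sum>0⇒∃ {suc n} f 1≤ with 1 ≤? f zero
... | yes le = zero , le
... | no ≰ with i , le ← sum>0⇒∃ (f ∘ suc) (subst (λ t → 1 ≤ t + sum (f ∘ suc)) (n<1⇒n≡0 (≰⇒> ≰)) 1≤) = suc i , le

∑>0⇒∃ : (p : Vec ℕ n) (f : S p → ℕ) → 1 ≤ ∑ p f → ∃ λ x → 1 ≤ f x
∑>0⇒∃ []      f 1≤ = [] , 1≤
∑>0⇒∃ (q ∷ p) f 1≤ with v , 1≤v ← sum>0⇒∃ (λ v → ∑ p λ x → f (v ∷ x)) 1≤
  with x , le ← ∑>0⇒∃ p (λ x → f (v ∷ x)) 1≤v = v ∷ x , le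

-- Numerical conditions on the smallest size c under which pairs with at most r + 3 relevant coordinates are Hamming balls.
record Sizeable (c r : ℕ) : Set where
  field
    3≤c     : 3 ≤ c
    r+1<    : r + 1 < c * (c ∸ 2)
    4≤c⊎r≡1 : 4 ≤ c ⊎ r ≡ 1

prodOver-⊆ : {X Y : Fin n → Bool} {f : Fin n → ℕ} → (∀ i → 1 ≤ f i) → (∀ i → T (X i) → T (Y i)) →
  prodOver X f ≤ prodOver Y f
prodOver-⊆ {X = X} {Y} {f} 1≤f X⊆Y = prod-mono-≤ λ i → each (X i) (Y i) (1≤f i) (X⊆Y i)
  where
  each : ∀ b c {m} → 1 ≤ m → (T b → T c) → factor b m ≤ factor c m
  each true  true  _   _ = ≤-refl
  each true  false _   h = ⊥-elim (h tt)
  each false true  1≤m _ = 1≤m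
  each false false _   _ = ≤-refl

-- P³ - 6 (P - 1)² = (P - 2)³ + 2
cube-bound : ∀ P → 3 ≤ P → 6 * ((P ∸ 1) * (P ∸ 1)) < P ^ 3
cube-bound (suc zero)    (s≤s ())
cube-bound (suc (suc R)) _ = subst (6 * ((1 + R) * (1 + R)) <_) (sym (e R)) (m<m+n _ (s≤s z≤n))
  where
  e : ∀ R → (2 + R) * ((2 + R) * ((2 + R) * 1)) ≡ 6 * ((1 + R) * (1 + R)) + (2 + R * (R * (R * 1)))
  e = solve-∀

head≤lookup : ∀ {m} (p : Vec ℕ (suc m)) → Linked _≤_ p → ∀ i → head p ≤ lookup p i
head≤lookup (q ∷ p) = head-≤

productOfFirst-1 : ∀ {m} (p : Vec ℕ (suc m)) → productOfFirst 1 p ≡ head p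
productOfFirst-1 (q ∷ p) = *-identityʳ q

module Combined {m : ℕ} {p : Vec ℕ (suc m)} {r : ℕ} {A B : Family p}
  (1≤r : 1 ≤ r) (r≤n : r ≤ suc m) (sorted : Linked _≤_ p) (sizeable : Sizeable (head p) r)
  (st : Structure r A B) where

  open Sizeable sizeable
  open Structure st

  head≤ : ∀ i → head p ≤ lookup p i
  head≤ = head≤lookup p sorted

  3≤p : ∀ i → 3 ≤ lookup p i
  3≤p i = ≤-trans 3≤c (head≤ i)

  1≤p : ∀ i → 1 ≤ lookup p i
  1≤p i = ≤-trans (s≤s z≤n) (3≤p i)

  c D E : ℕ
  c = head p
  D = productOfFirst r p
  E = productAfter r p

  open Relevant 3≤p st
  open Supports 3≤p st
  open Supports₂ 3≤p st
  private module Swapped = Supports₂ 3≤p (Structure-sym st)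

  E²≤ : E * E ≤ card A * card B
  E²≤ = Maximal⇒productAfter²≤ {A = A} {B} 1≤p r≤n maximal

  D*E≡Q : D * E ≡ Q
  D*E≡Q = productOfFirst*productAfter r p

  DE≢0 : NonZero (D * E)
  DE≢0 = >-nonZero (subst (1 ≤_) (sym D*E≡Q) (prod-pos 1≤p))

  instance
    D≢0 : NonZero D
    D≢0 = m*n≢0⇒m≢0 D {{DE≢0}}
    E≢0 : NonZero E
    E≢0 = m*n≢0⇒n≢0 D {{DE≢0}}

  D*c^≤Π : ∀ {e} (V : Fin (suc m) → Bool) → count V ≡ r + e → D * c ^ e ≤ prodOver V (lookup p)
  D*c^≤Π {e} V V≡ with c′ , c≤c′ , th ← threshold p sorted r 1≤r r≤n =
    ≤-trans (*-monoʳ-≤ D (^-monoˡ-≤ e c≤c′)) (productOfFirst*^≤prodOver th V V≡)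

  -- By `half-support` both (c - 2)Π|A| and (c - 2)Π|B| are at most c(r + 1)QP, hence so is (c -
  -- 2)ΠE. Here P is the largest relevant size: taking it out of Π leaves r + 2 sizes with product
  -- at least Dc². So P cancels, and with Q = DE what remains is c(c - 2) ≤ r + 1.
  double-half : ∀ {x y} → count W ≡ r + 3 → T (A x) → dist W x z ≡ 2 → T (B y) → ¬ dist W y z ≡ 2
  double-half {x} {y} W≡ x∈A X≡ y∈B Y≡ with a , Wa , maxP ← argmaxOn W (lookup p) (subst (1 ≤_) (sym W≡) (≤-trans 1≤r (m≤m+n r 3))) =
    <⇒≱ r+1< (*-cancelʳ-≤ _ _ (c * (D * P)) {{≢0}} (begin
      c * (c ∸ 2) * (c * (D * P)) ≡⟨ e₁ c (c ∸ 2) D P ⟩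
      (c ∸ 2) * (P * (D * (c * (c * 1)))) ≤⟨ *-monoʳ-≤ (c ∸ 2) (*-monoʳ-≤ P (D*c^≤Π {2} (W without a) W-a)) ⟩
      (c ∸ 2) * (P * prodOver (W without a) (lookup p)) ≡⟨ cong ((c ∸ 2) *_) (prodOver-without W (lookup p) a Wa) ⟨
      (c ∸ 2) * Π ≤⟨ *-cancelʳ-≤ _ _ E (≤-trans squeezed (≤-reflexive (trans (cong (λ q → c * ((r + 1) * (q * P))) (sym D*E≡Q)) (e₂ c r D E P)))) ⟩
      (r + 1) * (c * (D * P)) ∎))
    where
    P = lookup p a
    ≢0 : NonZero (c * (D * P))
    ≢0 = m*n≢0 c (D * P) {{>-nonZero (≤-trans (s≤s z≤n) 3≤c)}} {{m*n≢0 D P {{D≢0}} {{>-nonZero (1≤p a)}}}}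
    W-a : count (W without a) ≡ r + 2
    W-a = suc-injective (trans (sym (count-without W a Wa)) (trans W≡ (+-suc r 2)))
    e₁ : ∀ c d D P → c * d * (c * (D * P)) ≡ d * (P * (D * (c * (c * 1))))
    e₁ = solve-∀
    e₂ : ∀ c r D E P → c * ((r + 1) * (D * E * P)) ≡ (r + 1) * (c * (D * P)) * E
    e₂ = solve-∀
    drop-two : ∀ b {v} → c * b * Π ≤ 2 * b * Π + v → (c ∸ 2) * Π * b ≤ v
    drop-two b {v} le = +-cancelˡ-≤ (2 * b * Π) _ _ (begin
      2 * b * Π + (c ∸ 2) * Π * b ≡⟨ e₃ b Π (c ∸ 2) ⟩
      (2 + (c ∸ 2)) * b * Π ≡⟨ cong (λ t → t * b * Π) (m+[n∸m]≡n (≤-trans (s≤s (s≤s z≤n)) 3≤c)) ⟩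
      c * b * Π ≤⟨ le ⟩
      2 * b * Π + v ∎)
      where
      e₃ : ∀ b Π d → 2 * b * Π + d * Π * b ≡ (2 + d) * b * Π
      e₃ = solve-∀
    squeezed : (c ∸ 2) * Π * E ≤ c * ((r + 1) * (Q * P))
    squeezed = geometric-≤ {card A} {card B} {E} {(c ∸ 2) * Π} E²≤
      (drop-two (card A) (Swapped.half-support head≤ 1≤r W≡ maxP y∈B Y≡))
      (drop-two (card B) (half-support head≤ 1≤r W≡ maxP x∈A X≡))

  -- Let K and K′ be the products of pᵢ - 1 and of pᵢ over the support of x, and P the largest
  -- relevant size. From `triple-support` and `card-A-≤` follows (P - 1)Π ≤ 18K, where 18 = 2 · 3²
  -- stems from Q = 3E. The fourth relevant coordinate gives Π ≥ 3K′, and K/K′ ≤ ((P - 1)/P)³.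
  -- Together, P³ ≤ 6(P - 1)², against `cube-bound`.
  triple-impossible : ∀ {x} → c ≡ 3 → r ≡ 1 → count W ≡ r + 3 → T (A x) → ¬ dist W x z ≡ 3
  triple-impossible {x} c≡3 r≡1 W≡ x∈A X≡
    with a , Wa , maxP ← argmaxOn W (lookup p) (subst (1 ≤_) (sym W≡) (≤-trans 1≤r (m≤m+n r 3)))
    with j , t ← count>0⇒∃ (λ j → W j ∧ does (x at j ≟ z at j)) (≤-reflexive (sym (+-cancelˡ-≡ 3 _ _
      (trans (cong (_+ count (λ j → W j ∧ does (x at j ≟ z at j))) (sym X≡)) (trans (dist+agree W x z) (trans W≡ (trans (+-comm r 3) (cong (3 +_) r≡1))))))))
    with Wj , xj ← T-∧⁻ (W j) _ t =
    <⇒≱ (cube-bound P (3≤p a)) (*-cancelʳ-≤ _ _ (P-1 * (3 * K′)) {{≢0}} (begin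
      P ^ 3 * (P-1 * (3 * K′)) ≤⟨ *-monoʳ-≤ (P ^ 3) (*-monoʳ-≤ P-1 3K′≤Π) ⟩
      P ^ 3 * (P-1 * Π) ≤⟨ *-monoʳ-≤ (P ^ 3) (*-cancelʳ-≤ (P-1 * Π) (18 * K) (card A * card B) {{AB≢0}} product) ⟩
      P ^ 3 * (18 * K) ≡⟨ x∙yz≈y∙xz (P ^ 3) 18 K ⟩
      18 * (P ^ 3 * K) ≤⟨ *-monoʳ-≤ 18 scale ⟩
      18 * (P-1 ^ 3 * K′) ≡⟨ e₁ P-1 K′ ⟩
      6 * (P-1 * P-1) * (P-1 * (3 * K′)) ∎))
    where
    P = lookup p a
    P-1 = P ∸ 1
    X = differ W x z
    K K′ : ℕ
    K = prodOver X (λ i → lookup p i ∸ 1)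
    K′ = prodOver X (lookup p)
    AB≢0 : NonZero (card A * card B)
    AB≢0 = >-nonZero (*-mono-≤ card>0ˡ card>0ʳ)
    ≢0 : NonZero (P-1 * (3 * K′))
    ≢0 = m*n≢0 P-1 (3 * K′) {{>-nonZero (≤-trans (s≤s z≤n) (∸-monoˡ-≤ 1 (3≤p a)))}} {{m*n≢0 3 K′ {{_}} {{>-nonZero (prod-pos λ i → 1≤factor (X i) (1≤p i))}}}}
      where
      1≤factor : ∀ b {q} → 1 ≤ q → 1 ≤ factor b q
      1≤factor true  h = h
      1≤factor false _ = ≤-refl
    e₁ : ∀ u k → 18 * (u * (u * (u * 1)) * k) ≡ 6 * (u * u) * (u * (3 * k))
    e₁ = solve-∀
    3K′≤Π : 3 * K′ ≤ Π
    3K′≤Π = ≤-trans (*-mono-≤ (3≤p j) (prodOver-⊆ 1≤p λ i Xi → let Wi , x≢z = differ⁻ W {x} {z} i Xi in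
        T-∧⁺ Wi (not-does≟ λ i≡j → x≢z (subst (λ i → x at i ≡ z at i) (sym i≡j) (does≟⇒≡ xj)))))
      (≤-reflexive (sym (prodOver-without W (lookup p) j Wj)))
    scale : P ^ 3 * K ≤ P-1 ^ 3 * K′
    scale = begin
      P ^ 3 * K ≡⟨ cong (λ k → P ^ k * K) X≡ ⟨
      P ^ count X * K ≡⟨ prodOver-scale X P (λ i → lookup p i ∸ 1) ⟨
      prodOver X (λ i → P * (lookup p i ∸ 1)) ≤⟨ prodOver-mono-≤ X (λ i Xi → ratio (1≤p i) (maxP i (proj₁ (differ⁻ W {x} {z} i Xi)))) ⟩
      prodOver X (λ i → P-1 * lookup p i) ≡⟨ prodOver-scale X P-1 (lookup p) ⟩
      P-1 ^ count X * K′ ≡⟨ cong (λ k → P-1 ^ k * K′) X≡ ⟩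
      P-1 ^ 3 * K′ ∎
      where
      -- The quotient (q - 1)/q increases with q.
      ratio : ∀ {q P} → 1 ≤ q → q ≤ P → P * (q ∸ 1) ≤ (P ∸ 1) * q
      ratio {suc k} {suc l} _ (s≤s k≤l) = subst (k + l * k ≤_) (sym (*-suc l k)) (+-monoˡ-≤ (l * k) k≤l)
    A≤ : P-1 * card A ≤ Q
    A≤ = +-cancelˡ-≤ (card A) _ _ (begin
      card A + P-1 * card A ≡⟨ cong (_* card A) (m+[n∸m]≡n (1≤p a)) ⟩
      P * card A ≤⟨ card-A-≤ a Wa ⟩
      Q + card A ≡⟨ +-comm Q (card A) ⟩
      card A + Q ∎)
    Q≡3E : Q ≡ 3 * E
    Q≡3E = trans (sym D*E≡Q) (cong (_* E) (trans (cong (λ k → productOfFirst k p) r≡1) (trans (productOfFirst-1 p) c≡3)))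
    product : P-1 * Π * (card A * card B) ≤ 18 * K * (card A * card B)
    product = begin
      P-1 * Π * (card A * card B) ≡⟨ e₂ P-1 Π (card A) (card B) ⟩
      P-1 * card A * (card B * Π) ≤⟨ *-mono-≤ A≤ (triple-support W≡ x∈A X≡) ⟩
      Q * (2 * (Q * K)) ≡⟨ cong (λ q → q * (2 * (q * K))) Q≡3E ⟩
      3 * E * (2 * (3 * E * K)) ≡⟨ e₃ E K ⟩
      18 * K * (E * E) ≤⟨ *-monoʳ-≤ (18 * K) E²≤ ⟩
      18 * K * (card A * card B) ∎
      where
      e₂ : ∀ u v a b → u * v * (a * b) ≡ u * a * (b * v)
      e₂ = solve-∀
      e₃ : ∀ e k → 3 * e * (2 * (3 * e * k)) ≡ 18 * k * (e * e)
      e₃ = solve-∀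

  -- The union bound in `full-support` requires s < c. What escapes it is s = c = 3, where `4≤c⊎r≡1`
  -- leaves only r = 1.
  full-impossible : ∀ {s x y} → s ≤ 3 → count W ≡ r + s → T (A x) → dist W x z ≡ s → T (B y) → ¬ 1 ≤ dist W y z
  full-impossible {s} {x} {y} s≤3 W≡ x∈A X≡ y∈B 1≤Y with suc s ≤? c
  ... | yes s<c = full-support {x = x} {y} head≤ 3≤c s<c W≡ x∈A X≡ y∈B 1≤Y
  ... | no s≮c with 4≤c⊎r≡1
  ...   | inj₁ 4≤c = s≮c (≤-trans (s≤s s≤3) 4≤c)
  ...   | inj₂ r≡1 = triple-impossible {x} c≡3 r≡1 (trans W≡ (cong (r +_) s≡3)) x∈A (trans X≡ s≡3)
    where
    c≤s : c ≤ s
    c≤s = ≤-pred (≰⇒> s≮c)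
    c≡3 : c ≡ 3
    c≡3 = ≤-antisym (≤-trans c≤s s≤3) 3≤c
    s≡3 : s ≡ 3
    s≡3 = ≤-antisym s≤3 (≤-trans 3≤c c≤s)

-- Identification with Hamming balls

ball : {p : Vec ℕ n} → (Fin n → Bool) → S p → ℕ → Family p
ball W z k x = dist W x z ≤ᵇ k

∈ball⁺ : {p : Vec ℕ n} {W : Fin n → Bool} {z x : S p} → ∀ {k} → dist W x z ≤ k → T (ball W z k x)
∈ball⁺ = ≤⇒≤ᵇ

∈ball⁻ : {p : Vec ℕ n} {W : Fin n → Bool} {z x : S p} → ∀ {k} → T (ball W z k x) → dist W x z ≤ k
∈ball⁻ = ≤ᵇ⇒≤ _ _

-- By the triangle inequality members of the two balls differ in at most k + l coordinates of W,
-- which leaves r agreements.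
ball-cross : {p : Vec ℕ n} (W : Fin n → Bool) (z : S p) → ∀ {r k l} → r + (k + l) ≤ count W →
  CrossIntersecting r (ball W z k) (ball W z l)
ball-cross W z {r} {k} {l} le x y x∈ y∈ = subst (r ≤_) (sym (∣agreement∣≡sum x y))
  (≤-trans (+-cancelˡ-≤ (k + l) r _ (begin
    k + l + r ≡⟨ +-comm (k + l) r ⟩
    r + (k + l) ≤⟨ le ⟩
    count W ≡⟨ dist+agree W x y ⟨
    dist W x y + count agreeing ≤⟨ +-monoˡ-≤ (count agreeing) (≤-trans triangle (+-mono-≤ (∈ball⁻ {W = W} {z} {x} x∈) (∈ball⁻ {W = W} {z} {y} y∈))) ⟩
    k + l + count agreeing ∎))
    (sum-mono-≤ λ i → drop-W (W i) (does (x at i ≟ y at i))))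
  where
  agreeing : Fin _ → Bool
  agreeing i = W i ∧ does (x at i ≟ y at i)
  drop-W : ∀ a b → ⟦ a ∧ b ⟧ ≤ ⟦ b ⟧
  drop-W true  b = ≤-refl
  drop-W false b = z≤n
  triangle : dist W x y ≤ dist W x z + dist W y z
  triangle = subst (dist W x y ≤_) (∑-distrib-+ (λ i → ⟦ differ W x z i ⟧) (λ i → ⟦ differ W y z i ⟧)) (sum-mono-≤ each)
    where
    each : ∀ i → ⟦ differ W x y i ⟧ ≤ ⟦ differ W x z i ⟧ + ⟦ differ W y z i ⟧
    each i with W i
    ... | false = z≤n
    ... | true with x at i ≟ y at i | x at i ≟ z at i | y at i ≟ z at i
    ...   | yes _  | _       | _       = z≤n
    ...   | no _   | no _    | _       = s≤s z≤n
    ...   | no _   | yes _   | no _    = ≤-refl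
    ...   | no x≢y | yes x≡z | yes y≡z = contradiction (trans x≡z (sym y≡z)) x≢y

1≤⟦⟧⁻ : ∀ {b} → 1 ≤ ⟦ b ⟧ → T b
1≤⟦⟧⁻ {true} _ = tt

-- A downward search from the known bound K; whether a value is attained on A is decided by a sum of
-- indicators over all vectors.
maximum-over : {p : Vec ℕ n} (A : Family p) (f : S p → ℕ) → 1 ≤ card A → ∀ K → (∀ x → T (A x) → f x ≤ K) →
  ∃ λ k → (∀ x → T (A x) → f x ≤ k) × (∃ λ x → T (A x) × f x ≡ k)
maximum-over {p = p} A f 1≤A zero ≤K with x , 1≤ ← ∑>0⇒∃ p (λ x → ⟦ A x ⟧) (subst (1 ≤_) (card≡∑ A) 1≤A) =
  0 , ≤K , x , 1≤⟦⟧⁻ 1≤ , n≤0⇒n≡0 (≤K x (1≤⟦⟧⁻ 1≤))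
maximum-over {p = p} A f 1≤A (suc K) ≤K with 1 ≤? ∑ p (λ x → ⟦ A x ∧ (f x ≡ᵇ suc K) ⟧)
... | yes le with x , 1≤ ← ∑>0⇒∃ p _ le with x∈A , e ← T-∧⁻ (A x) _ (1≤⟦⟧⁻ 1≤) =
  suc K , ≤K , x , x∈A , ≡ᵇ⇒≡ (f x) (suc K) e
... | no none = maximum-over A f 1≤A K λ x x∈A → ≤-pred (≤∧≢⇒< (≤K x x∈A) λ e → none
  (≤-trans (1≤⟦⟧ (T-∧⁺ {A x} x∈A (≡⇒≡ᵇ (f x) (suc K) e))) (member≤∑ p (λ x → ⟦ A x ∧ (f x ≡ᵇ suc K) ⟧) x)))

record Balls {p : Vec ℕ n} (r : ℕ) (A B : Family p) (st : Structure r A B) : Set where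
  open Structure st
  field
    k l     : ℕ
    count≡  : count W ≡ r + (k + l)
    k+l≤3   : k + l ≤ 3
    A≗      : A ≗ ball W z k
    B≗      : B ≗ ball W z l

Balls-sym : {p : Vec ℕ n} {r : ℕ} {A B : Family p} {st : Structure r A B} → Balls r A B st → Balls r B A (Structure-sym st)
Balls-sym {r = r} b = record
  { k = l ; l = k ; count≡ = trans count≡ (cong (r +_) (+-comm k l)) ; k+l≤3 = subst (_≤ 3) (+-comm k l) k+l≤3
  ; A≗ = B≗ ; B≗ = A≗ }
  where open Balls b

squeeze-factor : ∀ {a b a′ b′} → 1 ≤ b → b ≤ b′ → a′ * b′ ≤ a * b → a′ ≤ a
squeeze-factor {a} {b} {a′} {b′} 1≤b b≤b′ le = *-cancelʳ-≤ a′ a b {{>-nonZero 1≤b}}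
  (≤-trans (*-monoʳ-≤ a′ b≤b′) le)

module Identified {m : ℕ} {p : Vec ℕ (suc m)} {r : ℕ} {A B : Family p}
  (1≤r : 1 ≤ r) (r≤n : r ≤ suc m) (sorted : Linked _≤_ p) (sizeable : Sizeable (head p) r)
  (st : Structure r A B) where

  open Structure st
  open Combined 1≤r r≤n sorted sizeable st public
  private
    module Swapped = Combined {A = B} {A} 1≤r r≤n sorted sizeable (Structure-sym st)
    module R = Relevant 3≤p st
    module R′ = Relevant 3≤p (Structure-sym st)

  -- If one support has size s, the other is empty by `full-impossible`. Otherwise both sizes are at
  -- most s - 1 ≤ 2, and their sum exceeds s only when s = 3 and both are 2, which `double-half`
  -- excludes.
  supports-add : ∀ {s x y} → s ≤ 3 → count W ≡ r + s → T (A x) → T (B y) → dist W x z + dist W y z ≤ s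
  supports-add {s} {x} {y} s≤3 W≡ x∈A y∈B = ≮⇒≥ (excess (m≤n⇒m<n∨m≡n X≤) (m≤n⇒m<n∨m≡n Y≤))
    where
    X = dist W x z
    Y = dist W y z
    X≤ : X ≤ s
    X≤ = R′.support≤ {s} {x} (≤-reflexive W≡) s≤3 x∈A
    Y≤ : Y ≤ s
    Y≤ = R.support≤ {s} {y} (≤-reflexive W≡) s≤3 y∈B
    positive : ∀ {a b} → a ≡ s → s < a + b → 1 ≤ b
    positive {a} {zero}  refl lt = contradiction (sym (+-identityʳ a)) (<⇒≢ lt)
    positive {a} {suc b} refl lt = s≤s z≤n
    excess : X < s ⊎ X ≡ s → Y < s ⊎ Y ≡ s → ¬ s < X + Y
    excess (inj₂ X≡) _ s< = full-impossible {s} {x} {y} s≤3 W≡ x∈A X≡ y∈B (positive X≡ s<)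
    excess (inj₁ _) (inj₂ Y≡) s< = Swapped.full-impossible {s} {y} {x} s≤3 W≡ y∈B Y≡ x∈A (positive Y≡ (subst (s <_) (+-comm X Y) s<))
    excess (inj₁ X<) (inj₁ Y<) s< = double-half {x} {y} (trans W≡ (cong (r +_) s≡3)) x∈A X≡2 y∈B Y≡2
      where
      s≡3 : s ≡ 3
      s≡3 = ≤-antisym s≤3 (+-cancelʳ-≤ s 3 s (begin
        3 + s ≡⟨ cong (2 +_) refl ⟩
        2 + suc s ≤⟨ +-monoʳ-≤ 2 s< ⟩
        2 + (X + Y) ≡⟨ cong suc (sym (+-suc X Y)) ⟩
        suc X + suc Y ≤⟨ +-mono-≤ X< Y< ⟩
        s + s ∎))
      X≤2 : X ≤ 2
      X≤2 = ≤-pred (subst (X <_) s≡3 X<)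
      Y≤2 : Y ≤ 2
      Y≤2 = ≤-pred (subst (Y <_) s≡3 Y<)
      4≤ : 4 ≤ X + Y
      4≤ = subst (_< X + Y) s≡3 s<
      X≡2 : X ≡ 2
      X≡2 = ≤-antisym X≤2 (+-cancelʳ-≤ 2 2 X (≤-trans 4≤ (+-monoʳ-≤ X Y≤2)))
      Y≡2 : Y ≡ 2
      Y≡2 = ≤-antisym Y≤2 (+-cancelˡ-≤ 2 2 Y (≤-trans 4≤ (+-monoˡ-≤ Y X≤2)))

  module _ {k l : ℕ} (W≡ : count W ≡ r + (k + l)) (k+l≤3 : k + l ≤ 3)
    (A≤k : ∀ x → T (A x) → dist W x z ≤ k) (B≤l : ∀ y → T (B y) → dist W y z ≤ l) where

    private
      A⊆ : ∀ x → T (A x) → T (ball W z k x)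
      A⊆ x x∈A = ∈ball⁺ {W = W} {z} {x} (A≤k x x∈A)
      B⊆ : ∀ y → T (B y) → T (ball W z l y)
      B⊆ y y∈B = ∈ball⁺ {W = W} {z} {y} (B≤l y y∈B)
      product : card (ball W z k) * card (ball W z l) ≤ card A * card B
      product = proj₂ maximal (ball W z k) (ball W z l) (ball-cross W z (≤-reflexive (sym W≡)))
      product′ : card (ball W z l) * card (ball W z k) ≤ card B * card A
      product′ = subst₂ _≤_ (*-comm (card (ball W z k)) (card (ball W z l))) (*-comm (card A) (card B)) product

    -- The two balls are themselves a competing pair, so their product of sizes is at most |A| |B|.
    -- As they contain A and B, neither inclusion can be strict.
    contained⇒balls : Balls r A B st
    contained⇒balls = record
      { k = k ; l = l ; count≡ = W≡ ; k+l≤3 = k+l≤3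
      ; A≗ = ⊆∧card≤⇒≗ A (ball W z k) A⊆ (squeeze-factor card>0ʳ (card-mono-≤ B (ball W z l) B⊆) product)
      ; B≗ = ⊆∧card≤⇒≗ B (ball W z l) B⊆ (squeeze-factor card>0ˡ (card-mono-≤ A (ball W z k) A⊆) product′)
      }

  balls : count W ≤ r + 3 → Balls r A B st
  balls W≤ = contained⇒balls {k} {l} W≡′ (subst (_≤ 3) (sym k+l≡s) s≤3) A≤k B≤l
    where
    dist≤ : ∀ x → T (A x) → dist W x z ≤ count W
    dist≤ x _ = subst (dist W x z ≤_) (dist+agree W x z) (m≤m+n (dist W x z) _)
    top = maximum-over A (λ x → dist W x z) card>0ˡ (count W) dist≤
    k = proj₁ top
    A≤k = proj₁ (proj₂ top)
    x₀ = proj₁ (proj₂ (proj₂ top))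
    x₀∈A = proj₁ (proj₂ (proj₂ (proj₂ top)))
    x₀≡k : dist W x₀ z ≡ k
    x₀≡k = proj₂ (proj₂ (proj₂ (proj₂ top)))
    -- The maximum of a constant serves only to produce a member of B.
    some = maximum-over B (λ _ → 0) card>0ʳ 0 (λ _ _ → z≤n)
    y₀ = proj₁ (proj₂ (proj₂ some))
    y₀∈B = proj₁ (proj₂ (proj₂ (proj₂ some)))
    excess : ∃ λ s → r + s ≡ count W
    excess = m≤n⇒∃[o]m+o≡n (m+n≤o⇒m≤o r (R.dist-bound {x₀} {y₀} x₀∈A y₀∈B))
    s = proj₁ excess
    W≡ : count W ≡ r + s
    W≡ = sym (proj₂ excess)
    s≤3 : s ≤ 3
    s≤3 = +-cancelˡ-≤ r s 3 (subst (_≤ r + 3) W≡ W≤)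
    room : ∃ λ l → k + l ≡ s
    room = m≤n⇒∃[o]m+o≡n (subst (_≤ s) x₀≡k (m+n≤o⇒m≤o (dist W x₀ z) (supports-add {s} {x₀} {y₀} s≤3 W≡ x₀∈A y₀∈B)))
    l = proj₁ room
    k+l≡s : k + l ≡ s
    k+l≡s = proj₂ room
    W≡′ : count W ≡ r + (k + l)
    W≡′ = trans W≡ (cong (r +_) (sym k+l≡s))
    B≤l : ∀ y → T (B y) → dist W y z ≤ l
    B≤l y y∈B = +-cancelˡ-≤ k _ l (subst₂ (λ u v → u + dist W y z ≤ v) x₀≡k (sym k+l≡s)
      (supports-add {s} {x₀} {y} s≤3 W≡ x₀∈A y∈B))

-- The entropy bound on the number of relevant coordinates

2uv≤u²+v² : ∀ u v → 2 * (u * v) ≤ u * u + v * v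
2uv≤u²+v² u v with ≤-total u v
... | inj₁ u≤v with d , refl ← m≤n⇒∃[o]m+o≡n u≤v = subst (2 * (u * (u + d)) ≤_) (sym (e u d)) (m≤m+n _ (d * d))
  where
  e : ∀ u d → u * u + (u + d) * (u + d) ≡ 2 * (u * (u + d)) + d * d
  e = solve-∀
... | inj₂ v≤u with d , refl ← m≤n⇒∃[o]m+o≡n v≤u = subst (2 * ((v + d) * v) ≤_) (sym (e v d)) (m≤m+n _ (d * d))
  where
  e : ∀ v d → (v + d) * (v + d) + v * v ≡ 2 * ((v + d) * v) + d * d
  e = solve-∀

-- AM-GM for one copy of u^(m + 1) and m copies of v^(m + 1).
young : ∀ m u v → suc m * (u * v ^ m) ≤ u ^ suc m + m * v ^ suc m
young zero    u v = ≤-refl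
young (suc m) u v = +-cancelʳ-≤ (m * (u * (v * w))) _ _ (begin
  (2 + m) * (u * (v * w)) + m * (u * (v * w)) ≡⟨ e₁ m u v w ⟩
  suc m * w * (2 * (u * v)) ≤⟨ *-monoʳ-≤ (suc m * w) (2uv≤u²+v² u v) ⟩
  suc m * w * (u * u + v * v) ≡⟨ e₂ m u v w ⟩
  u * (suc m * (u * w)) + suc m * (v * (v * w)) ≤⟨ +-monoˡ-≤ _ (*-monoʳ-≤ u (young m u v)) ⟩
  u * (u * u ^ m + m * (v * w)) + suc m * (v * (v * w)) ≡⟨ e₃ m u v w (u ^ m) ⟩
  u * (u * u ^ m) + suc m * (v * (v * w)) + m * (u * (v * w)) ∎)
  where
  w = v ^ m
  e₁ : ∀ m u v w → (2 + m) * (u * (v * w)) + m * (u * (v * w)) ≡ suc m * w * (2 * (u * v))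
  e₁ = solve-∀
  e₂ : ∀ m u v w → suc m * w * (u * u + v * v) ≡ u * (suc m * (u * w)) + suc m * (v * (v * w))
  e₂ = solve-∀
  e₃ : ∀ m u v w t → u * (u * t + m * (v * w)) + suc m * (v * (v * w)) ≡
                     u * (u * t) + suc m * (v * (v * w)) + m * (u * (v * w))
  e₃ = solve-∀

amgm-step : ∀ m s a → suc m ^ suc m * (a * s ^ m) ≤ m ^ m * (s + a) ^ suc m
amgm-step zero      s a = subst₂ _≤_ (sym (trans (+-identityʳ (a * 1)) (*-identityʳ a))) (sym (trans (+-identityʳ ((s + a) * 1)) (*-identityʳ (s + a)))) (m≤n+m a s)
amgm-step m@(suc _) s a = *-cancelˡ-≤ m (+-cancelʳ-≤ (m * v ^ suc m) _ _ (begin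
  m * (suc m ^ suc m * (a * s ^ m)) + m * v ^ suc m ≡⟨ cong (_+ m * v ^ suc m) (e₁ m (suc m ^ m) a (s ^ m)) ⟩
  suc m * m * a * (suc m ^ m * s ^ m) + m * v ^ suc m ≡⟨ cong (λ t → suc m * m * a * t + m * v ^ suc m) (^-distrib-* (suc m) s m) ⟨
  suc m * m * a * v ^ m + m * v ^ suc m ≡⟨ e₂ m a s (v ^ m) ⟩
  suc m * (u * v ^ m) ≤⟨ young m u v ⟩
  u ^ suc m + m * v ^ suc m ≡⟨ cong (_+ m * v ^ suc m) (trans (^-distrib-* (s + a) m (suc m)) (e₃ ((s + a) ^ suc m) m (m ^ m))) ⟩
  m * (m ^ m * (s + a) ^ suc m) + m * v ^ suc m ∎))
  where
  -- Up to the common factor m(m + 1), u is the mean after a joins m numbers of sum s, and v is the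
  -- mean before.
  u = (s + a) * m
  v = suc m * s
  e₁ : ∀ m t a s → m * (suc m * t * (a * s)) ≡ suc m * m * a * (t * s)
  e₁ = solve-∀
  e₂ : ∀ m a s w → suc m * m * a * w + m * (suc m * s * w) ≡ suc m * ((s + a) * m * w)
  e₂ = solve-∀
  e₃ : ∀ t m k → t * (m * k) ≡ m * (k * t)
  e₃ = solve-∀

^-pos : ∀ {m} k → 1 ≤ m → 1 ≤ m ^ k
^-pos zero    _  = ≤-refl
^-pos (suc k) 1≤ = *-mono-≤ 1≤ (^-pos k 1≤)

n^n≢0 : ∀ n → NonZero (n ^ n)
n^n≢0 zero    = _
n^n≢0 (suc n) = >-nonZero (^-pos (suc n) (s≤s z≤n))

amgm : ∀ xs → length xs ^ length xs * ListAction.product xs ≤ ListAction.sum xs ^ length xs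
amgm []       = ≤-refl
amgm (a ∷ xs) = *-cancelˡ-≤ (m ^ m) {{n^n≢0 m}} (begin
  m ^ m * (suc m ^ suc m * (a * P)) ≡⟨ e (m ^ m) (suc m ^ suc m) a P ⟩
  suc m ^ suc m * (a * (m ^ m * P)) ≤⟨ *-monoʳ-≤ (suc m ^ suc m) (*-monoʳ-≤ a (amgm xs)) ⟩
  suc m ^ suc m * (a * s ^ m) ≤⟨ amgm-step m s a ⟩
  m ^ m * (s + a) ^ suc m ≡⟨ cong (λ t → m ^ m * t ^ suc m) (+-comm s a) ⟩
  m ^ m * (a + s) ^ suc m ∎)
  where
  m = length xs
  P = ListAction.product xs
  s = ListAction.sum xs
  e : ∀ u v a p → u * (v * (a * p)) ≡ v * (a * (u * p))
  e = solve-∀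

product-prod : ∀ {a} {X : Set a} (f : Fin n → X → ℕ) (xs : List X) →
  ListAction.product (List.map (λ x → prod λ i → f i x) xs) ≡ prod λ i → ListAction.product (List.map (f i) xs)
product-prod {n} f []       = sym (prod-1 n)
  where
  prod-1 : ∀ n → prod {n} (λ _ → 1) ≡ 1
  prod-1 zero    = refl
  prod-1 (suc n) = trans (+-identityʳ _) (prod-1 n)
product-prod f (x ∷ xs) = trans (cong ((prod λ i → f i x) *_) (product-prod f xs))
  (sym (prod-distrib-* (λ i → f i x) λ i → ListAction.product (List.map (f i) xs)))

product-^ : ∀ {a} {X : Set a} b (f : X → ℕ) (xs : List X) →
  ListAction.product (List.map (λ x → b ^ f x) xs) ≡ b ^ sumOver f xs
product-^ b f []       = refl
product-^ b f (x ∷ xs) = trans (cong (b ^ f x *_) (product-^ b f xs)) (sym (^-distribˡ-+-* b (f x) (sumOver f xs)))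

-- The entropy bound |A| ≤ ∏ exp H(xᵢ) for weights (1 - 1/pᵢ) at zᵢ and 1/(pᵢ(pᵢ - 1)) elsewhere, cleared of logarithms.
entropy : {p : Vec ℕ n} (A : Family p) (W : Fin n → Bool) (z : S p) → (∀ i → 1 ≤ lookup p i) →
  card A ^ card A * prodOver W (λ i → ((lookup p i ∸ 1) ^ 2) ^ slice A i (z at i)) ≤
  (prod (lookup p) * prodOver W (λ i → lookup p i ∸ 1)) ^ card A
entropy {n} {p} A W z 1≤p = begin
  card A ^ card A * prodOver W (λ i → b i ^ slice A i (z at i))
    ≡⟨ cong (card A ^ card A *_) (sym (trans (product-prod (λ i x → b i ^ ⟦ W i ∧ does (x at i ≟ z at i) ⟧) L) (prod-cong-≗ each))) ⟩
  length L ^ length L * ListAction.product ws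
    ≡⟨ cong (λ k → k ^ k * ListAction.product ws) (length-map w L) ⟨
  length ws ^ length ws * ListAction.product ws
    ≤⟨ amgm ws ⟩
  ListAction.sum ws ^ length ws
    ≡⟨ cong (ListAction.sum ws ^_) (length-map w L) ⟩
  ListAction.sum ws ^ card A
    ≤⟨ ^-monoˡ-≤ (card A) total ⟩
  (prod (lookup p) * prodOver W (λ i → lookup p i ∸ 1)) ^ card A ∎
  where
  -- Multiplied by pᵢ(pᵢ - 1), the two weights become (pᵢ - 1)² and 1. AM-GM for the products `w x`
  -- over the members x of A then takes the place of Gibbs' inequality.
  b : Fin n → ℕ
  b i = (lookup p i ∸ 1) ^ 2
  w : S p → ℕ
  w x = prod λ i → b i ^ ⟦ W i ∧ does (x at i ≟ z at i) ⟧
  L = filterᵇ A (vectors p)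
  ws = List.map w L
  each : ∀ i → ListAction.product (List.map (λ x → b i ^ ⟦ W i ∧ does (x at i ≟ z at i) ⟧) L) ≡ factor (W i) (b i ^ slice A i (z at i))
  each i = trans (product-^ (b i) (λ x → ⟦ W i ∧ does (x at i ≟ z at i) ⟧) L)
    (trans (cong (b i ^_) (sumOver-family A _)) (by-W (W i)))
    where
    by-W : ∀ c → b i ^ ∑ p (λ x → ⟦ A x ⟧ * ⟦ c ∧ does (x at i ≟ z at i) ⟧) ≡ factor c (b i ^ slice A i (z at i))
    by-W true  = cong (b i ^_) (∑-cong p λ x → *-comm ⟦ A x ⟧ _)
    by-W false = cong (b i ^_) (trans (∑-cong p λ x → *-zeroʳ ⟦ A x ⟧) (∑-zero p))
  total : ListAction.sum ws ≤ prod (lookup p) * prodOver W (λ i → lookup p i ∸ 1)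
  total = begin
    sumOver w L
      ≡⟨ sumOver-family A w ⟩
    ∑ p (λ x → ⟦ A x ⟧ * w x)
      ≤⟨ ∑-mono-≤ p (λ x → ≤-trans (*-monoˡ-≤ (w x) (⟦⟧≤1 (A x))) (≤-reflexive (*-identityˡ (w x)))) ⟩
    ∑ p w
      ≡⟨ ∑-prod p (λ i v → b i ^ ⟦ W i ∧ does (v ≟ z at i) ⟧) ⟩
    prod (λ i → sum λ v → b i ^ ⟦ W i ∧ does (v ≟ z at i) ⟧)
      ≡⟨ prod-cong-≗ (λ i → by-W (W i) (1≤p i) (z at i)) ⟩
    prod (λ i → lookup p i * factor (W i) (lookup p i ∸ 1))
      ≡⟨ prod-distrib-* (lookup p) (λ i → factor (W i) (lookup p i ∸ 1)) ⟩
    prod (lookup p) * prodOver W (λ i → lookup p i ∸ 1) ∎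
    where
    by-W : ∀ c {k} → 1 ≤ k → (l : Fin k) →
      sum (λ v → ((k ∸ 1) ^ 2) ^ ⟦ c ∧ does (v ≟ l) ⟧) ≡ k * factor c (k ∸ 1)
    by-W false {k}     _ l = sum-const k 1
    by-W true  {suc h} _ l = begin-equality
      sum (λ v → (h ^ 2) ^ ⟦ does (v ≟ l) ⟧)
        ≡⟨ sum-cong-≗ (λ v → split (does (v ≟ l))) ⟩
      sum (λ v → ⟦ does (v ≟ l) ⟧ * h ^ 2 + ⟦ not (does (v ≟ l)) ⟧)
        ≡⟨ ∑-distrib-+ (λ v → ⟦ does (v ≟ l) ⟧ * h ^ 2) (λ v → ⟦ not (does (v ≟ l)) ⟧) ⟩
      sum (λ v → ⟦ does (v ≟ l) ⟧ * h ^ 2) + sum (λ v → ⟦ not (does (v ≟ l)) ⟧)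
        ≡⟨ cong₂ _+_ (sum-single l (λ _ → h ^ 2)) (sum-not-≟′ (s≤s z≤n) l) ⟩
      h * (h * 1) + h
        ≡⟨ e h ⟩
      suc h * h ∎
      where
      e : ∀ h → h * (h * 1) + h ≡ suc h * h
      e = solve-∀
      split : ∀ c → (h ^ 2) ^ ⟦ c ⟧ ≡ ⟦ c ⟧ * h ^ 2 + ⟦ not c ⟧
      split true  = e′ (h ^ 2)
        where
        e′ : ∀ t → t * 1 ≡ 1 * t + 0
        e′ = solve-∀
      split false = refl

^-cancel-< : ∀ k {a b} → a ^ k < b ^ k → a < b
^-cancel-< k lt = ≰⇒> λ b≤a → <⇒≱ lt (^-monoˡ-≤ k b≤a)

^-mono-<ˡ : ∀ {k a b} → 1 ≤ k → a < b → a ^ k < b ^ k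
^-mono-<ˡ {suc k} _ = ^-monoˡ-< (suc k)

prod-mono-< : {f g : Fin n → ℕ} → (∀ i → 1 ≤ f i) → (∀ i → f i ≤ g i) → ∀ j → f j < g j → prod f < prod g
prod-mono-< {suc n} {f} {g} 1≤f f≤g zero lt = begin-strict
  f zero * prod (f ∘ suc) <⟨ *-monoˡ-< (prod (f ∘ suc)) {{>-nonZero (prod-pos (1≤f ∘ suc))}} lt ⟩
  g zero * prod (f ∘ suc) ≤⟨ *-monoʳ-≤ (g zero) (prod-mono-≤ (f≤g ∘ suc)) ⟩
  g zero * prod (g ∘ suc) ∎
prod-mono-< {suc n} {f} {g} 1≤f f≤g (suc j) lt = begin-strict
  f zero * prod (f ∘ suc) <⟨ *-monoʳ-< (f zero) {{>-nonZero (1≤f zero)}} (prod-mono-< (1≤f ∘ suc) (f≤g ∘ suc) j lt) ⟩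
  f zero * prod (g ∘ suc) ≤⟨ *-monoˡ-≤ (prod (g ∘ suc)) (f≤g zero) ⟩
  g zero * prod (g ∘ suc) ∎

prodOver-^ : (W : Fin n → Bool) (f : Fin n → ℕ) → ∀ k → prodOver W (λ i → f i ^ k) ≡ prodOver W f ^ k
prodOver-^ W f k = trans (prod-cong-≗ λ i → each (W i)) (prod-^ (λ i → factor (W i) (f i)) k)
  where
  each : ∀ b {m} → factor b (m ^ k) ≡ factor b m ^ k
  each true  = refl
  each false = sym (^-zeroˡ k)

prodOver-* : (W : Fin n → Bool) (f g : Fin n → ℕ) → prodOver W (λ i → f i * g i) ≡ prodOver W f * prodOver W g
prodOver-* W f g = trans (prod-cong-≗ λ i → each (W i)) (prod-distrib-* (λ i → factor (W i) (f i)) λ i → factor (W i) (g i))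
  where
  each : ∀ b {m n} → factor b (m * n) ≡ factor b m * factor b n
  each true  = refl
  each false = refl

-- (1 - 2/k) log (k - 1) > (r / (r + 4)) log k, without logarithms.
Steep : ℕ → ℕ → Set
Steep r k = k ^ (r * k) < (k ∸ 1) ^ ((r + 4) * (k ∸ 2))

-- Take k-th powers and replace kG by its lower bound (k - 1)M. The exponent of k - 1 on the right
-- then exceeds the one on the left by (r + 4)(k - 2)M, so the M-th power of `Steep` remains.
steep⇒gain : ∀ {r k M G} → 3 ≤ k → 1 ≤ M → (k ∸ 1) * M ≤ k * G → Steep r k →
  k ^ (r * M) * (k ∸ 1) ^ ((r + 4) * M) < (((k ∸ 1) ^ 2) ^ G) ^ (r + 4)
steep⇒gain {r} {k@(suc (suc h))} {M} {G} 3≤k 1≤M mM≤kG st = ^-cancel-< k (begin-strict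
  (k ^ (r * M) * m ^ (e * M)) ^ k
    ≡⟨ trans (^-distrib-* (k ^ (r * M)) (m ^ (e * M)) k) (cong₂ _*_ (^-*-assoc k (r * M) k) (^-*-assoc m (e * M) k)) ⟩
  k ^ (r * M * k) * m ^ (e * M * k)
    ≡⟨ cong (λ t → k ^ t * m ^ (e * M * k)) (swap₂₃ r M k) ⟩
  k ^ (r * k * M) * m ^ (e * M * k)
    ≡⟨ cong (_* m ^ (e * M * k)) (^-*-assoc k (r * k) M) ⟨
  (k ^ (r * k)) ^ M * m ^ (e * M * k)
    <⟨ *-monoˡ-< (m ^ (e * M * k)) {{>-nonZero (^-pos (e * M * k) (s≤s z≤n))}} (^-mono-<ˡ 1≤M st) ⟩
  (m ^ (e * h)) ^ M * m ^ (e * M * k)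
    ≡⟨ cong (_* m ^ (e * M * k)) (^-*-assoc m (e * h) M) ⟩
  m ^ (e * h * M) * m ^ (e * M * k)
    ≡⟨ ^-distribˡ-+-* m (e * h * M) (e * M * k) ⟨
  m ^ (e * h * M + e * M * k)
    ≡⟨ cong (m ^_) (e₁ e h M) ⟩
  m ^ (2 * e * (m * M))
    ≤⟨ ^-monoʳ-≤ m (*-monoʳ-≤ (2 * e) mM≤kG) ⟩
  m ^ (2 * e * (k * G))
    ≡⟨ cong (m ^_) (e₂ e k G) ⟩
  m ^ (2 * G * e * k)
    ≡⟨ trans (cong (λ t → (t ^ e) ^ k) (^-*-assoc m 2 G)) (trans (cong (_^ k) (^-*-assoc m (2 * G) e)) (^-*-assoc m (2 * G * e) k)) ⟨
  (((m ^ 2) ^ G) ^ e) ^ k ∎)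
  where
  m = suc h
  e = r + 4
  swap₂₃ : ∀ a b c → a * b * c ≡ a * c * b
  swap₂₃ = solve-∀
  e₁ : ∀ e h M → e * h * M + e * M * (2 + h) ≡ 2 * e * ((1 + h) * M)
  e₁ = solve-∀
  e₂ : ∀ e k G → 2 * e * (k * G) ≡ 2 * G * e * k
  e₂ = solve-∀
steep⇒gain {k = suc zero} (s≤s ()) _ _ _

module Bounded {m : ℕ} {p : Vec ℕ (suc m)} {r : ℕ} (3≤p : ∀ i → 3 ≤ lookup p i) (steep : ∀ i → Steep r (lookup p i)) where

  private
    e = r + 4
    Q = prod (lookup p)

  -- This is |A| < Q/Π^(r/(r + 4)): the entropy bound to the power r + 4, with `steep⇒gain` applied
  -- at every coordinate of W. The weights pᵢ - 1 appear on both sides and cancel, and the M-th root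
  -- is taken last.
  family-bound : (A : Family p) (W : Fin (suc m) → Bool) (z : S p) → 1 ≤ card A → 1 ≤ count W →
    (∀ i → T (W i) → lookup p i * offSlice A i (z at i) ≤ card A) →
    card A ^ e * prodOver W (lookup p) ^ r < Q ^ e
  family-bound A W z 1≤M 1≤W rare = ^-cancel-< M (*-cancelʳ-< R _ _ (begin-strict
    (M ^ e * Π ^ r) ^ M * R
      ≡⟨ cong (_* R) (trans (^-distrib-* (M ^ e) (Π ^ r) M) (cong₂ _*_ (^-comm M e M) (^-*-assoc Π r M))) ⟩
    (M ^ M) ^ e * Π ^ (r * M) * R
      ≡⟨ *-assoc ((M ^ M) ^ e) (Π ^ (r * M)) R ⟩
    (M ^ M) ^ e * (Π ^ (r * M) * R)
      <⟨ *-monoʳ-< ((M ^ M) ^ e) {{m^n≢0 (M ^ M) e {{n^n≢0 M}}}} gain ⟩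
    (M ^ M) ^ e * weighted ^ e
      ≡⟨ ^-distrib-* (M ^ M) weighted e ⟨
    (M ^ M * weighted) ^ e
      ≤⟨ ^-monoˡ-≤ e (entropy A W z 1≤p) ⟩
    ((Q * Πm) ^ M) ^ e
      ≡⟨ trans (^-comm (Q * Πm) M e) (trans (cong (_^ M) (^-distrib-* Q Πm e)) (^-distrib-* (Q ^ e) (Πm ^ e) M)) ⟩
    (Q ^ e) ^ M * (Πm ^ e) ^ M
      ≡⟨ cong ((Q ^ e) ^ M *_) (^-*-assoc Πm e M) ⟩
    (Q ^ e) ^ M * R ∎))
    where
    M = card A
    Π = prodOver W (lookup p)
    Πm = prodOver W (λ i → lookup p i ∸ 1)
    R = Πm ^ (e * M)
    1≤p : ∀ i → 1 ≤ lookup p i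
    1≤p i = ≤-trans (s≤s z≤n) (3≤p i)
    weighted = prodOver W (λ i → ((lookup p i ∸ 1) ^ 2) ^ slice A i (z at i))
    ^-comm : ∀ a b c → (a ^ b) ^ c ≡ (a ^ c) ^ b
    ^-comm a b c = trans (^-*-assoc a b c) (trans (cong (a ^_) (*-comm b c)) (sym (^-*-assoc a c b)))
    popular-share : ∀ i → T (W i) → (lookup p i ∸ 1) * M ≤ lookup p i * slice A i (z at i)
    popular-share i Wi = +-cancelˡ-≤ M _ _ (begin
      M + (lookup p i ∸ 1) * M
        ≡⟨ cong (_* M) (m+[n∸m]≡n (1≤p i)) ⟩
      lookup p i * M
        ≡⟨ cong (lookup p i *_) (trans (+-comm (offSlice A i (z at i)) (slice A i (z at i))) (slice+offSlice A i (z at i))) ⟨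
      lookup p i * (offSlice A i (z at i) + slice A i (z at i))
        ≡⟨ *-distribˡ-+ (lookup p i) _ _ ⟩
      lookup p i * offSlice A i (z at i) + lookup p i * slice A i (z at i)
        ≤⟨ +-monoˡ-≤ _ (rare i Wi) ⟩
      M + lookup p i * slice A i (z at i) ∎)
    f g : Fin (suc m) → ℕ
    f i = factor (W i) (lookup p i ^ (r * M) * (lookup p i ∸ 1) ^ (e * M))
    g i = factor (W i) ((((lookup p i ∸ 1) ^ 2) ^ slice A i (z at i)) ^ e)
    local : ∀ i → T (W i) → lookup p i ^ (r * M) * (lookup p i ∸ 1) ^ (e * M) < (((lookup p i ∸ 1) ^ 2) ^ slice A i (z at i)) ^ e
    local i Wi = steep⇒gain {r} {lookup p i} {M} {slice A i (z at i)} (3≤p i) 1≤M (popular-share i Wi) (steep i)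
    1≤f : ∀ i → 1 ≤ f i
    1≤f i with W i
    ... | true  = *-mono-≤ (^-pos (r * M) (1≤p i)) (^-pos (e * M) (∸-monoˡ-≤ 1 (≤-trans (s≤s (s≤s z≤n)) (3≤p i))))
    ... | false = ≤-refl
    f≤g : ∀ i → f i ≤ g i
    f≤g i with W i | local i
    ... | true  | lt = <⇒≤ (lt tt)
    ... | false | _  = ≤-refl
    gain : Π ^ (r * M) * R < weighted ^ e
    gain = begin-strict
      Π ^ (r * M) * R
        ≡⟨ cong₂ _*_ (prodOver-^ W (lookup p) (r * M)) (prodOver-^ W (λ i → lookup p i ∸ 1) (e * M)) ⟨
      prodOver W (λ i → lookup p i ^ (r * M)) * prodOver W (λ i → (lookup p i ∸ 1) ^ (e * M))
        ≡⟨ prodOver-* W (λ i → lookup p i ^ (r * M)) (λ i → (lookup p i ∸ 1) ^ (e * M)) ⟨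
      prod f
        <⟨ prod-mono-< 1≤f f≤g (proj₁ j) (f<g (proj₁ j) (proj₂ j)) ⟩
      prod g
        ≡⟨ prodOver-^ W (λ i → ((lookup p i ∸ 1) ^ 2) ^ slice A i (z at i)) e ⟩
      weighted ^ e ∎
      where
      j : ∃ λ j → T (W j)
      j = count>0⇒∃ W 1≤W
      f<g : ∀ j → T (W j) → f j < g j
      f<g j Wj with W j | local j
      ... | true | lt = lt tt

  module _ {A B : Family p} (1≤r : 1 ≤ r) (r≤n : r ≤ suc m) (sorted : Linked _≤_ p) (st : Structure r A B) where

    open Structure st
    private
      D = productOfFirst r p
      E = productAfter r p
      Π = prodOver W (lookup p)
      1≤p : ∀ i → 1 ≤ lookup p i
      1≤p i = ≤-trans (s≤s z≤n) (3≤p i)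
      D*E≡Q : D * E ≡ Q
      D*E≡Q = productOfFirst*productAfter r p

    -- With the separating size c, D ≤ c^r and Π ≥ D c⁴, so D^(r + 4) ≤ (D c⁴)^r ≤ Π^r. Four is the
    -- least surplus of relevant coordinates to be ruled out.
    many⇒D^≤Π^ : ∀ {g} → count W ≡ r + (4 + g) → D ^ e ≤ Π ^ r
    many⇒D^≤Π^ {g} W≡ = go (threshold p sorted r 1≤r r≤n)
      where
      go : (∃ λ c → head p ≤ c × Threshold c r p) → D ^ e ≤ Π ^ r
      go (c , head≤c , th) = begin
        D ^ (r + 4) ≡⟨ ^-distribˡ-+-* D r 4 ⟩
        D ^ r * D ^ 4 ≤⟨ *-monoʳ-≤ (D ^ r) (^-monoˡ-≤ 4 (productOfFirst≤^ th)) ⟩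
        D ^ r * (c ^ r) ^ 4 ≡⟨ cong (D ^ r *_) (trans (^-*-assoc c r 4) (trans (cong (c ^_) (*-comm r 4)) (sym (^-*-assoc c 4 r)))) ⟩
        D ^ r * (c ^ 4) ^ r ≡⟨ ^-distrib-* D (c ^ 4) r ⟨
        (D * c ^ 4) ^ r ≤⟨ ^-monoˡ-≤ r (*-monoʳ-≤ D (^-monoʳ-≤ c {{c≢0}} (m≤m+n 4 g))) ⟩
        (D * c ^ (4 + g)) ^ r ≤⟨ ^-monoˡ-≤ r (productOfFirst*^≤prodOver th W W≡) ⟩
        Π ^ r ∎
        where
        c≢0 : NonZero c
        c≢0 = >-nonZero (≤-trans (subst (1 ≤_) (lookup-0 p) (1≤p zero)) head≤c)
          where
          lookup-0 : ∀ {m} (p : Vec ℕ (suc m)) → lookup p zero ≡ head p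
          lookup-0 (q ∷ p) = refl

    -- Otherwise the bounds for A and B multiply to (|A| |B|)^e Π^(2r) < Q^(2e) = (DE)^(2e),
    -- although Π^r ≥ D^e and |A| |B| ≥ E².
    few-relevant : count W ≤ r + 3
    few-relevant = ≮⇒≥ λ lt → absurd (m≤n⇒∃[o]m+o≡n lt)
      where
      absurd : ¬ (∃ λ g → suc (r + 3) + g ≡ count W)
      absurd (g , eq) = <⇒≱ (*-mono-< A< B<) (begin
        Q ^ e * Q ^ e ≡⟨ cong (λ q → q ^ e * q ^ e) D*E≡Q ⟨
        (D * E) ^ e * (D * E) ^ e ≡⟨ cong₂ _*_ (^-distrib-* D E e) (^-distrib-* D E e) ⟩
        D ^ e * E ^ e * (D ^ e * E ^ e) ≤⟨ *-mono-≤ (*-monoˡ-≤ (E ^ e) D≤) (*-monoˡ-≤ (E ^ e) D≤) ⟩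
        Π ^ r * E ^ e * (Π ^ r * E ^ e) ≡⟨ e₁ (Π ^ r) (E ^ e) ⟩
        E ^ e * E ^ e * (Π ^ r * Π ^ r) ≡⟨ cong (_* (Π ^ r * Π ^ r)) (^-distrib-* E E e) ⟨
        (E * E) ^ e * (Π ^ r * Π ^ r) ≤⟨ *-monoˡ-≤ (Π ^ r * Π ^ r) (^-monoˡ-≤ e (Maximal⇒productAfter²≤ {A = A} {B} 1≤p r≤n maximal)) ⟩
        (card A * card B) ^ e * (Π ^ r * Π ^ r) ≡⟨ cong (_* (Π ^ r * Π ^ r)) (^-distrib-* (card A) (card B) e) ⟩
        card A ^ e * card B ^ e * (Π ^ r * Π ^ r) ≡⟨ [m*n]*[o*p]≡[m*o]*[n*p] (card A ^ e) (card B ^ e) (Π ^ r) (Π ^ r) ⟩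
        card A ^ e * Π ^ r * (card B ^ e * Π ^ r) ∎)
        where
        W≡ : count W ≡ r + (4 + g)
        W≡ = trans (sym eq) (trans (cong (λ t → suc t + g) (+-comm r 3)) (trans (+-assoc 4 r g) (e₂ r g)))
          where
          e₂ : ∀ r g → 4 + (r + g) ≡ r + (4 + g)
          e₂ = solve-∀
        1≤W : 1 ≤ count W
        1≤W = subst (1 ≤_) (sym W≡) (≤-trans 1≤r (m≤m+n r (4 + g)))
        D≤ : D ^ e ≤ Π ^ r
        D≤ = many⇒D^≤Π^ W≡
        A< : card A ^ e * Π ^ r < Q ^ e
        A< = family-bound A W z card>0ˡ 1≤W (λ i Wi → Popular.rare (proj₁ (popularity i Wi)))
        B< : card B ^ e * Π ^ r < Q ^ e
        B< = family-bound B W z card>0ʳ 1≤W (λ i Wi → Popular.rare (proj₂ (popularity i Wi)))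
        e₁ : ∀ u v → u * v * (u * v) ≡ v * v * (u * u)
        e₁ = solve-∀

-- Numerical inequalities

-- Bernoulli's inequality (1 - 1/(m + 1))^h ≥ 1 - h/(m + 1), times (m + 1)^(h + 1).
bernoulli : ∀ m h → suc m ^ h * suc m ≤ m ^ h * suc m + h * suc m ^ h
bernoulli m zero    = m≤m+n _ 0
bernoulli m (suc h) = begin
  suc m * suc m ^ h * suc m ≡⟨ *-assoc (suc m) (suc m ^ h) (suc m) ⟩
  suc m * (suc m ^ h * suc m) ≤⟨ *-monoʳ-≤ (suc m) (bernoulli m h) ⟩
  suc m * (m ^ h * suc m + h * suc m ^ h) ≡⟨ e₁ m h (m ^ h) (suc m ^ h) ⟩
  m * m ^ h * suc m + h * (suc m * suc m ^ h) + suc m * m ^ h ≤⟨ +-monoʳ-≤ (m * m ^ h * suc m + h * (suc m * suc m ^ h)) (*-monoʳ-≤ (suc m) (^-monoˡ-≤ h (n≤1+n m))) ⟩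
  m * m ^ h * suc m + h * (suc m * suc m ^ h) + suc m * suc m ^ h ≡⟨ e₂ (m * m ^ h * suc m) h (suc m * suc m ^ h) ⟩
  m * m ^ h * suc m + suc h * (suc m * suc m ^ h) ∎
  where
  e₁ : ∀ m h u v → suc m * (u * suc m + h * v) ≡ m * u * suc m + h * (suc m * v) + suc m * u
  e₁ = solve-∀
  e₂ : ∀ a h v → a + h * v + v ≡ a + suc h * v
  e₂ = solve-∀

half-power : ∀ m h → 2 * h ≤ suc m → suc m ^ h ≤ 2 * m ^ h
half-power m h 2h≤ = *-cancelʳ-≤ _ _ (suc m) (+-cancelʳ-≤ (suc m * suc m ^ h) _ _ (begin
  suc m ^ h * suc m + suc m * suc m ^ h ≡⟨ e₁ (suc m ^ h) (suc m) ⟩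
  2 * (suc m ^ h * suc m) ≤⟨ *-monoʳ-≤ 2 (bernoulli m h) ⟩
  2 * (m ^ h * suc m + h * suc m ^ h) ≡⟨ e₂ (m ^ h) (suc m) h (suc m ^ h) ⟩
  2 * m ^ h * suc m + 2 * h * suc m ^ h ≤⟨ +-monoʳ-≤ (2 * m ^ h * suc m) (*-monoˡ-≤ (suc m ^ h) 2h≤) ⟩
  2 * m ^ h * suc m + suc m * suc m ^ h ∎))
  where
  e₁ : ∀ u v → u * v + v * u ≡ 2 * (u * v)
  e₁ = solve-∀
  e₂ : ∀ u v h w → 2 * (u * v + h * w) ≡ 2 * u * v + 2 * h * w
  e₂ = solve-∀

double-power : ∀ m h → 2 * h ≤ suc m → suc m ^ (h + h) ≤ 4 * m ^ (h + h)
double-power m h 2h≤ = begin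
  suc m ^ (h + h) ≡⟨ ^-distribˡ-+-* (suc m) h h ⟩
  suc m ^ h * suc m ^ h ≤⟨ *-mono-≤ (half-power m h 2h≤) (half-power m h 2h≤) ⟩
  2 * m ^ h * (2 * m ^ h) ≡⟨ [m*n]*[o*p]≡[m*o]*[n*p] 2 (m ^ h) 2 (m ^ h) ⟩
  4 * (m ^ h * m ^ h) ≡⟨ cong (4 *_) (^-distribˡ-+-* m h h) ⟨
  4 * m ^ (h + h) ∎

parity : ∀ m → ∃ λ h → m ≡ h + h ⊎ suc m ≡ h + h
parity zero    = 0 , inj₁ refl
parity (suc m) with parity m
... | h , inj₁ e = suc h , inj₂ (trans (cong (2 +_) e) (cong suc (sym (+-suc h h))))
... | h , inj₂ e = h , inj₁ e

-- The bound 4 stands in for e. Bernoulli yields a factor 2 for an exponent up to half of m + 1, so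
-- two halves yield 4. For odd m the exponent m + 1 is halved instead and one factor is given up
-- afterwards.
[1+m]^m≤4m^m : ∀ m → suc m ^ m ≤ 4 * m ^ m
[1+m]^m≤4m^m m with parity m
... | h , inj₁ e = subst (λ k → suc m ^ k ≤ 4 * m ^ k) (sym e) (double-power m h (≤-trans (≤-reflexive (trans (cong (h +_) (+-identityʳ h)) (sym e))) (n≤1+n m)))
... | h , inj₂ e = *-cancelˡ-≤ (suc m) (begin
  suc m ^ suc m ≤⟨ subst (λ k → suc m ^ k ≤ 4 * m ^ k) (sym e) (double-power m h (≤-reflexive (trans (cong (h +_) (+-identityʳ h)) (sym e)))) ⟩
  4 * (m * m ^ m) ≤⟨ *-monoʳ-≤ 4 (*-monoˡ-≤ (m ^ m) (n≤1+n m)) ⟩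
  4 * (suc m * m ^ m) ≡⟨ x∙yz≈y∙xz 4 (suc m) (m ^ m) ⟩
  suc m * (4 * m ^ m) ∎)

-- Raising r by d multiplies the smaller side by k^(dk) and the larger one only by (k - 1)^(d(k -
-- 2)), so the condition is easier for smaller r.
steep-≤ : ∀ {r r′ k} → 3 ≤ k → r ≤ r′ → Steep r′ k → Steep r k
steep-≤ {r} {r′} {k@(suc (suc h))} 3≤k r≤r′ st with d , refl ← m≤n⇒∃[o]m+o≡n r≤r′ =
  *-cancelʳ-< (k ^ (d * k)) _ _ (begin-strict
    k ^ (r * k) * k ^ (d * k) ≡⟨ ^-distribˡ-+-* k (r * k) (d * k) ⟨
    k ^ (r * k + d * k) ≡⟨ cong (k ^_) (*-distribʳ-+ k r d) ⟨
    k ^ ((r + d) * k) <⟨ st ⟩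
    suc h ^ ((r + d + 4) * h) ≡⟨ cong (suc h ^_) (e r d h) ⟩
    suc h ^ ((r + 4) * h + d * h) ≡⟨ ^-distribˡ-+-* (suc h) ((r + 4) * h) (d * h) ⟩
    suc h ^ ((r + 4) * h) * suc h ^ (d * h) ≤⟨ *-monoʳ-≤ (suc h ^ ((r + 4) * h)) (≤-trans (^-monoˡ-≤ (d * h) (n≤1+n (suc h)))
                                                    (^-monoʳ-≤ k (*-monoʳ-≤ d (m≤n+m h 2)))) ⟩
    suc h ^ ((r + 4) * h) * k ^ (d * k) ∎)
  where
  e : ∀ r d h → (r + d + 4) * h ≡ (r + 4) * h + d * h
  e = solve-∀
steep-≤ {k = suc zero} (s≤s ())

-- For r = m = k - 1, comparing (m + 4)(m - 1) with m(m + 1) leaves a gain of m^(2m - 4). It has to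
-- beat the factor 4^k lost in replacing k^m by m^m.
steep-6+ : ∀ j → Steep (5 + j) (6 + j)
steep-6+ j = begin-strict
  k ^ (m * k) ≡⟨ ^-*-assoc k m k ⟨
  (k ^ m) ^ k ≤⟨ ^-monoˡ-≤ k ([1+m]^m≤4m^m m) ⟩
  (4 * m ^ m) ^ k ≡⟨ trans (^-distrib-* 4 (m ^ m) k) (cong (4 ^ k *_) (^-*-assoc m m k)) ⟩
  4 ^ (6 + j) * m ^ (m * k) <⟨ *-monoˡ-< (m ^ (m * k)) {{m^n≢0 m (m * k)}} small ⟩
  m ^ (6 + 2 * j) * m ^ (m * k) ≡⟨ ^-distribˡ-+-* m (6 + 2 * j) (m * k) ⟨
  m ^ (6 + 2 * j + m * k) ≡⟨ cong (m ^_) (e j) ⟩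
  m ^ ((m + 4) * (4 + j)) ∎
  where
  m = 5 + j
  k = 6 + j
  e : ∀ j → 6 + 2 * j + (5 + j) * (6 + j) ≡ (5 + j + 4) * (4 + j)
  e = solve-∀
  small : 4 ^ (6 + j) < m ^ (6 + 2 * j)
  small = begin-strict
    4 ^ (6 + j) ≡⟨ ^-distribˡ-+-* 4 6 j ⟩
    4 ^ 6 * 4 ^ j <⟨ *-monoˡ-< (4 ^ j) {{m^n≢0 4 j}} (<ᵇ⇒< (4 ^ 6) (5 ^ 6) tt) ⟩
    5 ^ 6 * 4 ^ j ≤⟨ *-monoʳ-≤ (5 ^ 6) (^-monoˡ-≤ j (<ᵇ⇒< 3 25 tt)) ⟩
    5 ^ 6 * 25 ^ j ≡⟨ cong (5 ^ 6 *_) (^-*-assoc 5 2 j) ⟩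
    5 ^ 6 * 5 ^ (2 * j) ≡⟨ ^-distribˡ-+-* 5 6 (2 * j) ⟨
    5 ^ (6 + 2 * j) ≤⟨ ^-monoˡ-≤ (6 + 2 * j) (m≤m+n 5 j) ⟩
    m ^ (6 + 2 * j) ∎

-- By monotonicity only r = k - 1 has to be checked, and k = 5 is a computation. At k = 4, r = 3 the
-- inequality fails, as 4¹² > 3¹⁴; hence the condition r + 1 > 4.
steep-5+ : ∀ {r k} → 5 ≤ k → r < k → Steep r k
steep-5+ {r} {k} 5≤k r<k with m≤n⇒∃[o]m+o≡n 5≤k
... | zero  , refl = steep-≤ {r} (s≤s (s≤s (s≤s z≤n))) (≤-pred r<k) (<ᵇ⇒< (5 ^ 20) (4 ^ 24) tt)
... | suc j , refl = steep-≤ {r} (s≤s (s≤s (s≤s z≤n))) (≤-pred r<k) (steep-6+ j)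

-- Below k = 5 only (r, k) = (1, 3), (1, 4) and (2, 4) occur, and they are computed.
steep-2+ : ∀ {r k} → 1 ≤ r → 2 + r ≤ k → Steep r k
steep-2+ {r} 1≤r le with m≤n⇒∃[o]m+o≡n le
... | d , refl = go r d 1≤r
  where
  large : ∀ r d → 5 ≤ 2 + r + d → Steep r (2 + r + d)
  large r d 5≤k = steep-5+ 5≤k (≤-trans (n≤1+n (suc r)) (m≤m+n (2 + r) d))
  go : ∀ r d → 1 ≤ r → Steep r (2 + r + d)
  go 1 0 _ = <ᵇ⇒< (3 ^ 3) (2 ^ 5) tt
  go 1 1 _ = <ᵇ⇒< (4 ^ 4) (3 ^ 10) tt
  go 2 0 _ = <ᵇ⇒< (4 ^ 8) (3 ^ 12) tt
  go 1 (suc (suc d)) _ = large 1 (2 + d) (m≤m+n 5 d)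
  go 2 (suc d) _ = large 2 (suc d) (m≤m+n 5 d)
  go (suc (suc (suc r))) d _ = large (3 + r) d (≤-trans (m≤m+n 5 r) (m≤m+n (5 + r) d))

-- For k about r / 2 the gain 4k - 2r - 8 in the exponent has to beat the loss e^r, and this
-- is where k - 1 ≥ 2 ^ (j / 3) is used.
steep-log : ∀ {r k j} → 1 ≤ j → 8 * r + j * (r + 8) ≤ j * (2 * k) → 2 ^ j ≤ 2 * r → Steep r k
steep-log {r} {k} {j} 1≤j le 2^j≤ = go k refl (m≤n⇒∃[o]m+o≡n r+8≤2k)
  where
  r+8≤2k : r + 8 ≤ 2 * k
  r+8≤2k = *-cancelˡ-≤ j {{>-nonZero 1≤j}} (≤-trans (m≤n+m _ (8 * r)) le)
  go : ∀ k′ → k ≡ k′ → (∃ λ b → r + 8 + b ≡ 2 * k) → Steep r k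
  go zero refl (b , eq) = contradiction (≤-trans (m≤n+m 8 r) (≤-trans (m≤m+n (r + 8) b) (≤-reflexive eq))) λ ()
  go (suc zero) refl (b , eq) = contradiction (≤-trans (m≤n+m 8 r) (≤-trans (m≤m+n (r + 8) b) (≤-reflexive eq))) λ { (s≤s (s≤s ())) }
  go (suc (suc h)) refl (b , eq) = subst (k ^ (r * k) <_) (cong (m ^_) exponent) (^-cancel-< m (begin-strict
      (k ^ (r * k)) ^ m ≡⟨ trans (^-*-assoc k (r * k) m) (trans (cong (k ^_) (*-comm (r * k) m)) (sym (^-*-assoc k m (r * k)))) ⟩
      (k ^ m) ^ (r * k) ≤⟨ ^-monoˡ-≤ (r * k) ([1+m]^m≤4m^m m) ⟩
      (4 * m ^ m) ^ (r * k) ≡⟨ trans (^-distrib-* 4 (m ^ m) (r * k)) (cong (4 ^ (r * k) *_) (^-*-assoc m m (r * k))) ⟩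
      4 ^ (r * k) * m ^ (m * (r * k)) <⟨ *-monoˡ-< (m ^ (m * (r * k))) {{m^n≢0 m (m * (r * k))}} small ⟩
      m ^ (a * m) * m ^ (m * (r * k)) ≡⟨ ^-distribˡ-+-* m (a * m) (m * (r * k)) ⟨
      m ^ (a * m + m * (r * k)) ≡⟨ cong (m ^_) (e₁ a m (r * k)) ⟩
      m ^ ((r * k + a) * m) ≡⟨ ^-*-assoc m (r * k + a) m ⟨
      (m ^ (r * k + a)) ^ m ∎))
    where
    m = suc h
    -- This is the gain (r + 4)(k - 2) - rk = 4k - 2r - 8, expressed through b = 2k - r - 8.
    a = 2 * b + 8
    e₁ : ∀ a m t → a * m + m * t ≡ (t + a) * m
    e₁ = solve-∀
    r+4+b≡2h : r + 4 + b ≡ 2 * h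
    r+4+b≡2h = +-cancelˡ-≡ 4 _ _ (trans (e₂ r b) (trans eq (e₃ h)))
      where
      e₂ : ∀ r b → 4 + (r + 4 + b) ≡ r + 8 + b
      e₂ = solve-∀
      e₃ : ∀ h → 2 * (2 + h) ≡ 4 + 2 * h
      e₃ = solve-∀
    exponent : r * k + a ≡ (r + 4) * h
    exponent = trans (e₂ r h b) (trans (cong (λ t → r * h + 2 * t) r+4+b≡2h) (e₃ r h))
      where
      e₂ : ∀ r h b → r * (2 + h) + (2 * b + 8) ≡ r * h + 2 * (r + 4 + b)
      e₂ = solve-∀
      e₃ : ∀ r h → r * h + 2 * (2 * h) ≡ (r + 4) * h
      e₃ = solve-∀
    8r≤jb : 8 * r ≤ j * b
    8r≤jb = +-cancelʳ-≤ (j * (r + 8)) _ _ (≤-trans le (≤-reflexive (trans (cong (j *_) (sym eq)) (trans (*-distribˡ-+ j (r + 8) b) (+-comm (j * (r + 8)) (j * b))))))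
    2^j≤m³ : 2 ^ j ≤ m ^ 3
    2^j≤m³ = begin
      2 ^ j ≤⟨ 2^j≤ ⟩
      2 * r ≤⟨ *-monoʳ-≤ 2 (≤-trans (≤-trans (m≤m+n r 4) (m≤m+n (r + 4) b)) (≤-reflexive r+4+b≡2h)) ⟩
      2 * (2 * h) ≡⟨ e₂ h ⟩
      2 * 2 * h ≤⟨ *-mono-≤ (*-mono-≤ 2≤m 2≤m) (n≤1+n h) ⟩
      m * m * m ≡⟨ e₃ m ⟩
      m * (m * (m * 1)) ∎
      where
      e₂ : ∀ h → 2 * (2 * h) ≡ 2 * 2 * h
      e₂ = solve-∀
      e₃ : ∀ m → m * m * m ≡ m * (m * (m * 1))
      e₃ = solve-∀
      2≤m : 2 ≤ m
      2≤m = s≤s (*-cancelˡ-≤ 2 (≤-trans (≤-trans (s≤s (s≤s z≤n)) (≤-trans (m≤n+m 4 r) (m≤m+n (r + 4) b))) (≤-reflexive r+4+b≡2h)))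
    small : 4 ^ (r * k) < m ^ (a * m)
    small = ^-cancel-< 3 (begin-strict
      (4 ^ (r * k)) ^ 3 ≡⟨ trans (cong (_^ 3) (^-*-assoc 2 2 (r * k))) (^-*-assoc 2 (2 * (r * k)) 3) ⟩
      2 ^ (2 * (r * k) * 3) <⟨ ^-monoʳ-< 2 (s≤s (s≤s z≤n)) exponents ⟩
      2 ^ (j * (a * m)) ≡⟨ ^-*-assoc 2 j (a * m) ⟨
      (2 ^ j) ^ (a * m) ≤⟨ ^-monoˡ-≤ (a * m) 2^j≤m³ ⟩
      (m ^ 3) ^ (a * m) ≡⟨ trans (^-*-assoc m 3 (a * m)) (trans (cong (m ^_) (*-comm 3 (a * m))) (sym (^-*-assoc m (a * m) 3))) ⟩
      (m ^ (a * m)) ^ 3 ∎)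
      where
      -- Using 2^j ≤ m³ costs a factor 3 and brings the left side to at most 12rm. The constant 8 in
      -- the hypothesis leaves 16rm ≤ 2jbm to cover it.
      exponents : 2 * (r * k) * 3 < j * (a * m)
      exponents = begin-strict
        2 * (r * (2 + h)) * 3 ≤⟨ m≤m+n _ (6 * (r * h)) ⟩
        2 * (r * (2 + h)) * 3 + 6 * (r * h) ≡⟨ e₂ r h ⟩
        12 * r * m ≤⟨ *-monoˡ-≤ m (*-monoˡ-≤ r (<ᵇ⇒< 11 16 tt)) ⟩
        16 * r * m ≡⟨ cong (_* m) (e₃ r) ⟩
        2 * (8 * r) * m ≤⟨ *-monoˡ-≤ m (*-monoʳ-≤ 2 8r≤jb) ⟩
        2 * (j * b) * m <⟨ *-monoˡ-< m (m<m+n (2 * (j * b)) (*-mono-≤ {1} {8} (s≤s z≤n) 1≤j)) ⟩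
        (2 * (j * b) + 8 * j) * m ≡⟨ e₄ j b m ⟩
        j * (a * m) ∎
        where
        e₂ : ∀ r h → 2 * (r * (2 + h)) * 3 + 6 * (r * h) ≡ 12 * r * suc h
        e₂ = solve-∀
        e₃ : ∀ r → 16 * r ≡ 2 * (8 * r)
        e₃ = solve-∀
        e₄ : ∀ j b m → (2 * (j * b) + 8 * j) * m ≡ j * ((2 * b + 8) * m)
        e₄ = solve-∀

sizeable-4+ : ∀ {c r} → 4 ≤ c → r < c → Sizeable c r
sizeable-4+ {c} {r} 4≤c r<c = record
  { 3≤c = ≤-trans (s≤s (s≤s (s≤s z≤n))) 4≤c
  ; r+1< = begin-strict
      r + 1 ≡⟨ +-comm r 1 ⟩
      1 + r ≤⟨ r<c ⟩
      c <⟨ m<m*n c 2 {{>-nonZero (≤-trans (s≤s z≤n) 4≤c)}} (s≤s (s≤s z≤n)) ⟩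
      c * 2 ≤⟨ *-monoʳ-≤ c (∸-monoˡ-≤ 2 4≤c) ⟩
      c * (c ∸ 2) ∎
  ; 4≤c⊎r≡1 = inj₁ 4≤c }

sizeable-2+ : ∀ {c r} → 1 ≤ r → 2 + r ≤ c → Sizeable c r
sizeable-2+ {c} {r} 1≤r le with 4 ≤? c
... | yes 4≤c = sizeable-4+ 4≤c (≤-trans (n≤1+n (suc r)) le)
... | no ≰ = subst₂ Sizeable (sym c≡3) (sym r≡1) record
  { 3≤c = ≤-refl ; r+1< = ≤-refl ; 4≤c⊎r≡1 = inj₂ refl }
  where
  c≤3 : c ≤ 3
  c≤3 = ≤-pred (≰⇒> ≰)
  r≡1 : r ≡ 1
  r≡1 = ≤-antisym (≤-pred (≤-pred (≤-trans le c≤3))) 1≤r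
  c≡3 : c ≡ 3
  c≡3 = ≤-antisym c≤3 (≤-trans (+-monoʳ-≤ 2 1≤r) le)

sizeable-half : ∀ {c r} → 1 ≤ r → r + 8 ≤ 2 * c → Sizeable c r
sizeable-half {c} {r} 1≤r le = record
  { 3≤c = ≤-trans (s≤s (s≤s (s≤s z≤n))) 5≤c
  ; r+1< = *-cancelˡ-< 2 _ _ (begin-strict
      2 * (r + 1) <⟨ *-monoʳ-< 2 (+-monoʳ-< r {1} {4} (s≤s (s≤s z≤n))) ⟩
      2 * (r + 4) ≤⟨ *-monoˡ-≤ (r + 4) (≤-trans (s≤s (s≤s z≤n)) 5≤c) ⟩
      c * (r + 4) ≤⟨ *-monoʳ-≤ c (subst (r + 4 ≤_) (sym (*-distribˡ-∸ 2 c 2)) (subst (_≤ 2 * c ∸ 4) (+-∸-assoc r {8} {4} (s≤s (s≤s (s≤s (s≤s z≤n))))) (∸-monoˡ-≤ 4 le))) ⟩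
      c * (2 * (c ∸ 2)) ≡⟨ x∙yz≈y∙xz c 2 (c ∸ 2) ⟩
      2 * (c * (c ∸ 2)) ∎)
  ; 4≤c⊎r≡1 = inj₁ (≤-trans (n≤1+n 4) 5≤c) }
  where
  5≤c : 5 ≤ c
  5≤c = *-cancelˡ-< 2 4 c (≤-trans (+-monoˡ-≤ 8 1≤r) le)

-- Sizes of balls

-- The product of the sizes outside W times the j-th elementary symmetric polynomial in the numbers
-- pᵢ - 1 with i in W. The centre does not enter.
sphere : Vec ℕ n → (Fin n → Bool) → ℕ → ℕ
sphere []      W zero    = 1
sphere []      W (suc j) = 0
sphere (q ∷ p) W zero    = if W zero then sphere p (W ∘ suc) 0 else q * sphere p (W ∘ suc) 0
sphere (q ∷ p) W (suc j) =
  if W zero then sphere p (W ∘ suc) (suc j) + (q ∸ 1) * sphere p (W ∘ suc) j else q * sphere p (W ∘ suc) (suc j)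

sum-centre : ∀ {q} (w : Fin q) c d →
  sum (λ v → if does (v ≟ w) then c else d) ≡ c + (q ∸ 1) * d
sum-centre {suc h} w c d = begin-equality
  sum (λ v → if does (v ≟ w) then c else d)
    ≡⟨ sum-cong-≗ (λ v → split (does (v ≟ w))) ⟩
  sum (λ v → ⟦ does (v ≟ w) ⟧ * c + ⟦ not (does (v ≟ w)) ⟧ * d)
    ≡⟨ ∑-distrib-+ (λ v → ⟦ does (v ≟ w) ⟧ * c) (λ v → ⟦ not (does (v ≟ w)) ⟧ * d) ⟩
  sum (λ v → ⟦ does (v ≟ w) ⟧ * c) + sum (λ v → ⟦ not (does (v ≟ w)) ⟧ * d)
    ≡⟨ cong₂ _+_ (sum-single w (λ _ → c)) (sum-not-≟ w d) ⟩
  c + h * d ∎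
  where
  split : ∀ b → (if b then c else d) ≡ ⟦ b ⟧ * c + ⟦ not b ⟧ * d
  split true  = sym (trans (+-identityʳ (c + 0)) (+-identityʳ c))
  split false = sym (+-identityʳ d)

∑-sphere : (p : Vec ℕ n) (W : Fin n → Bool) (z : S p) → ∀ j →
  ∑ p (λ x → ⟦ dist W x z ≡ᵇ j ⟧) ≡ sphere p W j
∑-sphere []      W []      zero    = refl
∑-sphere []      W []      (suc j) = refl
∑-sphere (q ∷ p) W (w ∷ z) zero with W zero
... | false = trans (sum-const q _) (cong (q *_) (∑-sphere p (W ∘ suc) z 0))
... | true = trans
  (sum-cong-≗ λ v → split v)
  (trans (sum-centre w (sphere p (W ∘ suc) 0) 0) (trans (cong (sphere p (W ∘ suc) 0 +_) (*-zeroʳ (q ∸ 1))) (+-identityʳ _)))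
  where
  split : ∀ v → ∑ p (λ x → ⟦ ⟦ not (does (v ≟ w)) ⟧ + dist (W ∘ suc) x z ≡ᵇ 0 ⟧) ≡
    (if does (v ≟ w) then sphere p (W ∘ suc) 0 else 0)
  split v with does (v ≟ w)
  ... | true  = ∑-sphere p (W ∘ suc) z 0
  ... | false = ∑-zero p
∑-sphere (q ∷ p) W (w ∷ z) (suc j) with W zero
... | false = trans (sum-const q _) (cong (q *_) (∑-sphere p (W ∘ suc) z (suc j)))
... | true = trans
  (sum-cong-≗ λ v → split v) (sum-centre w (sphere p (W ∘ suc) (suc j)) (sphere p (W ∘ suc) j))
  where
  split : ∀ v → ∑ p (λ x → ⟦ ⟦ not (does (v ≟ w)) ⟧ + dist (W ∘ suc) x z ≡ᵇ suc j ⟧) ≡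
    (if does (v ≟ w) then sphere p (W ∘ suc) (suc j) else sphere p (W ∘ suc) j)
  split v with does (v ≟ w)
  ... | true  = ∑-sphere p (W ∘ suc) z (suc j)
  ... | false = ∑-sphere p (W ∘ suc) z j

volume : Vec ℕ n → (Fin n → Bool) → ℕ → ℕ
volume p W zero    = sphere p W 0
volume p W (suc k) = volume p W k + sphere p W (suc k)

sphere≤volume : (p : Vec ℕ n) (W : Fin n → Bool) → ∀ k → sphere p W k ≤ volume p W k
sphere≤volume p W zero    = ≤-refl
sphere≤volume p W (suc k) = m≤n+m _ (volume p W k)

card-ball : {p : Vec ℕ n} (W : Fin n → Bool) (z : S p) → ∀ k → card (ball W z k) ≡ volume p W k
card-ball {p = p} W z k = trans (card≡∑ (ball W z k)) (go k)
  where
  ≤ᵇ0 : ∀ d → ⟦ d ≤ᵇ 0 ⟧ ≡ ⟦ d ≡ᵇ 0 ⟧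
  ≤ᵇ0 zero    = refl
  ≤ᵇ0 (suc d) = refl
  ≤ᵇsuc : ∀ d k → ⟦ d ≤ᵇ suc k ⟧ ≡ ⟦ d ≤ᵇ k ⟧ + ⟦ d ≡ᵇ suc k ⟧
  ≤ᵇsuc zero          k       = refl
  ≤ᵇsuc (suc zero)    zero    = refl
  ≤ᵇsuc (suc (suc d)) zero    = refl
  ≤ᵇsuc (suc zero)    (suc k) = refl
  ≤ᵇsuc (suc (suc d)) (suc k) = ≤ᵇsuc (suc d) k
  go : ∀ k → ∑ p (λ x → ⟦ ball W z k x ⟧) ≡ volume p W k
  go zero    = trans (∑-cong p λ x → ≤ᵇ0 (dist W x z)) (∑-sphere p W z 0)
  go (suc k) = trans (∑-cong p λ x → ≤ᵇsuc (dist W x z) k)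
    (trans (∑-distrib p (λ x → ⟦ ball W z k x ⟧) (λ x → ⟦ dist W x z ≡ᵇ suc k ⟧)) (cong₂ _+_ (go k) (∑-sphere p W z (suc k))))

-- Double counting: a vector at distance j becomes one at distance j + 1 by changing one of |W| - j
-- coordinates to one of at most M values, and each vector at distance j + 1 arises in j + 1 ways.
-- The term with M j stands on the left to avoid a subtraction.
sphere-step : (p : Vec ℕ n) (W : Fin n → Bool) (M : ℕ) → (∀ i → T (W i) → lookup p i ∸ 1 ≤ M) → ∀ j →
  suc j * sphere p W (suc j) + M * j * sphere p W j ≤ M * count W * sphere p W j
sphere-step []      W M q≤M zero    = ≤-refl
sphere-step []      W M q≤M (suc j) = ≤-reflexive (trans (cong (_+ M * suc j * 0) (*-zeroʳ (suc (suc j)))) (trans (*-zeroʳ (M * suc j)) (sym (*-zeroʳ (M * 0)))))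
sphere-step (q ∷ p) W M q≤M zero with W zero | q≤M zero
... | false | _ = begin
    1 * (q * e₁) + M * 0 * (q * e₀) ≡⟨ f₁ q e₁ e₀ M ⟩
    q * (1 * e₁ + M * 0 * e₀) ≤⟨ *-monoʳ-≤ q (sphere-step p (W ∘ suc) M (q≤M ∘ suc) 0) ⟩
    q * (M * N * e₀) ≡⟨ x∙yz≈y∙xz q (M * N) e₀ ⟩
    M * N * (q * e₀) ∎
  where
  e₀ = sphere p (W ∘ suc) 0
  e₁ = sphere p (W ∘ suc) 1
  N = count (W ∘ suc)
  f₁ : ∀ q e₁ e₀ M → 1 * (q * e₁) + M * 0 * (q * e₀) ≡ q * (1 * e₁ + M * 0 * e₀)
  f₁ = solve-∀
... | true | h = begin
    1 * (e₁ + (q ∸ 1) * e₀) + M * 0 * e₀ ≡⟨ f₁ (q ∸ 1) e₁ e₀ M ⟩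
    1 * e₁ + M * 0 * e₀ + (q ∸ 1) * e₀ ≤⟨ +-mono-≤ (sphere-step p (W ∘ suc) M (q≤M ∘ suc) 0) (*-monoˡ-≤ e₀ (h tt)) ⟩
    M * N * e₀ + M * e₀ ≡⟨ f₂ M N e₀ ⟩
    M * suc N * e₀ ∎
  where
  e₀ = sphere p (W ∘ suc) 0
  e₁ = sphere p (W ∘ suc) 1
  N = count (W ∘ suc)
  f₁ : ∀ q e₁ e₀ M → 1 * (e₁ + q * e₀) + M * 0 * e₀ ≡ 1 * e₁ + M * 0 * e₀ + q * e₀
  f₁ = solve-∀
  f₂ : ∀ M N e → M * N * e + M * e ≡ M * suc N * e
  f₂ = solve-∀
sphere-step (q ∷ p) W M q≤M (suc j) with W zero | q≤M zero
... | false | _ = begin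
    (2 + j) * (q * e₂) + M * suc j * (q * e₁) ≡⟨ f₁ j q e₂ e₁ M ⟩
    q * ((2 + j) * e₂ + M * suc j * e₁) ≤⟨ *-monoʳ-≤ q (sphere-step p (W ∘ suc) M (q≤M ∘ suc) (suc j)) ⟩
    q * (M * N * e₁) ≡⟨ x∙yz≈y∙xz q (M * N) e₁ ⟩
    M * N * (q * e₁) ∎
  where
  e₁ = sphere p (W ∘ suc) (suc j)
  e₂ = sphere p (W ∘ suc) (suc (suc j))
  N = count (W ∘ suc)
  f₁ : ∀ j q e₂ e₁ M → (2 + j) * (q * e₂) + M * suc j * (q * e₁) ≡ q * ((2 + j) * e₂ + M * suc j * e₁)
  f₁ = solve-∀
... | true | h = begin
    (2 + j) * (e₂ + t * e₁) + M * suc j * (e₁ + t * e₀)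
      ≡⟨ f₁ j t e₂ e₁ e₀ M ⟩
    ((2 + j) * e₂ + M * suc j * e₁) + t * (suc j * e₁ + M * j * e₀) + t * e₁ + t * (M * e₀)
      ≤⟨ +-monoˡ-≤ (t * (M * e₀)) (+-mono-≤ (+-mono-≤ (sphere-step p (W ∘ suc) M (q≤M ∘ suc) (suc j))
           (*-monoʳ-≤ t (sphere-step p (W ∘ suc) M (q≤M ∘ suc) j))) (*-monoˡ-≤ e₁ (h tt))) ⟩
    M * N * e₁ + t * (M * N * e₀) + M * e₁ + t * (M * e₀)
      ≡⟨ f₂ t M N e₁ e₀ ⟩
    M * suc N * (e₁ + t * e₀) ∎
  where
  t = q ∸ 1
  e₀ = sphere p (W ∘ suc) j
  e₁ = sphere p (W ∘ suc) (suc j)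
  e₂ = sphere p (W ∘ suc) (suc (suc j))
  N = count (W ∘ suc)
  f₁ : ∀ j t e₂ e₁ e₀ M → (2 + j) * (e₂ + t * e₁) + M * suc j * (e₁ + t * e₀) ≡
    ((2 + j) * e₂ + M * suc j * e₁) + t * (suc j * e₁ + M * j * e₀) + t * e₁ + t * (M * e₀)
  f₁ = solve-∀
  f₂ : ∀ t M N e₁ e₀ → M * N * e₁ + t * (M * N * e₀) + M * e₁ + t * (M * e₀) ≡ M * suc N * (e₁ + t * e₀)
  f₂ = solve-∀

module _ {p : Vec ℕ n} (W : Fin n → Bool) (z : S p) (a : Fin n) (Wa : T (W a)) where

  private
    p_a = lookup p a
    W′ = W without a

  dist-set : ∀ x v → dist W (set x a v) z ≡ ⟦ not (does (v ≟ z at a)) ⟧ + dist W′ x z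
  dist-set x v = begin-equality
    sum (λ i → ⟦ differ W (set x a v) z i ⟧)
      ≡⟨ sum-cong-≗ each ⟩
    sum (λ i → ⟦ does (i ≟ a) ⟧ * ⟦ not (does (v ≟ z at a)) ⟧ + ⟦ differ W′ x z i ⟧)
      ≡⟨ ∑-distrib-+ (λ i → ⟦ does (i ≟ a) ⟧ * ⟦ not (does (v ≟ z at a)) ⟧) (λ i → ⟦ differ W′ x z i ⟧) ⟩
    sum (λ i → ⟦ does (i ≟ a) ⟧ * ⟦ not (does (v ≟ z at a)) ⟧) + dist W′ x z
      ≡⟨ cong (_+ dist W′ x z) (sum-single a (λ _ → ⟦ not (does (v ≟ z at a)) ⟧)) ⟩
    ⟦ not (does (v ≟ z at a)) ⟧ + dist W′ x z ∎
    where
    each : ∀ i → ⟦ differ W (set x a v) z i ⟧ ≡ ⟦ does (i ≟ a) ⟧ * ⟦ not (does (v ≟ z at a)) ⟧ + ⟦ differ W′ x z i ⟧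
    each i with i ≟ a
    ... | yes refl rewrite set-at-same x i v | Equivalence.to T-≡ Wa = sym (trans (+-identityʳ _) (+-identityʳ _))
    ... | no i≢a   rewrite set-at-other x v (i≢a ∘ sym) | ∧-identityʳ (W i) = refl

  slice-ball : ∀ l → p_a * slice (ball W z l) a (z at a) ≡ volume p W′ l
  slice-ball l = trans (sym (card-free (ball W z l) a (z at a)))
    (trans (trans (card≡∑ (free (ball W z l) a (z at a))) (trans (∑-cong p λ x → cong (λ d → ⟦ d ≤ᵇ l ⟧) (at-centre x)) (sym (card≡∑ (ball W′ z l))))) (card-ball W′ z l))
    where
    at-centre : ∀ x → dist W (set x a (z at a)) z ≡ dist W′ x z
    at-centre x = trans (dist-set x (z at a)) (cong (λ b → ⟦ not b ⟧ + dist W′ x z) (Equivalence.to T-≡ (does≟-refl {u = z at a} refl)))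

  slice-ball-off : ∀ l v → v ≢ z at a → p_a * slice (ball W z (suc l)) a v ≡ volume p W′ l
  slice-ball-off l v v≢z = trans (sym (card-free (ball W z (suc l)) a v))
    (trans (trans (card≡∑ (free (ball W z (suc l)) a v)) (trans (∑-cong p λ x → cong ⟦_⟧ (off-centre x)) (sym (card≡∑ (ball W′ z l))))) (card-ball W′ z l))
    where
    suc≤ᵇsuc : ∀ d → (suc d ≤ᵇ suc l) ≡ (d ≤ᵇ l)
    suc≤ᵇsuc zero    = refl
    suc≤ᵇsuc (suc d) = refl
    off-centre : ∀ x → (dist W (set x a v) z ≤ᵇ suc l) ≡ (dist W′ x z ≤ᵇ l)
    off-centre x = trans (cong (_≤ᵇ suc l) (trans (dist-set x v) (cong (λ b → ⟦ b ⟧ + dist W′ x z) (Equivalence.to T-≡ (not-does≟ v≢z))))) (suc≤ᵇsuc (dist W′ x z))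

  offSlice-ball : ∀ l → 1 ≤ p_a → p_a * offSlice (ball W z (suc l)) a (z at a) ≡ (p_a ∸ 1) * volume p W′ l
  offSlice-ball l 1≤p = begin-equality
    p_a * offSlice F a (z at a)
      ≡⟨ cong (p_a *_) (offSlice≡sum F a (z at a)) ⟩
    p_a * sum (λ v → ⟦ not (does (v ≟ z at a)) ⟧ * slice F a v)
      ≡⟨ *-distribˡ-sum p_a (λ v → ⟦ not (does (v ≟ z at a)) ⟧ * slice F a v) ⟩
    sum (λ v → p_a * (⟦ not (does (v ≟ z at a)) ⟧ * slice F a v))
      ≡⟨ sum-cong-≗ each ⟩
    sum (λ v → ⟦ not (does (v ≟ z at a)) ⟧ * volume p W′ l)
      ≡⟨ *-distribʳ-sum (volume p W′ l) (λ v → ⟦ not (does (v ≟ z at a)) ⟧) ⟨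
    count (λ v → not (does (v ≟ z at a))) * volume p W′ l
      ≡⟨ cong (_* volume p W′ l) (sum-not-≟′ 1≤p (z at a)) ⟩
    (p_a ∸ 1) * volume p W′ l ∎
    where
    F = ball W z (suc l)
    each : ∀ v → p_a * (⟦ not (does (v ≟ z at a)) ⟧ * slice F a v) ≡ ⟦ not (does (v ≟ z at a)) ⟧ * volume p W′ l
    each v with v ≟ z at a
    ... | yes _  = *-zeroʳ p_a
    ... | no v≢z = trans (cong (p_a *_) (+-identityʳ (slice F a v))) (trans (slice-ball-off l v v≢z) (sym (+-identityʳ _)))

  -- With the central entry at a the radius l + 1 is left for the remaining coordinates, with any of
  -- the p_a - 1 other entries only l.
  volume-without : ∀ l → 1 ≤ p_a → p_a * volume p W (suc l) ≡ sphere p W′ (suc l) + p_a * volume p W′ l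
  volume-without l 1≤p = begin-equality
    p_a * volume p W (suc l)
      ≡⟨ cong (p_a *_) (trans (slice+offSlice F a (z at a)) (card-ball W z (suc l))) ⟨
    p_a * (slice F a (z at a) + offSlice F a (z at a))
      ≡⟨ trans (*-distribˡ-+ p_a _ _) (cong₂ _+_ (slice-ball (suc l)) (offSlice-ball l 1≤p)) ⟩
    volume p W′ l + sphere p W′ (suc l) + (p_a ∸ 1) * volume p W′ l
      ≡⟨ f (volume p W′ l) (sphere p W′ (suc l)) (p_a ∸ 1) ⟩
    sphere p W′ (suc l) + (1 + (p_a ∸ 1)) * volume p W′ l
      ≡⟨ cong (λ q → sphere p W′ (suc l) + q * volume p W′ l) (m+[n∸m]≡n 1≤p) ⟩
    sphere p W′ (suc l) + p_a * volume p W′ l ∎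
    where
    F = ball W z (suc l)
    f : ∀ v s t → v + s + t * v ≡ s + (1 + t) * v
    f = solve-∀

volume-0 : {p : Vec ℕ n} (W : Fin n → Bool) (z : S p) → volume p W 0 * prodOver W (lookup p) ≤ prod (lookup p)
volume-0 {p = p} W z = subst (_≤ prod (lookup p)) (cong (_* prodOver W (lookup p)) (card-ball W z 0))
  (≤-trans (*-monoˡ-≤ (prodOver W (lookup p)) (≤-trans (≤-reflexive (card≡∑ (ball W z 0))) (∑-mono-≤ p each)))
    (≤-reflexive (∑-eqOn*prodOver W z)))
  where
  each : ∀ x → ⟦ ball W z 0 x ⟧ ≤ eqOn W z x
  each x with eqOn-cases W z x
  ... | inj₁ eq = ≤-trans (⟦⟧≤1 (ball W z 0 x)) (eqOn≥1 W z x eq)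
  ... | inj₂ _ with 1 ≤? dist W x z
  ...   | yes le = ≤-trans (≤-reflexive (zero-out (dist W x z) le)) z≤n
    where
    zero-out : ∀ d → 1 ≤ d → ⟦ d ≤ᵇ 0 ⟧ ≡ 0
    zero-out (suc d) _ = refl
  ...   | no ≰ = ≤-trans (⟦⟧≤1 (ball W z 0 x)) (eqOn≥1 W z x (dist≤0⇒≡ W {x} {z} (≮⇒≥ ≰)))

card-cong : {p : Vec ℕ n} {A A′ : Family p} → A ≗ A′ → card A ≡ card A′
card-cong {p = p} {A} {A′} A≗A′ = trans (card≡∑ A) (trans (∑-cong p λ x → cong ⟦_⟧ (A≗A′ x)) (sym (card≡∑ A′)))

offSlice-cong : {p : Vec ℕ n} {A A′ : Family p} → A ≗ A′ → ∀ i v → offSlice A i v ≡ offSlice A′ i v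
offSlice-cong {p = p} A≗A′ i v = ∑-cong p λ x → cong (λ b → ⟦ not (does (x at i ≟ v)) ⟧ * ⟦ b ⟧) (A≗A′ x)

volume-mono : (p : Vec ℕ n) (W : Fin n → Bool) → ∀ k → volume p W 0 ≤ volume p W k
volume-mono p W zero    = ≤-refl
volume-mono p W (suc k) = ≤-trans (volume-mono p W k) (m≤m+n _ _)

volume-without-0 : {p : Vec ℕ n} (W : Fin n → Bool) (z : S p) (a : Fin n) → T (W a) →
  lookup p a * volume p W 0 ≡ volume p (W without a) 0
volume-without-0 {p = p} W z a Wa = begin-equality
  lookup p a * volume p W 0
    ≡⟨ cong (lookup p a *_) (card-ball W z 0) ⟨
  lookup p a * card F
    ≡⟨ cong (lookup p a *_) (trans (cong (slice F a (z at a) +_) (sym none)) (slice+offSlice F a (z at a))) ⟨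
  lookup p a * (slice F a (z at a) + 0)
    ≡⟨ cong (lookup p a *_) (+-identityʳ (slice F a (z at a))) ⟩
  lookup p a * slice F a (z at a)
    ≡⟨ slice-ball W z a Wa 0 ⟩
  volume p (W without a) 0 ∎
  where
  F = ball W z 0
  none : offSlice F a (z at a) ≡ 0
  none = trans (∑-cong p each) (∑-zero p)
    where
    ≤ᵇ0 : ∀ d → 1 ≤ d → ⟦ d ≤ᵇ 0 ⟧ ≡ 0
    ≤ᵇ0 (suc d) _ = refl
    each : ∀ x → ⟦ not (does (x at a ≟ z at a)) ⟧ * ⟦ F x ⟧ ≡ 0
    each x with x at a ≟ z at a
    ... | yes _ = refl
    ... | no ≢  = trans (+-identityʳ _) (≤ᵇ0 (dist W x z) (count>0 (differ W x z) a (differ⁺ W {x} {z} Wa ≢)))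

-- Radii of maximal pairs when p₁ exceeds r

module Radii {m : ℕ} {p : Vec ℕ (suc m)} {r : ℕ} {A B : Family p}
  (1≤r : 1 ≤ r) (r≤n : r ≤ suc m) (sorted : Linked _≤_ p) (sizeable : Sizeable (head p) r) (r<c : r < head p)
  (st : Structure r A B) (balls : Balls r A B st) where

  open Structure st
  open Balls balls
  open Combined 1≤r r≤n sorted sizeable st

  private
    Q Π : ℕ
    Q = prod (lookup p)
    Π = prodOver W (lookup p)

    1≤W : 1 ≤ count W
    1≤W = subst (1 ≤_) (sym count≡) (≤-trans 1≤r (m≤m+n r (k + l)))

    top = argmaxOn W (lookup p) 1≤W
    a = proj₁ top
    Wa : T (W a)
    Wa = proj₁ (proj₂ top)
    W′ = W without a
    P = lookup p a
    M = P ∸ 1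

    maxP : ∀ i → T (W i) → lookup p i ≤ P
    maxP = proj₂ (proj₂ top)

    1≤P : 1 ≤ P
    1≤P = 1≤p a

    1+M≡P : 1 + M ≡ P
    1+M≡P = m+[n∸m]≡n 1≤P

    c≤P : head p ≤ P
    c≤P = head≤ a

    q≤M : ∀ i → T (W′ i) → lookup p i ∸ 1 ≤ M
    q≤M i W′i = ∸-monoˡ-≤ 1 (maxP i (without-⊆ W a i W′i))

    cardA≡ : card A ≡ volume p W k
    cardA≡ = trans (card-cong A≗) (card-ball W z k)

    cardB≡ : card B ≡ volume p W l
    cardB≡ = trans (card-cong B≗) (card-ball W z l)

    V′ : ℕ → ℕ
    V′ = volume p W′

    1≤V′ : ∀ {j} → 1 ≤ volume p W 0 → 1 ≤ V′ j
    1≤V′ {j} 1≤V = ≤-trans (subst (1 ≤_) (volume-without-0 W z a Wa) (*-mono-≤ 1≤P 1≤V)) (volume-mono p W′ j)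

    1≤V0 : 1 ≤ volume p W 0
    1≤V0 = subst (1 ≤_) (trans (sym (card≡∑ (ball W z 0))) (card-ball W z 0))
      (≤-trans (1≤⟦⟧ (∈ball⁺ {W = W} {z} {z} {0} self)) (member≤∑ p (λ x → ⟦ ball W z 0 x ⟧) z))
      where
      self : dist W z z ≤ 0
      self = ≮⇒≥ λ 1≤d → let i , t = count>0⇒∃ (differ W z z) 1≤d in proj₂ (differ⁻ W {z} {z} i t) refl

    W′≡ : ∀ {s} → k + l ≡ suc s → count W′ ≡ r + s
    W′≡ {s} e = suc-injective (trans (sym (count-without W a Wa)) (trans count≡ (trans (cong (r +_) e) (+-suc r s))))

  -- Removing the largest relevant coordinate and lowering the positive radius by one gives a
  -- competing pair. Its size forces P² V′ ≤ S′ + P V′, where V′ and S′ are the reduced ball of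
  -- radius l′ and the sphere of radius l′ + 1. By `sphere-step` S′ ≤ M r V′, and r ≤ M = P - 1
  -- makes Mr + P less than P².
  not-point-ball : ∀ {l′} → k ≡ 0 → ¬ l ≡ suc l′
  not-point-ball {l′} k≡0 l≡ = <⇒≱ large (*-cancelʳ-≤ _ _ (V′ l′) {{>-nonZero (1≤V′ {l′} 1≤V0)}} (begin
      P * P * V′ l′ ≤⟨ *-cancelˡ-≤ (V′ 0) {{>-nonZero (1≤V′ {0} 1≤V0)}} scaled ⟩
      sphere p W′ (suc l′) + P * V′ l′ ≤⟨ +-monoˡ-≤ (P * V′ l′) sphere≤ ⟩
      M * r * V′ l′ + P * V′ l′ ≡⟨ *-distribʳ-+ (V′ l′) (M * r) P ⟨
      (M * r + P) * V′ l′ ∎))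
    where
    W′-count : count W′ ≡ r + l′
    W′-count = W′≡ (trans (cong (_+ l) k≡0) l≡)
    r≤M : r ≤ M
    r≤M = ∸-monoˡ-≤ 1 (≤-trans r<c c≤P)
    large : M * r + P < P * P
    large = begin-strict
      M * r + P ≤⟨ +-monoˡ-≤ P (*-monoʳ-≤ M r≤M) ⟩
      M * M + P <⟨ m<m+n (M * M + P) (∸-monoˡ-≤ 1 (≤-trans (s≤s (s≤s z≤n)) (3≤p a))) ⟩
      M * M + P + M ≡⟨ cong (λ t → M * M + t + M) 1+M≡P ⟨
      M * M + (1 + M) + M ≡⟨ f M ⟩
      (1 + M) * (1 + M) ≡⟨ cong₂ _*_ 1+M≡P 1+M≡P ⟩
      P * P ∎
      where
      f : ∀ M → M * M + (1 + M) + M ≡ (1 + M) * (1 + M)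
      f = solve-∀
    sphere≤ : sphere p W′ (suc l′) ≤ M * r * V′ l′
    sphere≤ = begin
      sphere p W′ (suc l′) ≤⟨ m≤m+n _ (l′ * sphere p W′ (suc l′)) ⟩
      suc l′ * sphere p W′ (suc l′) ≤⟨ +-cancelʳ-≤ (M * l′ * sphere p W′ l′) _ _ (begin
          suc l′ * sphere p W′ (suc l′) + M * l′ * sphere p W′ l′ ≤⟨ sphere-step p W′ M q≤M l′ ⟩
          M * count W′ * sphere p W′ l′ ≡⟨ cong (λ t → M * t * sphere p W′ l′) W′-count ⟩
          M * (r + l′) * sphere p W′ l′ ≡⟨ f M r l′ (sphere p W′ l′) ⟩
          M * r * sphere p W′ l′ + M * l′ * sphere p W′ l′ ∎) ⟩
      M * r * sphere p W′ l′ ≤⟨ *-monoʳ-≤ (M * r) (sphere≤volume p W′ l′) ⟩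
      M * r * V′ l′ ∎
      where
      f : ∀ M r l s → M * (r + l) * s ≡ M * r * s + M * l * s
      f = solve-∀
    product : V′ 0 * V′ l′ ≤ volume p W 0 * volume p W (suc l′)
    product = subst₂ _≤_ (cong₂ _*_ (card-ball W′ z 0) (card-ball W′ z l′))
      (cong₂ _*_ (trans cardA≡ (cong (volume p W) k≡0)) (trans cardB≡ (cong (volume p W) l≡)))
      (proj₂ maximal (ball W′ z 0) (ball W′ z l′) (ball-cross W′ z (≤-reflexive (sym W′-count))))
    scaled : V′ 0 * (P * P * V′ l′) ≤ V′ 0 * (sphere p W′ (suc l′) + P * V′ l′)
    scaled = begin
      V′ 0 * (P * P * V′ l′) ≡⟨ f (V′ 0) P (V′ l′) ⟩
      P * P * (V′ 0 * V′ l′) ≤⟨ *-monoʳ-≤ (P * P) product ⟩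
      P * P * (volume p W 0 * volume p W (suc l′)) ≡⟨ [m*n]*[o*p]≡[m*o]*[n*p] P P (volume p W 0) (volume p W (suc l′)) ⟩
      P * volume p W 0 * (P * volume p W (suc l′)) ≡⟨ cong₂ _*_ (volume-without-0 W z a Wa) (volume-without W z a Wa l′ 1≤P) ⟩
      V′ 0 * (sphere p W′ (suc l′) + P * V′ l′) ∎
      where
      f : ∀ v P w → v * (P * P * w) ≡ P * P * (v * w)
      f = solve-∀

  -- A ball of radius 2 has too many members off the centre for zₐ to be popular: `rare` at the
  -- largest relevant coordinate gives PM V′ ≤ S′ + P V′ for the reduced ball V′ of radius 1 and
  -- sphere S′ of radius 2. As 2S′ ≤ M(r + 1)V′, this says 2PM ≤ M(r + 1) + 2P.
  not-one-two : k ≡ 1 → ¬ l ≡ 2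
  not-one-two k≡1 l≡2 = <⇒≱ (large 4≤c⊎r≡1) (*-cancelʳ-≤ _ _ (V′ 1) {{>-nonZero (1≤V′ {1} 1≤V0)}} (begin
      2 * (P * M) * V′ 1 ≡⟨ trans (*-assoc 2 (P * M) (V′ 1)) (cong (2 *_) (*-assoc P M (V′ 1))) ⟩
      2 * (P * (M * V′ 1)) ≤⟨ *-monoʳ-≤ 2 rare ⟩
      2 * (sphere p W′ 2 + P * V′ 1) ≡⟨ *-distribˡ-+ 2 (sphere p W′ 2) (P * V′ 1) ⟩
      2 * sphere p W′ 2 + 2 * (P * V′ 1) ≤⟨ +-monoˡ-≤ (2 * (P * V′ 1)) sphere≤ ⟩
      M * (r + 1) * V′ 1 + 2 * (P * V′ 1) ≡⟨ f (M * (r + 1)) P (V′ 1) ⟩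
      (M * (r + 1) + 2 * P) * V′ 1 ∎))
    where
    open Sizeable sizeable
    f : ∀ u P v → u * v + 2 * (P * v) ≡ (u + 2 * P) * v
    f = solve-∀
    W′-count : count W′ ≡ r + 2
    W′-count = W′≡ (cong₂ _+_ k≡1 l≡2)
    sphere≤ : 2 * sphere p W′ 2 ≤ M * (r + 1) * V′ 1
    sphere≤ = ≤-trans (+-cancelʳ-≤ (M * 1 * sphere p W′ 1) _ _ (begin
        2 * sphere p W′ 2 + M * 1 * sphere p W′ 1 ≤⟨ sphere-step p W′ M q≤M 1 ⟩
        M * count W′ * sphere p W′ 1 ≡⟨ cong (λ t → M * t * sphere p W′ 1) W′-count ⟩
        M * (r + 2) * sphere p W′ 1 ≡⟨ g M r (sphere p W′ 1) ⟩
        M * (r + 1) * sphere p W′ 1 + M * 1 * sphere p W′ 1 ∎))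
      (*-monoʳ-≤ (M * (r + 1)) (sphere≤volume p W′ 1))
      where
      g : ∀ M r s → M * (r + 2) * s ≡ M * (r + 1) * s + M * 1 * s
      g = solve-∀
    B≗2 : B ≗ ball W z 2
    B≗2 = subst (λ j → B ≗ ball W z j) l≡2 B≗
    rare : P * (M * V′ 1) ≤ sphere p W′ 2 + P * V′ 1
    rare = begin
      P * (M * V′ 1) ≡⟨ cong (P *_) (offSlice-ball W z a Wa 1 1≤P) ⟨
      P * (P * offSlice (ball W z 2) a (z at a)) ≡⟨ cong (λ t → P * (P * t)) (offSlice-cong B≗2 a (z at a)) ⟨
      P * (P * offSlice B a (z at a)) ≤⟨ *-monoʳ-≤ P (Popular.rare (proj₂ (popularity a Wa))) ⟩
      P * card B ≡⟨ cong (P *_) (trans cardB≡ (cong (volume p W) l≡2)) ⟩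
      P * volume p W 2 ≡⟨ volume-without W z a Wa 1 1≤P ⟩
      sphere p W′ 2 + P * V′ 1 ∎
    large : 4 ≤ head p ⊎ r ≡ 1 → M * (r + 1) + 2 * P < 2 * (P * M)
    large (inj₁ 4≤c) = begin-strict
      M * (r + 1) + 2 * P ≤⟨ +-monoˡ-≤ (2 * P) (*-monoʳ-≤ M (≤-trans (≤-reflexive (+-comm r 1)) (≤-trans r<c c≤P))) ⟩
      M * P + 2 * P ≡⟨ g₁ M P ⟩
      (M + 2) * P <⟨ *-monoˡ-< P {{>-nonZero 1≤P}} (+-monoʳ-< M (∸-monoˡ-≤ 1 (≤-trans 4≤c c≤P))) ⟩
      (M + M) * P ≡⟨ g₂ M P ⟩
      2 * (P * M) ∎
      where
      g₁ : ∀ M P → M * P + 2 * P ≡ (M + 2) * P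
      g₁ = solve-∀
      g₂ : ∀ M P → (M + M) * P ≡ 2 * (P * M)
      g₂ = solve-∀
    large (inj₂ r≡1) = begin-strict
      M * (r + 1) + 2 * P ≡⟨ cong₂ (λ u v → M * (u + 1) + 2 * v) r≡1 (sym 1+M≡P) ⟩
      M * 2 + 2 * (1 + M) <⟨ m<m+n _ {2} (s≤s z≤n) ⟩
      M * 2 + 2 * (1 + M) + 2 ≡⟨ g₁ M ⟩
      M * 2 + 2 * M + 2 * 2 ≤⟨ +-monoʳ-≤ (M * 2 + 2 * M) (*-monoʳ-≤ 2 2≤M) ⟩
      M * 2 + 2 * M + 2 * M ≡⟨ g₂ M ⟩
      2 * (2 * M) + 2 * M ≤⟨ +-monoˡ-≤ (2 * M) (*-monoʳ-≤ 2 (*-monoˡ-≤ M 2≤M)) ⟩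
      2 * (M * M) + 2 * M ≡⟨ g₃ M ⟩
      2 * ((1 + M) * M) ≡⟨ cong (λ t → 2 * (t * M)) 1+M≡P ⟩
      2 * (P * M) ∎
      where
      2≤M : 2 ≤ M
      2≤M = ∸-monoˡ-≤ 1 (3≤p a)
      g₁ : ∀ M → M * 2 + 2 * (1 + M) + 2 ≡ M * 2 + 2 * M + 2 * 2
      g₁ = solve-∀
      g₂ : ∀ M → M * 2 + 2 * M + 2 * M ≡ 2 * (2 * M) + 2 * M
      g₂ = solve-∀
      g₃ : ∀ M → 2 * (M * M) + 2 * M ≡ 2 * ((1 + M) * M)
      g₃ = solve-∀

  point-volume : count W ≡ r → volume p W 0 ≤ E
  point-volume W≡r = *-cancelˡ-≤ D (begin
    D * volume p W 0 ≤⟨ *-monoˡ-≤ (volume p W 0) (≤-trans (≤-reflexive (sym (*-identityʳ D))) (D*c^≤Π {0} W (trans W≡r (sym (+-identityʳ r))))) ⟩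
    Π * volume p W 0 ≡⟨ *-comm Π (volume p W 0) ⟩
    volume p W 0 * Π ≤⟨ volume-0 W z ⟩
    Q ≡⟨ D*E≡Q ⟨
    D * E ∎)

  module _ (W≡ : count W ≡ r + 2) where

    private
      W′-count : count W′ ≡ r + 1
      W′-count = suc-injective (trans (sym (count-without W a Wa)) (trans W≡ (+-suc r 1)))

      second = argmaxOn W′ (lookup p) (subst (1 ≤_) (sym W′-count) (≤-trans 1≤r (m≤m+n r 1)))
      b = proj₁ second
      P₂ = lookup p b
      W″ = W′ without b

      W″-count : count W″ ≡ r + 0
      W″-count = suc-injective (trans (sym (count-without W′ b (proj₁ (proj₂ second)))) (trans W′-count (+-suc r 0)))

      -- The two largest relevant sizes P ≥ P₂ are taken out, so that the r remaining ones can be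
      -- compared with D. In the limiting case P = r + 1 the factor on the right is exactly P P₂.
      bound : P * P₂ * (D * volume p W 1) ≤ (P + (P₂ ∸ 1) * (r + 1)) * Q
      bound = begin
        P * P₂ * (D * volume p W 1) ≡⟨ f P P₂ D (volume p W 1) ⟩
        P * volume p W 1 * (P₂ * D) ≡⟨ cong (_* (P₂ * D)) (volume-without W z a Wa 0 1≤P) ⟩
        (sphere p W′ 1 + P * V′ 0) * (P₂ * D) ≤⟨ *-mono-≤ (+-monoˡ-≤ (P * V′ 0) sphere≤) Π′≥ ⟩
        ((P₂ ∸ 1) * (r + 1) * V′ 0 + P * V′ 0) * prodOver W′ (lookup p)
                                                   ≡⟨ g ((P₂ ∸ 1) * (r + 1)) (V′ 0) P (prodOver W′ (lookup p)) ⟩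
        (P + (P₂ ∸ 1) * (r + 1)) * (V′ 0 * prodOver W′ (lookup p))
                                                   ≤⟨ *-monoʳ-≤ (P + (P₂ ∸ 1) * (r + 1)) (volume-0 W′ z) ⟩
        (P + (P₂ ∸ 1) * (r + 1)) * Q ∎
        where
        f : ∀ P Q D v → P * Q * (D * v) ≡ P * v * (Q * D)
        f = solve-∀
        g : ∀ u v P π → (u * v + P * v) * π ≡ (P + u) * (v * π)
        g = solve-∀
        sphere≤ : sphere p W′ 1 ≤ (P₂ ∸ 1) * (r + 1) * V′ 0
        sphere≤ = begin
          sphere p W′ 1 ≤⟨ ≤-trans (m≤m+n _ 0) (m≤m+n (1 * sphere p W′ 1) ((P₂ ∸ 1) * 0 * V′ 0)) ⟩
          1 * sphere p W′ 1 + (P₂ ∸ 1) * 0 * V′ 0 ≤⟨ sphere-step p W′ (P₂ ∸ 1) (λ i t → ∸-monoˡ-≤ 1 (proj₂ (proj₂ second) i t)) 0 ⟩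
          (P₂ ∸ 1) * count W′ * V′ 0 ≡⟨ cong (λ t → (P₂ ∸ 1) * t * V′ 0) W′-count ⟩
          (P₂ ∸ 1) * (r + 1) * V′ 0 ∎
        Π′≥ : P₂ * D ≤ prodOver W′ (lookup p)
        Π′≥ = begin
          P₂ * D ≡⟨ cong (P₂ *_) (*-identityʳ D) ⟨
          P₂ * (D * 1) ≤⟨ *-monoʳ-≤ P₂ (D*c^≤Π {0} W″ W″-count) ⟩
          P₂ * prodOver W″ (lookup p) ≡⟨ prodOver-without W′ (lookup p) b (proj₁ (proj₂ second)) ⟨
          prodOver W′ (lookup p) ∎

      split : ∀ P → P + (P₂ ∸ 1) * P ≡ P * P₂
      split P = trans (cong (_* P) (m+[n∸m]≡n (1≤p b))) (*-comm P₂ P)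

      PP₂≢0 : NonZero (P * P₂)
      PP₂≢0 = m*n≢0 P P₂ {{>-nonZero 1≤P}} {{>-nonZero (1≤p b)}}

    unit-volume : volume p W 1 ≤ E
    unit-volume = *-cancelˡ-≤ D (*-cancelˡ-≤ (P * P₂) {{PP₂≢0}} (≤-trans bound (begin
      (P + (P₂ ∸ 1) * (r + 1)) * Q ≤⟨ *-monoˡ-≤ Q (+-monoʳ-≤ P (*-monoʳ-≤ (P₂ ∸ 1) (≤-trans (≤-reflexive (+-comm r 1)) (≤-trans r<c c≤P)))) ⟩
      (P + (P₂ ∸ 1) * P) * Q ≡⟨ cong₂ _*_ (split P) (sym D*E≡Q) ⟩
      P * P₂ * (D * E) ∎)))

    unit-volume-< : r + 1 < P → volume p W 1 < E
    unit-volume-< r+1<P = *-cancelˡ-< D _ _ (*-cancelˡ-< (P * P₂) _ _ (≤-<-trans bound (begin-strict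
      (P + (P₂ ∸ 1) * (r + 1)) * Q <⟨ *-monoˡ-< Q {{>-nonZero (prod-pos 1≤p)}} (+-monoʳ-< P (*-monoʳ-< (P₂ ∸ 1) {{>-nonZero (∸-monoˡ-≤ 1 (≤-trans (s≤s (s≤s z≤n)) (3≤p b)))}} r+1<P)) ⟩
      (P + (P₂ ∸ 1) * P) * Q ≡⟨ cong₂ _*_ (split P) (sym D*E≡Q) ⟩
      P * P₂ * (D * E) ∎)))

    -- Equality excludes r + 1 < P, so no relevant size exceeds r + 1, and r < p₁ excludes smaller
    -- ones.
    unit-sizes : volume p W 1 ≡ E → ∀ i → T (W i) → lookup p i ≡ r + 1
    unit-sizes V≡E i Wi = ≤-antisym
      (≤-trans (maxP i Wi) (≮⇒≥ λ lt → <⇒≢ (unit-volume-< lt) V≡E))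
      (≤-trans (≤-reflexive (+-comm r 1)) (≤-trans r<c (head≤ i)))

data Outcome {p : Vec ℕ n} (r : ℕ) (A B : Family p) (st : Structure r A B) : Set where
  fixing : let open Structure st in
    count W ≡ r → A ≗ ball W z 0 → B ≗ ball W z 0 → volume p W 0 ≤ productAfter r p → Outcome r A B st
  unit   : let open Structure st in
    count W ≡ r + 2 → A ≗ ball W z 1 → B ≗ ball W z 1 → volume p W 1 ≤ productAfter r p →
    (volume p W 1 ≡ productAfter r p → ∀ i → T (W i) → lookup p i ≡ r + 1) → Outcome r A B st

outcome : ∀ {m} {p : Vec ℕ (suc m)} {r} {A B : Family p} → 1 ≤ r → r ≤ suc m → Linked _≤_ p →
  Sizeable (head p) r → r < head p → (st : Structure r A B) → Balls r A B st → Outcome r A B st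
outcome {p = p} {r} {A} {B} 1≤r r≤n sorted sizeable r<c st bs = go k l refl refl
  where
  open Structure st
  open Balls bs
  open Radii 1≤r r≤n sorted sizeable r<c st bs
  module Swapped = Radii {A = B} {A} 1≤r r≤n sorted sizeable r<c (Structure-sym st) (Balls-sym bs)
  too-many : ∀ {a b} → k ≡ a → l ≡ b → ¬ a + b ≤ 3 → Outcome r A B st
  too-many k≡ l≡ ≰ = contradiction (subst₂ (λ a b → a + b ≤ 3) k≡ l≡ k+l≤3) ≰
  go : ∀ a b → k ≡ a → l ≡ b → Outcome r A B st
  go zero zero k≡ l≡ = fixing W≡ (subst (λ j → A ≗ ball W z j) k≡ A≗) (subst (λ j → B ≗ ball W z j) l≡ B≗) (point-volume W≡)
    where
    W≡ : count W ≡ r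
    W≡ = trans count≡ (trans (cong₂ (λ a b → r + (a + b)) k≡ l≡) (+-identityʳ r))
  go zero    (suc b) k≡ l≡ = contradiction l≡ (not-point-ball k≡)
  go (suc a) zero    k≡ l≡ = contradiction k≡ (Swapped.not-point-ball l≡)
  go 1       1       k≡ l≡ = unit W≡ (subst (λ j → A ≗ ball W z j) k≡ A≗) (subst (λ j → B ≗ ball W z j) l≡ B≗) (unit-volume W≡) (unit-sizes W≡)
    where
    W≡ : count W ≡ r + 2
    W≡ = trans count≡ (cong₂ (λ a b → r + (a + b)) k≡ l≡)
  go 1       2       k≡ l≡ = contradiction l≡ (not-one-two k≡)
  go 2       1       k≡ l≡ = contradiction k≡ (Swapped.not-one-two l≡)
  go 1       (suc (suc (suc b))) k≡ l≡ = too-many k≡ l≡ λ { (s≤s (s≤s (s≤s ()))) }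
  go 2       (suc (suc b))       k≡ l≡ = too-many k≡ l≡ λ { (s≤s (s≤s (s≤s ()))) }
  go (suc (suc (suc a))) (suc b) k≡ l≡ = too-many k≡ l≡ λ { (s≤s (s≤s (s≤s le))) → contradiction (subst (_≤ 0) (+-suc a b) le) λ () }

-- Maximal pairs and the size threshold

card≤prod : {p : Vec ℕ n} (A : Family p) → card A ≤ prod (lookup p)
card≤prod {p = p} A = subst₂ _≤_ (sym (card≡∑ A)) (∑-1 p) (∑-mono-≤ p λ x → ⟦⟧≤1 (A x))

MaximalAbove : {p : Vec ℕ n} (r N : ℕ) → Set
MaximalAbove {p = p} r N = Σ (Family p) λ A → Σ (Family p) λ B → Maximal r A B × N ≤ card A * card B

-- Recursion on the gap d to the trivial bound Q², which every strictly better pair narrows. Whether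
-- a better pair exists is never decided, hence the double negation.
maximal-above : {p : Vec ℕ n} {r : ℕ} → ∀ d (A B : Family p) → CrossIntersecting r A B →
  prod (lookup p) * prod (lookup p) ≤ card A * card B + d → ¬ ¬ MaximalAbove {p = p} r (card A * card B)
maximal-above {p = p} {r} d A B c le none = none (A , B , (c , maximal) , ≤-refl)
  where
  maximal : ∀ A′ B′ → CrossIntersecting r A′ B′ → card A′ * card B′ ≤ card A * card B
  maximal A′ B′ c′ = ≮⇒≥ (improve d le)
    where
    improve : ∀ d → prod (lookup p) * prod (lookup p) ≤ card A * card B + d → ¬ card A * card B < card A′ * card B′
    improve zero    le lt = <⇒≱ lt (≤-trans (*-mono-≤ (card≤prod A′) (card≤prod B′)) (≤-trans le (≤-reflexive (+-identityʳ _))))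
    improve (suc d) le lt = maximal-above d A′ B′ c′
      (≤-trans le (≤-trans (≤-reflexive (+-suc (card A * card B) d)) (+-monoˡ-≤ d lt)))
      λ (A″ , B″ , max , above) → none (A″ , B″ , max , ≤-trans (<⇒≤ lt) above)

Maximal⇒MaximalPair : {p : Vec ℕ n} {r : ℕ} {A B : Family p} → (∀ i → 1 ≤ lookup p i) → r ≤ n → Maximal r A B → MaximalPair r A B
Maximal⇒MaximalPair {p = p} {r} {A} {B} 1≤p r≤n max = record
  { maximal = max
  ; card>0ˡ = n≢0⇒n>0 λ A≡0 → contradiction (subst (λ a → 1 ≤ a * card B) A≡0 1≤AB) λ ()
  ; card>0ʳ = n≢0⇒n>0 λ B≡0 → contradiction (subst (1 ≤_) (trans (cong (card A *_) B≡0) (*-zeroʳ (card A))) 1≤AB) λ () }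
  where
  1≤DE : 1 ≤ productOfFirst r p * productAfter r p
  1≤DE = subst (1 ≤_) (sym (productOfFirst*productAfter r p)) (prod-pos 1≤p)
  1≤E : 1 ≤ productAfter r p
  1≤E = n≢0⇒n>0 λ E≡0 → contradiction (subst (1 ≤_) (trans (cong (productOfFirst r p *_) E≡0) (*-zeroʳ (productOfFirst r p))) 1≤DE) λ ()
  1≤AB : 1 ≤ card A * card B
  1≤AB = ≤-trans (*-mono-≤ 1≤E 1≤E) (Maximal⇒productAfter²≤ {A = A} {B} 1≤p r≤n max)

lookup-tabulate-T : (W : Fin n → Bool) → ∀ i → i ∈ Vec.tabulate W → T (W i)
lookup-tabulate-T W i i∈ = subst T (trans (sym (Vec.[]=⇒lookup i∈)) (Vec.lookup∘tabulate W i)) tt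

∈-tabulate : (W : Fin n → Bool) → ∀ i → T (W i) → i ∈ Vec.tabulate W
∈-tabulate W i t = Vec.lookup⇒[]= i (Vec.tabulate W) (trans (Vec.lookup∘tabulate W i) (Equivalence.to T-≡ t))

∣tabulate∣ : (W : Fin n → Bool) → ∣ Vec.tabulate W ∣ ≡ count W
∣tabulate∣ W = trans (∣∣≡sum (Vec.tabulate W)) (sum-cong-≗ λ i → cong ⟦_⟧ (Vec.lookup∘tabulate W i))

∣∩∁agreement∣ : {p : Vec ℕ n} (W : Fin n → Bool) (x z : S p) → ∣ Vec.tabulate W ∩ ∁ (agreement x z) ∣ ≡ dist W x z
∣∩∁agreement∣ W x z = trans (∣∣≡sum (Vec.tabulate W ∩ ∁ (agreement x z))) (sum-cong-≗ λ i → cong ⟦_⟧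
  (trans (Vec.lookup-zipWith _∧_ i (Vec.tabulate W) (∁ (agreement x z)))
    (cong₂ _∧_ (Vec.lookup∘tabulate W i) (trans (Vec.lookup-map i not (agreement x z))
      (cong not (Vec.lookup∘tabulate (λ j → does (x at j ≟ z at j)) i))))))

≗ball⇒IsHammingBallOfRadius : {p : Vec ℕ n} {A : Family p} (W : Fin n → Bool) (z : S p) → ∀ {k} → k ≤ count W →
  A ≗ ball W z k → IsHammingBallOfRadius k (Vec.tabulate W) A
≗ball⇒IsHammingBallOfRadius {A = A} W z {k} k≤ A≗ = z , subst (k ≤_) (sym (∣tabulate∣ W)) k≤ , λ x → mk⇔
  (λ x∈A → subst (_≤ k) (sym (∣∩∁agreement∣ W x z)) (∈ball⁻ {W = W} {z} {x} (subst T (A≗ x) x∈A)))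
  (λ le → subst T (sym (A≗ x)) (∈ball⁺ {W = W} {z} {x} (subst (_≤ k) (∣∩∁agreement∣ W x z) le)))

≗ball⇒ObtainedByFixing : {p : Vec ℕ n} {A : Family p} {r : ℕ} (W : Fin n → Bool) (z : S p) → count W ≡ r →
  A ≗ ball W z 0 → ObtainedByFixing r A
≗ball⇒ObtainedByFixing {A = A} W z W≡r A≗ = Vec.tabulate W , trans (∣tabulate∣ W) W≡r , z , λ x → mk⇔
  (λ x∈A i i∈ → dist≤0⇒≡ W {x} {z} (∈ball⁻ {W = W} {z} {x} (subst T (A≗ x) x∈A)) i (lookup-tabulate-T W i i∈))
  (λ same → subst T (sym (A≗ x)) (∈ball⁺ {W = W} {z} {x} {0} (≮⇒≥ λ 1≤d →
    let i , t = count>0⇒∃ (differ W x z) 1≤d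
        Wi , ≢ = differ⁻ W {x} {z} i t in ≢ (same i (∈-tabulate W i Wi)))))

UnitBall : {p : Vec ℕ n} → ℕ → Family p → Set
UnitBall {n} {p} r A = Σ (Subset n) λ R → ∣ R ∣ ≡ r + 2 × (∀ i → i ∈ R → lookup p i ≡ r + 1) × IsHammingBallOfRadius 1 R A

module Classified {m : ℕ} {p : Vec ℕ (suc m)} {r : ℕ} (1≤r : 1 ≤ r) (r≤n : r ≤ suc m) (sorted : Linked _≤_ p)
  (sizeable : Sizeable (head p) r) (steep : ∀ i → Steep r (lookup p i)) where

  3≤p : ∀ i → 3 ≤ lookup p i
  3≤p i = ≤-trans (Sizeable.3≤c sizeable) (head≤lookup p sorted i)

  1≤p : ∀ i → 1 ≤ lookup p i
  1≤p i = ≤-trans (s≤s z≤n) (3≤p i)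

  E² : ℕ
  E² = productAfter r p * productAfter r p

  structured : {A B : Family p} → Maximal r A B → Structure r A B
  structured max = structure 3≤p (Maximal⇒MaximalPair 1≤p r≤n max)

  classified : {A B : Family p} (max : Maximal r A B) → Balls r A B (structured max)
  classified {A} {B} max = Identified.balls 1≤r r≤n sorted sizeable st
    (Bounded.few-relevant 3≤p steep 1≤r r≤n sorted st)
    where
    st : Structure r A B
    st = structured max

  hamming-balls : {A B : Family p} → Maximal r A B →
    Σ (Subset (suc m)) λ R → ∣ R ∣ ≤ r + 3 × IsHammingBall R A × IsHammingBall R B
  hamming-balls {A} {B} max =
      Vec.tabulate W , subst (_≤ r + 3) (sym (trans (∣tabulate∣ W) count≡)) (+-monoʳ-≤ r k+l≤3)
    , (k , ≗ball⇒IsHammingBallOfRadius W z k≤W A≗)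
    , (l , ≗ball⇒IsHammingBallOfRadius W z l≤W B≗)
    where
    st : Structure r A B
    st = structured max
    open Structure st
    open Balls (classified max)
    k+l≤W : k + l ≤ count W
    k+l≤W = subst (k + l ≤_) (sym count≡) (m≤n+m (k + l) r)
    k≤W : k ≤ count W
    k≤W = ≤-trans (m≤m+n k l) k+l≤W
    l≤W : l ≤ count W
    l≤W = ≤-trans (m≤n+m l k) k+l≤W

  module _ (r<c : r < head p) where

    outcomes : {A B : Family p} (max : Maximal r A B) → Outcome r A B (structured max)
    outcomes {A} {B} max = outcome 1≤r r≤n sorted sizeable r<c (structured max) (classified max)

    maximal-bound : {A B : Family p} → Maximal r A B → card A * card B ≤ E²
    maximal-bound {A} {B} max = bound (outcomes max)
      where
      st : Structure r A B
      st = structured max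
      open Structure st using (W; z)
      card≤ : ∀ {F : Family p} {k} → F ≗ ball W z k → volume p W k ≤ productAfter r p → card F ≤ productAfter r p
      card≤ {F} {k} F≗ V≤ = subst (_≤ productAfter r p) (sym (trans (card-cong F≗) (card-ball W z k))) V≤
      bound : Outcome r A B st → card A * card B ≤ E²
      bound (fixing _ A≗ B≗ V≤) = *-mono-≤ (card≤ {A} {0} A≗ V≤) (card≤ {B} {0} B≗ V≤)
      bound (unit _ A≗ B≗ V≤ _) = *-mono-≤ (card≤ {A} {1} A≗ V≤) (card≤ {B} {1} B≗ V≤)

    -- An inequality in ℕ can be proved by contradiction, so a maximal pair under a double negation
    -- is enough.
    cross-bound : (A B : Family p) → CrossIntersecting r A B → card A * card B ≤ E²
    cross-bound A B c = ≮⇒≥ λ lt → maximal-above {p = p} {r} (prod (lookup p) * prod (lookup p)) A B c (m≤n+m _ (card A * card B))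
      λ (A′ , B′ , max , above) → <⇒≱ (≤-trans lt above) (maximal-bound {A′} {B′} max)

    -- By `cross-bound` a pair that attains the bound is maximal, so the classification applies to
    -- the pair itself.
    equality : (A B : Family p) → CrossIntersecting r A B → card A * card B ≡ E² →
      A ≗ B × (ObtainedByFixing r A ⊎ UnitBall r A)
    equality A B c eq = from (outcomes max)
      where
      max : Maximal r A B
      max = c , λ A′ B′ c′ → ≤-trans (cross-bound A′ B′ c′) (≤-reflexive (sym eq))
      st : Structure r A B
      st = structured max
      open Structure st using (W; z)
      from : Outcome r A B st → A ≗ B × (ObtainedByFixing r A ⊎ UnitBall r A)
      from (fixing W≡ A≗ B≗ _) = (λ x → trans (A≗ x) (sym (B≗ x))) , inj₁ (≗ball⇒ObtainedByFixing W z W≡ A≗)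
      from (unit W≡ A≗ B≗ V≤ sizes) = (λ x → trans (A≗ x) (sym (B≗ x))) , inj₂
        ( Vec.tabulate W , trans (∣tabulate∣ W) W≡
        , (λ i i∈ → sizes V≡E i (lookup-tabulate-T W i i∈))
        , ≗ball⇒IsHammingBallOfRadius W z (subst (1 ≤_) (sym W≡) (≤-trans 1≤r (m≤m+n r 2))) A≗ )
        where
        V≡E : volume p W 1 ≡ productAfter r p
        V≡E = ≤-antisym V≤ (square-cancel-≤ (≤-reflexive (trans (sym eq)
          (cong₂ _*_ (trans (card-cong A≗) (card-ball W z 1)) (trans (card-cong B≗) (card-ball W z 1))))))

    no-unit-ball : {A : Family p} → r + 1 < head p → ¬ UnitBall r A
    no-unit-ball lt (R , R≡ , sizes , _) with i , t ← count>0⇒∃ (lookup R) (subst (1 ≤_) (trans (sym R≡) (∣∣≡sum R)) (≤-trans 1≤r (m≤m+n r 2))) =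
      <⇒≱ lt (subst (head p ≤_) (sizes i (Vec.lookup⇒[]= i R (Equivalence.to T-≡ t))) (head≤lookup p sorted i))

2^⌊log₂n⌋≤n : ∀ n → 1 ≤ n → 2 ^ ⌊log₂ n ⌋ ≤ n
2^⌊log₂n⌋≤n = <-rec (λ n → 1 ≤ n → 2 ^ ⌊log₂ n ⌋ ≤ n) step
  where
  double-half≤ : ∀ n → 2 * ⌊ n /2⌋ ≤ n
  double-half≤ n = ≤-trans (+-monoʳ-≤ ⌊ n /2⌋ (≤-trans (≤-reflexive (+-identityʳ ⌊ n /2⌋)) (⌊n/2⌋≤⌈n/2⌉ n))) (≤-reflexive (⌊n/2⌋+⌈n/2⌉≡n n))
  step : ∀ n → (∀ {k} → k < n → 1 ≤ k → 2 ^ ⌊log₂ k ⌋ ≤ k) → 1 ≤ n → 2 ^ ⌊log₂ n ⌋ ≤ n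
  step 1                 rec 1≤n = ≤-refl
  step n@(suc (suc h)) rec 1≤n = begin
    2 ^ ⌊log₂ n ⌋ ≤⟨ ^-monoʳ-≤ 2 (m≤n+m∸n ⌊log₂ n ⌋ 1) ⟩
    2 * 2 ^ (⌊log₂ n ⌋ ∸ 1) ≡⟨ cong (λ t → 2 * 2 ^ t) (⌊log₂⌊n/2⌋⌋≡⌊log₂n⌋∸1 n) ⟨
    2 * 2 ^ ⌊log₂ ⌊ n /2⌋ ⌋ ≤⟨ *-monoʳ-≤ 2 (rec (⌊n/2⌋<n (suc h)) (s≤s z≤n)) ⟩
    2 * ⌊ n /2⌋ ≤⟨ double-half≤ n ⟩
    n ∎

n≤2^n : ∀ n → n ≤ 2 ^ n
n≤2^n zero    = z≤n
n≤2^n (suc n) = ≤-trans (+-mono-≤ (^-pos n (s≤s z≤n)) (n≤2^n n)) (≤-reflexive (cong (2 ^ n +_) (sym (+-identityʳ (2 ^ n)))))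

-- The successor keeps this denominator positive, and 2^(levels r) is still at most 2r for r ≥ 1, as
-- `steep-log` requires.
levels : ℕ → ℕ
levels r = suc ⌊log₂ r ⌋

-- This is 4 + 4r/j with j = levels r. Multiplied by 2j, the condition p₁ ≥ r/2 + 4 + 4r/j becomes
-- the hypothesis of `steep-log`.
excess : ℕ → ℚ
excess r = (ℤ.+ (4 * levels r + 4 * r)) ℚ./ levels r

sizeThreshold : ℕ → ℚ
sizeThreshold r = ½ ℚ.* fromℕ r ℚ.+ excess r

toℚᵘ-/ : ∀ n d → ℚ.toℚᵘ ((ℤ.+ n) ℚ./ suc d) ℚᵘ.≃ ℚᵘ.mkℚᵘ (ℤ.+ n) d
toℚᵘ-/ n d = ℚ.toℚᵘ-fromℚᵘ (ℚᵘ.mkℚᵘ (ℤ.+ n) d)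

sizeThreshold≤⇒ : ∀ {r c} → sizeThreshold r ℚ.≤ fromℕ c → 8 * r + levels r * (r + 8) ≤ levels r * (2 * c)
sizeThreshold≤⇒ {r} {c} le = subst₂ _≤_ (e₁ r j) (e₂ c j) (ℤ.drop‿+≤+ (subst₂ ℤ._≤_ lhs rhs (ℚᵘ.drop-*≤* leᵘ)))
  where
  j = levels r
  e₁ : ∀ r j → (1 * r * j + (4 * j + 4 * r) * 2) * 1 ≡ 8 * r + j * (r + 8)
  e₁ = solve-∀
  e₂ : ∀ c j → c * (2 * j) ≡ j * (2 * c)
  e₂ = solve-∀
  leftᵘ : ℚᵘ.ℚᵘ
  leftᵘ = ℚᵘ.½ ℚᵘ.* ℚᵘ.mkℚᵘ (ℤ.+ r) 0 ℚᵘ.+ ℚᵘ.mkℚᵘ (ℤ.+ (4 * j + 4 * r)) ⌊log₂ r ⌋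
  left≃ : ℚ.toℚᵘ (sizeThreshold r) ℚᵘ.≃ leftᵘ
  left≃ = ℚᵘ.≃-trans (ℚ.toℚᵘ-homo-+ (½ ℚ.* fromℕ r) (excess r))
    (ℚᵘ.+-cong (ℚᵘ.≃-trans (ℚ.toℚᵘ-homo-* ½ (fromℕ r)) (ℚᵘ.*-congˡ {ℚᵘ.½} (toℚᵘ-/ r 0))) (toℚᵘ-/ (4 * j + 4 * r) ⌊log₂ r ⌋))
  leᵘ : leftᵘ ℚᵘ.≤ ℚᵘ.mkℚᵘ (ℤ.+ c) 0
  leᵘ = ℚᵘ.≤-respˡ-≃ left≃ (ℚᵘ.≤-respʳ-≃ (toℚᵘ-/ c 0) (ℚ.toℚᵘ-mono-≤ le))
  lhs : ((ℤ.+ 1 ℤ.* ℤ.+ r) ℤ.* ℤ.+ j ℤ.+ ℤ.+ (4 * j + 4 * r) ℤ.* ℤ.+ 2) ℤ.* ℤ.+ 1 ≡ ℤ.+ ((1 * r * j + (4 * j + 4 * r) * 2) * 1)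
  lhs = trans (cong (ℤ._* (ℤ.+ 1)) (cong₂ ℤ._+_ (trans (cong (ℤ._* (ℤ.+ j)) (sym (ℤ.pos-* 1 r))) (sym (ℤ.pos-* (1 * r) j))) (sym (ℤ.pos-* (4 * j + 4 * r) 2))))
    (sym (ℤ.pos-* (1 * r * j + (4 * j + 4 * r) * 2) 1))
  rhs : ℤ.+ c ℤ.* ℤ.+ (2 * j) ≡ ℤ.+ (c * (2 * j))
  rhs = sym (ℤ.pos-* c (2 * j))

excess-LittleO : ∀ ε → 0ℚ ℚ.< ε → ∃ λ N → ∀ r → N ≤ r → excess r ℚ.≤ ε ℚ.* fromℕ r
excess-LittleO (ℚ.mkℚ (ℤ.+ zero) b _)   (ℚ.*<* (ℤ.+<+ ()))
excess-LittleO (ℚ.mkℚ (-[1+ a ]) b _) (ℚ.*<* ())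
excess-LittleO ε@(ℚ.mkℚ (ℤ.+ suc a) b _) _ = 2 ^ x , λ r N≤r → ℚ.toℚᵘ-cancel-≤
  (ℚᵘ.≤-respˡ-≃ (ℚᵘ.≃-sym (toℚᵘ-/ (4 * levels r + 4 * r) ⌊log₂ r ⌋))
    (ℚᵘ.≤-respʳ-≃ (ℚᵘ.≃-sym (ℚᵘ.≃-trans (ℚ.toℚᵘ-homo-* ε (fromℕ r)) (ℚᵘ.*-congˡ {ℚ.toℚᵘ ε} (toℚᵘ-/ r 0))))
      (ℚᵘ.*≤* (subst₂ ℤ._≤_ (ℤ.pos-* (4 * levels r + 4 * r) (suc b * 1))
        (trans (ℤ.pos-* (suc a * r) (levels r)) (cong (ℤ._* (ℤ.+ levels r)) (ℤ.pos-* (suc a) r)))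
        (ℤ.+≤+ (small r N≤r))))))
  where
  -- With ε ≥ 1/(b + 1), the part 4 is at most εr/2 once r ≥ x, and the part 4r/j is at most εr/2
  -- once j ≥ x. Both hold for r ≥ 2^x.
  x = 8 * suc b
  small : ∀ r → 2 ^ x ≤ r → (4 * levels r + 4 * r) * (suc b * 1) ≤ suc a * r * levels r
  small r N≤r = *-cancelˡ-≤ 2 (begin
    2 * ((4 * j + 4 * r) * (suc b * 1)) ≡⟨ e₁ j r (suc b) ⟩
    8 * suc b * j + 8 * suc b * r ≤⟨ +-mono-≤ (*-monoˡ-≤ j x≤r) (*-monoˡ-≤ r x≤j) ⟩
    r * j + j * r ≡⟨ e₂ r j ⟩
    2 * (1 * r * j) ≤⟨ *-monoʳ-≤ 2 (*-monoˡ-≤ j (*-monoˡ-≤ r (s≤s {0} {a} z≤n))) ⟩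
    2 * (suc a * r * j) ∎)
    where
    j = levels r
    x≤r : x ≤ r
    x≤r = ≤-trans (n≤2^n x) N≤r
    x≤j : x ≤ j
    x≤j = ≤-trans (≤-reflexive (sym (⌊log₂[2^n]⌋≡n x))) (≤-trans (⌊log₂⌋-mono-≤ N≤r) (n≤1+n _))
    e₁ : ∀ j r b → 2 * ((4 * j + 4 * r) * (b * 1)) ≡ 8 * b * j + 8 * b * r
    e₁ = solve-∀
    e₂ : ∀ r j → r * j + j * r ≡ 2 * (1 * r * j)
    e₂ = solve-∀

shift-LittleO : (h x : ℕ → ℚ) → (∀ r → 0ℚ ℚ.≤ x r) →
  (∀ ε → 0ℚ ℚ.< ε → ∃ λ N → ∀ r → N ≤ r → x r ℚ.≤ ε ℚ.* fromℕ r) → LittleO (λ r → h r ℚ.+ x r ℚ.- h r)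
shift-LittleO h x 0≤x small ε 0<ε = proj₁ (small ε 0<ε) , λ r N≤r →
  ℚ.≤-trans (ℚ.≤-reflexive (trans (cong ℚ.∣_∣ (cancel (h r) (x r))) (ℚ.0≤p⇒∣p∣≡p (0≤x r)))) (proj₂ (small ε 0<ε) r N≤r)
  where
  cancel : ∀ h x → h ℚ.+ x ℚ.- h ≡ x
  cancel h x = trans (cong (ℚ._- h) (ℚ.+-comm h x))
    (trans (ℚ.+-assoc x h (ℚ.- h)) (trans (cong (x ℚ.+_) (ℚ.+-inverseʳ h)) (ℚ.+-identityʳ x)))

0≤excess : ∀ r → 0ℚ ℚ.≤ excess r
0≤excess r = ℚ.nonNegative⁻¹ (excess r) {{ℚ.normalize-nonNeg (4 * levels r + 4 * r) (levels r)}}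

sizeThreshold-LittleO : LittleO (λ r → sizeThreshold r ℚ.- ½ ℚ.* fromℕ r)
sizeThreshold-LittleO = shift-LittleO (λ r → ½ ℚ.* fromℕ r) excess 0≤excess excess-LittleO

-- The three ranges of the smallest size

module _ {m r : ℕ} (1≤r : 1 ≤ r) (r≤n : r ≤ suc m) {p : Vec ℕ (suc m)} (sorted : Linked _≤_ p) (A B : Family p) where

  large-sizes : CrossIntersecting r A B → r + 1 < head p →
    (card A * card B ≤ productOfSquaresAfter r p) ×
    (card A * card B ≡ productOfSquaresAfter r p → A ≗ B × ObtainedByFixing r A)
  large-sizes c r+1<c =
      subst (card A * card B ≤_) (sym (productOfSquaresAfter≡ r p)) (cross-bound r<c A B c)
    , λ eq → conclude (equality r<c A B c (trans eq (productOfSquaresAfter≡ r p)))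
    where
    2+r≤c : 2 + r ≤ head p
    2+r≤c = subst (λ k → suc k ≤ head p) (+-comm r 1) r+1<c
    r<c : r < head p
    r<c = ≤-trans (n≤1+n (suc r)) 2+r≤c
    open Classified 1≤r r≤n sorted (sizeable-2+ 1≤r 2+r≤c)
      (λ i → steep-2+ {r} {lookup p i} 1≤r (≤-trans 2+r≤c (head≤lookup p sorted i)))
    conclude : A ≗ B × (ObtainedByFixing r A ⊎ UnitBall r A) → A ≗ B × ObtainedByFixing r A
    conclude (A≗B , inj₁ fixed) = A≗B , fixed
    conclude (A≗B , inj₂ ball)  = contradiction ball (no-unit-ball r<c {A} r+1<c)

  critical-sizes : CrossIntersecting r A B → head p ≡ r + 1 → r + 1 > 4 →
    (card A * card B ≤ productOfSquaresAfter r p) ×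
    (card A * card B ≡ productOfSquaresAfter r p → A ≗ B × (ObtainedByFixing r A ⊎ UnitBall r A))
  critical-sizes c c≡r+1 4<r+1 =
      subst (card A * card B ≤_) (sym (productOfSquaresAfter≡ r p)) (cross-bound r<c A B c)
    , λ eq → equality r<c A B c (trans eq (productOfSquaresAfter≡ r p))
    where
    5≤c : 5 ≤ head p
    5≤c = subst (5 ≤_) (sym c≡r+1) 4<r+1
    r<c : r < head p
    r<c = ≤-reflexive (trans (+-comm 1 r) (sym c≡r+1))
    open Classified 1≤r r≤n sorted (sizeable-4+ (≤-trans (n≤1+n 4) 5≤c) r<c)
      (λ i → steep-5+ {r} {lookup p i} (≤-trans 5≤c (head≤lookup p sorted i)) (≤-trans r<c (head≤lookup p sorted i)))

  half-sizes : sizeThreshold r ℚ.≤ fromℕ (head p) → Maximal r A B →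
    Σ (Subset (suc m)) λ R → ∣ R ∣ ≤ r + 3 × IsHammingBall R A × IsHammingBall R B
  half-sizes t≤c = hamming-balls
    where
    j = levels r
    cleared : 8 * r + j * (r + 8) ≤ j * (2 * head p)
    cleared = sizeThreshold≤⇒ {r} {head p} t≤c
    open Classified 1≤r r≤n sorted
      (sizeable-half 1≤r (*-cancelˡ-≤ j (≤-trans (m≤n+m (j * (r + 8)) (8 * r)) cleared)))
      (λ i → steep-log {r} {lookup p i} {j} (s≤s z≤n) (≤-trans cleared (*-monoʳ-≤ j (*-monoʳ-≤ 2 (head≤lookup p sorted i))))
        (*-monoʳ-≤ 2 (2^⌊log₂n⌋≤n r 1≤r)))

theorem7 :
    Σ (ℕ → ℚ) λ t →
      LittleO (λ r → t r ℚ.- ½ ℚ.* fromℕ r) ×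
      (∀ (m : ℕ) → let n = suc m in
       ∀ (r : ℕ) → 1 ≤ r → r ≤ n →
       ∀ (p : Vec ℕ n) → IsSizeVector p → Linked _≤_ p →
       ∀ (A B : Family p) → CrossIntersecting r A B →
         (head p > r + 1 →
           (card A * card B ≤ productOfSquaresAfter r p) ×
           (card A * card B ≡ productOfSquaresAfter r p →
             A ≗ B × ObtainedByFixing r A)) ×
         (head p ≡ r + 1 → r + 1 > 4 →
           (card A * card B ≤ productOfSquaresAfter r p) ×
           (card A * card B ≡ productOfSquaresAfter r p →
             A ≗ B ×
             (ObtainedByFixing r A ⊎
              (Σ (Subset n) λ T →
                ∣ T ∣ ≡ r + 2 ×
                (∀ i → i ∈ T → lookup p i ≡ r + 1) ×
                IsHammingBallOfRadius 1 T A)))) ×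
         (t r ℚ.≤ fromℕ (head p) → Maximal r A B →
           Σ (Subset n) λ T →
             ∣ T ∣ ≤ r + 3 × IsHammingBall T A × IsHammingBall T B))
theorem7 = sizeThreshold , sizeThreshold-LittleO , λ m r 1≤r r≤n p _ sorted A B c →
    large-sizes 1≤r r≤n sorted A B c , critical-sizes 1≤r r≤n sorted A B c , half-sizes 1≤r r≤n sorted A B
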